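{- For all integers $k\ge1$ and $n\ge0$, $$e_6(5^kn+\delta_{5,k})\equiv0\pmod{5^{2k}}.$$
   Context: $q=e^{2\pi i\tau}$, $(q;q)_\infty=\prod_{n\ge1}(1-q^n)$, $E_6(\tau)=1-504\sum_{n\ge1}\sigma_5(n)q^n$ with $\sigma_5(n)=\sum_{d\mid n}d^5$. The numbers $e_6(n)$ are defined by $\sum_{n\ge0}e_6(n)q^n=E_6(\tau)/(q;q)_\infty$. For a prime $\ell\ge5$ and $k\ge1$, $\delta_{\ell,k}$ is the integer with $0<\delta_{\ell,k}<\ell^k$ and $24\delta_{\ell,k}\equiv1\pmod{\ell^k}$. -}

module Defs where

open import Data.Nat as ℕ using (ℕ; zero; suc)
open import Data.Integer using (ℤ; +_; _+_; _*_; -_; _-_)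
open import Data.List using (List; []; _∷_; map; upTo; filter; foldr)
open import Data.Nat.Divisibility using (_∣?_)
open import Relation.Nullary using (yes; no)

sumℤ : List ℤ → ℤ
sumℤ = foldr _+_ (+ 0)

sumℕ : List ℕ → ℕ
sumℕ = foldr ℕ._+_ 0

-- Formal power series over ℤ, given by coefficient functions: f n = coefficient of q^n.
Series : Set
Series = ℕ → ℤ

_⊛_ : Series → Series → Series
(f ⊛ g) n = sumℤ (map (λ i → f i * g (n ℕ.∸ i)) (upTo (suc n)))

-- The series 1 - q^k  (used for k ≥ 1)
oneMinusQ^ : ℕ → Series
oneMinusQ^ k zero = + 1
oneMinusQ^ k (suc m) with suc m ℕ.≟ k
... | yes _ = - (+ 1)
... | no _ = + 0

partialEuler : ℕ → Series
partialEuler zero zero = + 1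
partialEuler zero (suc n) = + 0
partialEuler (suc N) = partialEuler N ⊛ oneMinusQ^ (suc N)

-- (q;q)_∞ = ∏_{n≥1}(1-q^n): its coefficient of q^n equals that of the
-- finite product ∏_{k=1}^{n}(1-q^k), since later factors are 1 + O(q^{n+1}).
euler : Series
euler n = partialEuler n n

-- Multiplicative inverse of a power series with constant term 1:
-- a 0 = 1,  a n = - Σ_{m=1}^{n} c m * a (n - m).
-- Defined via the list of all earlier coefficients (structural recursion).
private
  -- invUpTo c n = [a n, a (n-1), ..., a 0]
  invUpTo : Series → ℕ → List ℤ
  invUpTo c zero = + 1 ∷ []
  invUpTo c (suc n) = next ∷ prev
    where
      prev : List ℤ
      prev = invUpTo c n
      go : ℕ → List ℤ → ℤ
      go m [] = + 0
      go m (x ∷ xs) = c m * x + go (suc m) xs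
      next : ℤ
      next = - go 1 prev

  head0 : List ℤ → ℤ
  head0 [] = + 0
  head0 (x ∷ _) = x

-- Inverse series (assumes constant term 1)
inverse : Series → Series
inverse c n = head0 (invUpTo c n)

invEuler : Series
invEuler = inverse euler

σ₅ : ℕ → ℕ
σ₅ n = sumℕ (map (λ d → d ℕ.^ 5) (filter (λ d → d ∣? n) (map suc (upTo n))))

E₆ : Series
E₆ zero = + 1
E₆ (suc n) = - (+ 504 * + σ₅ (suc n))

e₆ : ℕ → ℤ
e₆ = E₆ ⊛ invEuler

{-# OPTIONS --safe #-}
-- Write D = q d/dq, U for Σ a(n) q^n ↦ Σ a(5n) q^n and V for f(q) ↦ f(q^5), and put E = (q;q)_∞,
-- t = η(5τ)^6/η(τ)^6, P = η(τ)^5/η(5τ), y = η(25τ)/η(τ) and 𝓔 = D t/t. Then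
-- E₆ = 𝓔 P^2 (1 - 500 t - 15625 t^2), and the generating functions of e₆ along the progressions arise from E₆
-- by applying f ↦ U (y f) and f ↦ U f in turn. Because y^5 = V(t) (1 + 5y + 15y^2 + 25y^3 + 25y^4), the series
-- U (𝓔 y^i) obey a linear recurrence, from which both maps send the ℤ-span of the 𝓔 P^2 (5t)^l, l ≥ 1, into
-- 25 times itself; each step thus gains a factor 5^2.
--
-- No analysis is needed. The Taylor coefficients at z = 1 of the Jacobi triple product express E₆ as a differential
-- polynomial in G = Σ σ(n) q^n = - D E / E. The pentagonal number theorem, together with the absence of exponents
-- ≡ 2 mod 5 in Jacobi's series for E^3, gives E = A (1 - r - r^2) with r the Rogers–Ramanujan continued fraction at q^5
-- and A a series in q^5. This turns the relations between levels 1, 5 and 25 into polynomial identities in r, once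
-- modular forms are identified by the remark that f = c V(f) and f(0) = 0 force f = 0.
module Submission where

-- The obstacle is that U is transparent only on powers of `y`, or polynomials in `r`, times series
-- in q^5, whereas 𝓔 P^2 t^l carries the factor P^2. The relations P t = V(P) y and y^6 = V(t) t
-- remove it: each P absorbs one t and becomes a series in q^5, and the remaining powers of t become
-- powers of y. For l >= 2 the action of U is therefore that on 𝓔 y^i. For l <= 1 there are too few
-- factors t, and the images are computed directly from expressions in `r`.
--
-- The coefficient of y^κ in the modular equation, one of 1, 5, 15, 25, 25, has 5-adic valuation at
-- least κ/2. This dictates the half-integral slope in `Lattice`, and the gain of 25 is what this
-- slope leaves over after division by t^j.
--
-- E₆ itself has a term with l = 0 and lies outside the span, so its first image gains only one
-- factor 5. The missing factor comes at the end, because every element of the span is divisible by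
-- 5 as a power series: after K steps the exponent is (2K - 1) + 1.

module PowersOfFive where

  open import Defs
  open import Algebra.Bundles using (CommutativeRing; RawRing)
  import Algebra.Solver.Ring as RingSolver
  open import Algebra.Solver.Ring.AlmostCommutativeRing using (fromCommutativeRing; _-Raw-AlmostCommutative⟶_)
  open import Algebra.Structures using (IsCommutativeRing)
  open import Data.Bool using (Bool; true; T; _∧_)
  open import Data.Empty using (⊥-elim)
  open import Data.Fin using (Fin; _↑ʳ_; _↑ˡ_)
  open import Data.Fin.Patterns using (0F; 1F; 2F; 3F; 4F)
  open import Data.Integer as ℤ using (ℤ; +_; -[1+_])
  import Data.Integer.Divisibility as ℤᵈ
  import Data.Integer.Properties as ℤₚ
  open import Data.Integer.Tactic.RingSolver using (solve-∀)
  open import Data.List using (List; []; _∷_; map; filter; applyUpTo)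
  open import Data.List.Properties using (map-upTo; filter-accept; filter-reject)
  open import Data.Maybe using (Maybe; just; nothing)
  open import Data.Nat as ℕ using (ℕ; zero; suc; z≤n; s≤s)
  open import Data.Nat.Divisibility as ℕᵈ using (_∣_; divides; _∣?_; ∣m+n∣m⇒∣n; ∣m⇒∣m*n; ∣n⇒∣m*n; m∣m*n)
  import Data.Nat.DivMod as ℕᵐ
  import Data.Nat.Induction as ℕᵢ
  import Data.Nat.Properties as ℕₚ
  import Data.Nat.Tactic.RingSolver as ℕˢ
  open import Data.Product using (∃; _×_; _,_)
  open import Data.Vec as Vec using (Vec; []; _∷_; _++_; lookup)
  open import Data.Vec.Properties using (lookup-map; lookup-++ˡ; lookup-++ʳ)
  open import Function using (_∘_)
  open import Level using (0ℓ)
  open import Relation.Binary.PropositionalEquality as ≡ using (_≡_; _≢_; refl; sym; trans; cong; cong₂; module ≡-Reasoning)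
  open import Relation.Nullary using (¬_; yes; no; does)

  -- The ring of integer power series

  tail : Series → Series
  tail f n = f (suc n)

  -- The Cauchy product by recursion, so that the ring laws go by induction; `⊛-conv` ties it to the
  -- list sum of `⊛`.
  conv : Series → Series → Series
  conv f g zero = f 0 ℤ.* g 0
  conv f g (suc n) = f 0 ℤ.* g (suc n) ℤ.+ conv (tail f) g n

  conv-cong : ∀ {f f′ g g′} n → (∀ m → m ℕ.≤ n → f m ≡ f′ m) → (∀ m → m ℕ.≤ n → g m ≡ g′ m) →
              conv f g n ≡ conv f′ g′ n
  conv-cong zero p q = cong₂ ℤ._*_ (p 0 z≤n) (q 0 z≤n)
  conv-cong (suc n) p q = cong₂ ℤ._+_ (cong₂ ℤ._*_ (p 0 z≤n) (q (suc n) ℕₚ.≤-refl))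
    (conv-cong n (λ m m≤n → p (suc m) (s≤s m≤n)) (λ m m≤n → q m (ℕₚ.m≤n⇒m≤1+n m≤n)))

  conv-sucʳ : ∀ f g n → conv f g (suc n) ≡ conv f (tail g) n ℤ.+ f (suc n) ℤ.* g 0
  conv-sucʳ f g zero = refl
  conv-sucʳ f g (suc n) = trans (cong (λ z → (f 0 ℤ.* g (suc (suc n))) ℤ.+ z) (conv-sucʳ (tail f) g n))
    (sym (ℤₚ.+-assoc (f 0 ℤ.* g (suc (suc n))) _ _))

  conv-comm : ∀ f g n → conv f g n ≡ conv g f n
  conv-comm f g zero = ℤₚ.*-comm (f 0) (g 0)
  conv-comm f g (suc n) = begin
    f 0 ℤ.* g (suc n) ℤ.+ conv (tail f) g n  ≡⟨ cong₂ ℤ._+_ (ℤₚ.*-comm (f 0) (g (suc n))) (conv-comm (tail f) g n) ⟩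
    g (suc n) ℤ.* f 0 ℤ.+ conv g (tail f) n  ≡⟨ ℤₚ.+-comm (g (suc n) ℤ.* f 0) _ ⟩
    conv g (tail f) n ℤ.+ g (suc n) ℤ.* f 0  ≡⟨ conv-sucʳ g f n ⟨
    conv g f (suc n) ∎
    where open ≡-Reasoning

  conv-distribʳ : ∀ f g h n → conv (λ i → f i ℤ.+ g i) h n ≡ conv f h n ℤ.+ conv g h n
  conv-distribʳ f g h zero = ℤₚ.*-distribʳ-+ (h 0) (f 0) (g 0)
  conv-distribʳ f g h (suc n) =
    trans (cong (λ z → ((f 0 ℤ.+ g 0) ℤ.* h (suc n)) ℤ.+ z) (conv-distribʳ (tail f) (tail g) h n))
          (rearrange (f 0) (g 0) (h (suc n)) (conv (tail f) h n) (conv (tail g) h n))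
    where
    rearrange : ∀ a b c x y → (a ℤ.+ b) ℤ.* c ℤ.+ (x ℤ.+ y) ≡ (a ℤ.* c ℤ.+ x) ℤ.+ (b ℤ.* c ℤ.+ y)
    rearrange = solve-∀

  conv-scale : ∀ k f h n → conv (λ i → k ℤ.* f i) h n ≡ k ℤ.* conv f h n
  conv-scale k f h zero = ℤₚ.*-assoc k (f 0) (h 0)
  conv-scale k f h (suc n) = trans (cong (λ z → (k ℤ.* f 0 ℤ.* h (suc n)) ℤ.+ z) (conv-scale k (tail f) h n))
    (rearrange k (f 0) (h (suc n)) _)
    where
    rearrange : ∀ a b c x → a ℤ.* b ℤ.* c ℤ.+ a ℤ.* x ≡ a ℤ.* (b ℤ.* c ℤ.+ x)
    rearrange = solve-∀

  conv-assoc : ∀ f g h n → conv (conv f g) h n ≡ conv f (conv g h) n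
  conv-assoc f g h zero = ℤₚ.*-assoc (f 0) (g 0) (h 0)
  conv-assoc f g h (suc n) = begin
    f 0 ℤ.* g 0 ℤ.* h (suc n) ℤ.+ conv (tail (conv f g)) h n
      ≡⟨ cong (λ z → (f 0 ℤ.* g 0 ℤ.* h (suc n)) ℤ.+ z) (trans (conv-distribʳ (λ i → f 0 ℤ.* tail g i) (conv (tail f) g) h n)
           (cong₂ ℤ._+_ (conv-scale (f 0) (tail g) h n) (conv-assoc (tail f) g h n))) ⟩
    f 0 ℤ.* g 0 ℤ.* h (suc n) ℤ.+ (f 0 ℤ.* conv (tail g) h n ℤ.+ conv (tail f) (conv g h) n)
      ≡⟨ rearrange (f 0) (g 0) (h (suc n)) _ _ ⟩
    f 0 ℤ.* (g 0 ℤ.* h (suc n) ℤ.+ conv (tail g) h n) ℤ.+ conv (tail f) (conv g h) n ∎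
    where
    open ≡-Reasoning
    rearrange : ∀ a b c x y → a ℤ.* b ℤ.* c ℤ.+ (a ℤ.* x ℤ.+ y) ≡ a ℤ.* (b ℤ.* c ℤ.+ x) ℤ.+ y
    rearrange = solve-∀

  ⊛-conv : ∀ f g n → (f ⊛ g) n ≡ conv f g n
  ⊛-conv f g n = trans (cong sumℤ (map-upTo (λ i → f i ℤ.* g (n ℕ.∸ i)) (suc n))) (go f n)
    where
    go : ∀ f n → sumℤ (applyUpTo (λ i → f i ℤ.* g (n ℕ.∸ i)) (suc n)) ≡ conv f g n
    go f zero = ℤₚ.+-identityʳ _
    go f (suc n) = cong (λ z → (f 0 ℤ.* g (suc n)) ℤ.+ z) (go (tail f) n)

  infix 4 _≈_
  record _≈_ (f g : Series) : Set where
    constructor coeffwise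
    field coeff : ∀ n → f n ≡ g n
  open _≈_ public

  infixl 6 _+_
  infixl 7 _*_
  infix 8 -_

  opaque
    _+_ _*_ : Series → Series → Series
    (f + g) n = f n ℤ.+ g n
    _*_ = conv

    -_ : Series → Series
    (- f) n = ℤ.- f n

    ι : ℤ → Series
    ι z zero = z
    ι z (suc n) = + 0

    -‿coeff : ∀ f n → (- f) n ≡ ℤ.- f n
    -‿coeff f n = refl

    ι-coeff-0 : ∀ z → ι z 0 ≡ z
    ι-coeff-0 z = refl

    ι-coeff-suc : ∀ z n → ι z (suc n) ≡ + 0
    ι-coeff-suc z n = refl

    ⊛≈* : ∀ f g → (f ⊛ g) ≈ (f * g)
    ⊛≈* f g = coeffwise (⊛-conv f g)

    ι-* : ∀ z f n → (ι z * f) n ≡ z ℤ.* f n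
    ι-* z f zero = refl
    ι-* z f (suc n) = trans (cong (λ w → (z ℤ.* f (suc n)) ℤ.+ w) (zeros n f)) (ℤₚ.+-identityʳ _)
      where
      zeros : ∀ n f → conv (λ _ → + 0) f n ≡ + 0
      zeros zero f = refl
      zeros (suc n) f = trans (ℤₚ.+-identityˡ _) (zeros n f)

    ι-+-homo : ∀ a b → ι (a ℤ.+ b) ≈ ι a + ι b
    ι-+-homo a b = coeffwise λ { zero → refl ; (suc n) → refl }

    ι-*-homo : ∀ a b → ι (a ℤ.* b) ≈ ι a * ι b
    ι-*-homo a b = coeffwise λ { zero → refl ; (suc n) → sym (trans (ι-* a (ι b) (suc n)) (ℤₚ.*-zeroʳ a)) }

    ι-‿-homo : ∀ a → ι (ℤ.- a) ≈ - ι a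
    ι-‿-homo a = coeffwise λ { zero → refl ; (suc n) → refl }

  ≈-refl : ∀ {f} → f ≈ f
  ≈-refl = coeffwise λ n → refl

  ≈-sym : ∀ {f g} → f ≈ g → g ≈ f
  ≈-sym p = coeffwise λ n → sym (coeff p n)

  ≈-trans : ∀ {f g h} → f ≈ g → g ≈ h → f ≈ h
  ≈-trans p q = coeffwise λ n → trans (coeff p n) (coeff q n)

  opaque
    unfolding _+_
    isCommutativeRing : IsCommutativeRing _≈_ _+_ _*_ -_ (ι (+ 0)) (ι (+ 1))
    isCommutativeRing = record
        { isRing = record
          { +-isAbelianGroup = record
            { isGroup = record
              { isMonoid = record
                { isSemigroup = record
                  { isMagma = record
                    { isEquivalence = record { refl = ≈-refl ; sym = ≈-sym ; trans = ≈-trans }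
                    ; ∙-cong = λ p q → coeffwise λ n → cong₂ ℤ._+_ (coeff p n) (coeff q n)
                    }
                  ; assoc = λ f g h → coeffwise λ n → ℤₚ.+-assoc (f n) (g n) (h n)
                  }
                ; identity = (λ f → coeffwise λ { zero → ℤₚ.+-identityˡ (f 0) ; (suc n) → ℤₚ.+-identityˡ (f (suc n)) })
                           , (λ f → coeffwise λ { zero → ℤₚ.+-identityʳ (f 0) ; (suc n) → ℤₚ.+-identityʳ (f (suc n)) })
                }
              ; inverse = (λ f → coeffwise λ { zero → ℤₚ.+-inverseˡ (f 0) ; (suc n) → ℤₚ.+-inverseˡ (f (suc n)) })
                        , (λ f → coeffwise λ { zero → ℤₚ.+-inverseʳ (f 0) ; (suc n) → ℤₚ.+-inverseʳ (f (suc n)) })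
              ; ⁻¹-cong = λ p → coeffwise λ n → cong ℤ.-_ (coeff p n)
              }
            ; comm = λ f g → coeffwise λ n → ℤₚ.+-comm (f n) (g n)
            }
          ; *-cong = λ p q → coeffwise λ n → conv-cong n (λ m _ → coeff p m) (λ m _ → coeff q m)
          ; *-assoc = λ f g h → coeffwise (conv-assoc f g h)
          ; *-identity = (λ f → coeffwise λ n → trans (ι-* (+ 1) f n) (ℤₚ.*-identityˡ (f n)))
                       , (λ f → coeffwise λ n → trans (conv-comm f (ι (+ 1)) n) (trans (ι-* (+ 1) f n) (ℤₚ.*-identityˡ (f n))))
          ; distrib = (λ f g h → coeffwise λ n → trans (conv-comm f _ n) (trans (conv-distribʳ g h f n)
                        (cong₂ ℤ._+_ (conv-comm g f n) (conv-comm h f n))))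
                    , (λ f g h → coeffwise (conv-distribʳ g h f))
          }
        ; *-comm = λ f g → coeffwise (conv-comm f g)
        }

  seriesRing : CommutativeRing 0ℓ 0ℓ
  seriesRing = record { isCommutativeRing = isCommutativeRing }

  open CommutativeRing seriesRing
    using (+-cong; *-cong; -‿cong; *-congˡ; *-congʳ; +-congˡ; +-congʳ; *-comm; *-assoc; *-identityˡ; zeroˡ; zeroʳ; +-identityʳ; +-identityˡ; setoid; _-_)

  open import Algebra.Properties.Semiring.Exp (CommutativeRing.semiring seriesRing) using (_^_)
  import Relation.Binary.Reasoning.Setoid setoid as ≈R

  ℤ-rawRing : RawRing _ _
  ℤ-rawRing = CommutativeRing.rawRing ℤₚ.+-*-commutativeRing

  ι-morphism : ℤ-rawRing -Raw-AlmostCommutative⟶ fromCommutativeRing seriesRing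
  ι-morphism = record
    { ⟦_⟧ = ι ; +-homo = ι-+-homo ; *-homo = ι-*-homo ; -‿homo = ι-‿-homo ; 0-homo = ≈-refl ; 1-homo = ≈-refl }

  ι-cong? : ∀ a b → Maybe (ι a ≈ ι b)
  ι-cong? a b with a ℤₚ.≟ b
  ... | yes refl = just ≈-refl
  ... | no _ = nothing

  open RingSolver ℤ-rawRing (fromCommutativeRing seriesRing) ι-morphism ι-cong?
    using (solve; _:=_; _:+_; _:*_; _:-_; :-_; _:^_; con; var; op; [+]; [*]; Polynomial; ⟦_⟧)

  # : ∀ {n} → ℕ → Polynomial n
  # k = con (+ k)

  infixr 0 _▸_ _▸⁺_ _▸⁻_

  -- Linear combinations: hypotheses a ≈ b reduce f ≈ g to a ring identity f = g + Σ c (a - b).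
  _▸_ : ∀ {c a b f g} → a ≈ b → f ≈ g + c * (a - b) → f ≈ g
  _▸_ {c} {a} {b} {f} {g} a≈b p = begin
    f                    ≈⟨ p ⟩
    g + c * (a - b)      ≈⟨ +-congˡ (*-congˡ (+-congʳ a≈b)) ⟩
    g + c * (b - b)      ≈⟨ solve 3 (λ g c b → g :+ c :* (b :- b) := g) ≈-refl g c b ⟩
    g                    ∎
    where open ≈R

  _▸⁺_ : ∀ {a b f g} → a ≈ b → f ≈ g + (a - b) → f ≈ g
  _▸⁺_ {a} {b} a≈b p = a≈b ▸ ≈-trans p (+-congˡ (≈-sym (*-identityˡ (a - b))))

  _▸⁻_ : ∀ {a b f g} → a ≈ b → f ≈ g - (a - b) → f ≈ g
  _▸⁻_ {a} {b} {f} {g} a≈b p = ≈-sym a≈b ▸⁺ ≈-trans p (solve 3 (λ g a b → g :- (a :- b) := g :+ (b :- a)) ≈-refl g a b)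

  -- Agreement up to a given degree, and monomials

  infix 4 _≈[_]_
  record _≈[_]_ (f : Series) (N : ℕ) (g : Series) : Set where
    constructor below
    field coeff≤ : ∀ m → m ℕ.≤ N → f m ≡ g m
  open _≈[_]_ public

  module _ {N : ℕ} where
    ≈⇒≈[] : ∀ {f g} → f ≈ g → f ≈[ N ] g
    ≈⇒≈[] p = below λ m _ → coeff p m

    []-sym : ∀ {f g} → f ≈[ N ] g → g ≈[ N ] f
    []-sym p = below λ m m≤N → sym (coeff≤ p m m≤N)

    []-trans : ∀ {f g h} → f ≈[ N ] g → g ≈[ N ] h → f ≈[ N ] h
    []-trans p q = below λ m m≤N → trans (coeff≤ p m m≤N) (coeff≤ q m m≤N)

    opaque
      unfolding _+_
      []-+ : ∀ {f f′ g g′} → f ≈[ N ] f′ → g ≈[ N ] g′ → f + g ≈[ N ] f′ + g′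
      []-+ p q = below λ m m≤N → cong₂ ℤ._+_ (coeff≤ p m m≤N) (coeff≤ q m m≤N)

      []-* : ∀ {f f′ g g′} → f ≈[ N ] f′ → g ≈[ N ] g′ → f * g ≈[ N ] f′ * g′
      []-* p q = below λ m m≤N → conv-cong m (λ i i≤m → coeff≤ p i (ℕₚ.≤-trans i≤m m≤N))
                                             (λ i i≤m → coeff≤ q i (ℕₚ.≤-trans i≤m m≤N))

  []-limit : ∀ {f g} → (∀ N → f ≈[ N ] g) → f ≈ g
  []-limit p = coeffwise λ n → coeff≤ (p n) n ℕₚ.≤-refl

  mono : ℕ → Series
  mono zero zero = + 1
  mono zero (suc n) = + 0
  mono (suc k) zero = + 0
  mono (suc k) (suc n) = mono k n

  mono-diag : ∀ k → mono k k ≡ + 1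
  mono-diag zero = refl
  mono-diag (suc k) = mono-diag k

  mono-off : ∀ k n → k ≢ n → mono k n ≡ + 0
  mono-off zero zero p = ⊥-elim (p refl)
  mono-off zero (suc n) p = refl
  mono-off (suc k) zero p = refl
  mono-off (suc k) (suc n) p = mono-off k n (λ e → p (cong suc e))

  opaque
    unfolding _+_
    mono-0 : mono 0 ≈ ι (+ 1)
    mono-0 = coeffwise λ { zero → refl ; (suc n) → refl }

    mono-suc-*-0 : ∀ k f → (mono (suc k) * f) 0 ≡ + 0
    mono-suc-*-0 k f = refl

    mono-suc-*-suc : ∀ k f n → (mono (suc k) * f) (suc n) ≡ (mono k * f) n
    mono-suc-*-suc k f n = ℤₚ.+-identityˡ _

  mono-0-* : ∀ f n → (mono 0 * f) n ≡ f n
  mono-0-* f n = coeff (≈-trans (*-congʳ mono-0) (*-identityˡ f)) n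

  mono-* : ∀ a b → mono a * mono b ≈ mono (a ℕ.+ b)
  mono-* a b = coeffwise (go a b)
    where
    go : ∀ a b n → (mono a * mono b) n ≡ mono (a ℕ.+ b) n
    go zero b n = mono-0-* (mono b) n
    go (suc a) b zero = mono-suc-*-0 a (mono b)
    go (suc a) b (suc n) = trans (mono-suc-*-suc a (mono b) n) (go a b n)

  mono-small : ∀ {N k} f → N ℕ.< k → mono k * f ≈[ N ] ι (+ 0)
  mono-small f N<k = below λ m m≤N → trans (go _ m (ℕₚ.≤-<-trans m≤N N<k)) (sym (zeros m))
    where
    zeros : ∀ n → ι (+ 0) n ≡ + 0
    zeros zero = ι-coeff-0 _
    zeros (suc n) = ι-coeff-suc _ n
    go : ∀ k m → m ℕ.< k → (mono k * f) m ≡ + 0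
    go (suc k) zero _ = mono-suc-*-0 k f
    go (suc k) (suc m) (s≤s m<k) = trans (mono-suc-*-suc k f m) (go k m m<k)

  ι0-coeff : ∀ n → ι (+ 0) n ≡ + 0
  ι0-coeff zero = ι-coeff-0 _
  ι0-coeff (suc n) = ι-coeff-suc _ n

  -- The derivation q d/dq and the substitutions q ↦ q^(k+1)

  opaque
    D : Series → Series
    D f n = + n ℤ.* f n

    D-coeff : ∀ f n → D f n ≡ + n ℤ.* f n
    D-coeff f n = refl

    D-cong : ∀ {f g} → f ≈ g → D f ≈ D g
    D-cong p = coeffwise λ n → cong (+ n ℤ.*_) (coeff p n)

    D-[] : ∀ {N f g} → f ≈[ N ] g → D f ≈[ N ] D g
    D-[] p = below λ n n≤N → cong (+ n ℤ.*_) (coeff≤ p n n≤N)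

    D-mono : ∀ k → D (mono k) ≈ ι (+ k) * mono k
    D-mono k = coeffwise λ n → trans (go n) (sym (ι-* (+ k) (mono k) n))
      where
      go : ∀ n → + n ℤ.* mono k n ≡ + k ℤ.* mono k n
      go n with k ℕₚ.≟ n
      ... | yes refl = refl
      ... | no k≢n rewrite mono-off k n k≢n = trans (ℤₚ.*-zeroʳ (+ n)) (sym (ℤₚ.*-zeroʳ (+ k)))

  opaque
    unfolding _+_ D
    D-+ : ∀ f g → D (f + g) ≈ D f + D g
    D-+ f g = coeffwise λ n → ℤₚ.*-distribˡ-+ (+ n) (f n) (g n)

    D-neg : ∀ f → D (- f) ≈ - D f
    D-neg f = coeffwise λ n → sym (ℤₚ.neg-distribʳ-* (+ n) (f n))

    D-ι : ∀ z → D (ι z) ≈ ι (+ 0)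
    D-ι z = coeffwise λ { zero → refl ; (suc n) → ℤₚ.*-zeroʳ (+ suc n) }

    D-* : ∀ f g → D (f * g) ≈ D f * g + f * D g
    D-* f g = coeffwise (go f g)
      where
      open ≡-Reasoning
      spread : ∀ n a b x → (+ 1 ℤ.+ n) ℤ.* (a ℤ.* b ℤ.+ x) ≡ a ℤ.* ((+ 1 ℤ.+ n) ℤ.* b) ℤ.+ (n ℤ.* x ℤ.+ x)
      spread = solve-∀
      regroup : ∀ p x y z → p ℤ.+ ((y ℤ.+ z) ℤ.+ x) ≡ (+ 0 ℤ.+ (y ℤ.+ x)) ℤ.+ (p ℤ.+ z)
      regroup = solve-∀
      expand : ∀ n a → n ℤ.* a ℤ.+ a ≡ (+ 1 ℤ.+ n) ℤ.* a
      expand = solve-∀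
      go : ∀ f g n → + n ℤ.* conv f g n ≡ conv (D f) g n ℤ.+ conv f (D g) n
      go f g zero = sym (trans (ℤₚ.+-identityˡ _) (ℤₚ.*-zeroʳ (f 0)))
      go f g (suc n) = begin
        + suc n ℤ.* (f 0 ℤ.* g (suc n) ℤ.+ conv (tail f) g n)
          ≡⟨ spread (+ n) (f 0) (g (suc n)) (conv (tail f) g n) ⟩
        p ℤ.+ (+ n ℤ.* conv (tail f) g n ℤ.+ conv (tail f) g n)
          ≡⟨ cong (λ w → p ℤ.+ (w ℤ.+ conv (tail f) g n)) (go (tail f) g n) ⟩
        p ℤ.+ ((conv (D (tail f)) g n ℤ.+ conv (tail f) (D g) n) ℤ.+ conv (tail f) g n)
          ≡⟨ regroup p (conv (tail f) g n) (conv (D (tail f)) g n) (conv (tail f) (D g) n) ⟩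
        (+ 0 ℤ.+ (conv (D (tail f)) g n ℤ.+ conv (tail f) g n)) ℤ.+ (p ℤ.+ conv (tail f) (D g) n)
          ≡⟨ cong (λ w → (+ 0 ℤ.+ w) ℤ.+ (p ℤ.+ conv (tail f) (D g) n)) split ⟩
        conv (D f) g (suc n) ℤ.+ conv f (D g) (suc n) ∎
        where
        p : ℤ
        p = f 0 ℤ.* (+ suc n ℤ.* g (suc n))
        split : conv (D (tail f)) g n ℤ.+ conv (tail f) g n ≡ conv (tail (D f)) g n
        split = trans (sym (conv-distribʳ (D (tail f)) (tail f) g n))
          (conv-cong n (λ m _ → expand (+ m) (f (suc m))) (λ _ _ → refl))

  -- dilate k j f is q^j f(q^(k+1)).
  dilate : ℕ → ℕ → Series → Series
  dilate k zero f zero = f 0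
  dilate k (suc j) f zero = + 0
  dilate k zero f (suc n) = dilate k k (tail f) n
  dilate k (suc j) f (suc n) = dilate k j f n

  dilate-cong′ : ∀ k j {f g} n → (∀ m → f m ≡ g m) → dilate k j f n ≡ dilate k j g n
  dilate-cong′ k zero zero p = p 0
  dilate-cong′ k (suc j) zero p = refl
  dilate-cong′ k zero (suc n) p = dilate-cong′ k k n (λ m → p (suc m))
  dilate-cong′ k (suc j) (suc n) p = dilate-cong′ k j n p

  dilate-cong : ∀ k j {f g} → f ≈ g → dilate k j f ≈ dilate k j g
  dilate-cong k j p = coeffwise λ n → dilate-cong′ k j n (coeff p)

  dilate-[] : ∀ {N f g} k j → f ≈[ N ] g → dilate k j f ≈[ N ] dilate k j g
  dilate-[] k j p = below λ m m≤N → go k j m λ i i≤m → coeff≤ p i (ℕₚ.≤-trans i≤m m≤N)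
    where
    go : ∀ {f g} k j n → (∀ m → m ℕ.≤ n → f m ≡ g m) → dilate k j f n ≡ dilate k j g n
    go k zero zero p = p 0 z≤n
    go k (suc j) zero p = refl
    go k zero (suc n) p = go k k n (λ m m≤n → p (suc m) (s≤s m≤n))
    go k (suc j) (suc n) p = go k j n (λ m m≤n → p m (ℕₚ.m≤n⇒m≤1+n m≤n))

  dilate-+′ : ∀ k j f g n → dilate k j (λ i → f i ℤ.+ g i) n ≡ dilate k j f n ℤ.+ dilate k j g n
  dilate-+′ k zero f g zero = refl
  dilate-+′ k (suc j) f g zero = refl
  dilate-+′ k zero f g (suc n) = dilate-+′ k k (tail f) (tail g) n
  dilate-+′ k (suc j) f g (suc n) = dilate-+′ k j f g n

  dilate-scale : ∀ k j z f n → dilate k j (λ i → z ℤ.* f i) n ≡ z ℤ.* dilate k j f n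
  dilate-scale k zero z f zero = refl
  dilate-scale k (suc j) z f zero = sym (ℤₚ.*-zeroʳ z)
  dilate-scale k zero z f (suc n) = dilate-scale k k z (tail f) n
  dilate-scale k (suc j) z f (suc n) = dilate-scale k j z f n

  dilate-shift : ∀ k j f n → dilate k j f (j ℕ.+ n) ≡ dilate k 0 f n
  dilate-shift k zero f n = refl
  dilate-shift k (suc j) f n = dilate-shift k j f n

  dilate-zero : ∀ k j n → dilate k j (λ _ → + 0) n ≡ + 0
  dilate-zero k zero zero = refl
  dilate-zero k (suc j) zero = refl
  dilate-zero k zero (suc n) = dilate-zero k k n
  dilate-zero k (suc j) (suc n) = dilate-zero k j n

  dilate-mono : ∀ k j f → mono j * dilate k 0 f ≈ dilate k j f
  dilate-mono k j f = coeffwise (go j)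
    where
    go : ∀ j n → (mono j * dilate k 0 f) n ≡ dilate k j f n
    go zero n = mono-0-* (dilate k 0 f) n
    go (suc j) zero = mono-suc-*-0 j _
    go (suc j) (suc n) = trans (mono-suc-*-suc j _ n) (go j n)

  opaque
    unfolding _+_
    dilate-+ : ∀ k j f g → dilate k j (f + g) ≈ dilate k j f + dilate k j g
    dilate-+ k j f g = coeffwise (dilate-+′ k j f g)

    dilate-* : ∀ k j f g → dilate k j (f * g) ≈ dilate k j f * dilate k 0 g
    dilate-* k j f g = coeffwise (go j f g)
      where
      go : ∀ j f g n → dilate k j (conv f g) n ≡ conv (dilate k j f) (dilate k 0 g) n
      go zero f g zero = refl
      go (suc j) f g zero = refl
      go (suc j) f g (suc n) = trans (go j f g n) (sym (ℤₚ.+-identityˡ _))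
      go zero f g (suc n) = trans (dilate-+′ k k (λ i → f 0 ℤ.* tail g i) (conv (tail f) g) n)
        (cong₂ ℤ._+_ (dilate-scale k k (f 0) (tail g) n) (go k (tail f) g n))

    dilate-ι : ∀ k z → dilate k 0 (ι z) ≈ ι z
    dilate-ι k z = coeffwise λ { zero → refl ; (suc n) → trans (dilate-cong′ k k n (λ m → refl)) (dilate-zero k k n) }

    dilate-neg : ∀ k j f → dilate k j (- f) ≈ - dilate k j f
    dilate-neg k j f = coeffwise λ n → trans (dilate-cong′ k j n (λ m → sym (ℤₚ.-1*i≡-i (f m))))
      (trans (dilate-scale k j -[1+ 0 ] f n) (ℤₚ.-1*i≡-i _))

  opaque
    unfolding D
    D-dilate : ∀ k f → D (dilate k 0 f) ≈ ι (+ suc k) * dilate k 0 (D f)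
    D-dilate k f = coeffwise λ n → trans (go 0 f n) (trans (ℤₚ.+-identityʳ _) (sym (ι-* (+ suc k) (dilate k 0 (D f)) n)))
      where
      expand : ∀ n a → (+ 1 ℤ.+ n) ℤ.* a ≡ n ℤ.* a ℤ.+ a
      expand = solve-∀
      assoc : ∀ b c a → (b ℤ.+ c ℤ.* a) ℤ.+ a ≡ b ℤ.+ (+ 1 ℤ.+ c) ℤ.* a
      assoc = solve-∀
      collect : ∀ k b a → k ℤ.* b ℤ.+ k ℤ.* a ≡ k ℤ.* (b ℤ.+ a) ℤ.+ + 0
      collect = solve-∀
      step : ∀ n a b c → n ℤ.* a ≡ b ℤ.+ c ℤ.* a → (+ 1 ℤ.+ n) ℤ.* a ≡ b ℤ.+ (+ 1 ℤ.+ c) ℤ.* a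
      step n a b c e = trans (expand n a) (trans (cong (ℤ._+ a) e) (assoc b c a))
      -- The term with `+ j` comes from the prefactor q^j of `dilate k j f`; the induction needs
      -- every j because `dilate` counts j down between two coefficients.
      go : ∀ j f n → + n ℤ.* dilate k j f n ≡ + suc k ℤ.* dilate k j (D f) n ℤ.+ + j ℤ.* dilate k j f n
      go zero f zero = sym (trans (ℤₚ.+-identityʳ _) (ℤₚ.*-zeroʳ (+ suc k)))
      go (suc j) f zero = sym (cong₂ ℤ._+_ (ℤₚ.*-zeroʳ (+ suc k)) (ℤₚ.*-zeroʳ (+ suc j)))
      go (suc j) f (suc n) = step (+ n) (dilate k j f n) (+ suc k ℤ.* dilate k j (D f) n) (+ j) (go j f n)
      go zero f (suc n) = begin
        + suc n ℤ.* x                                        ≡⟨ step (+ n) x (+ suc k ℤ.* y) (+ k) (go k (tail f) n) ⟩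
        + suc k ℤ.* y ℤ.+ + suc k ℤ.* x                      ≡⟨ collect (+ suc k) y x ⟩
        + suc k ℤ.* (y ℤ.+ x) ℤ.+ + 0                        ≡⟨ cong (λ w → + suc k ℤ.* w ℤ.+ + 0) (dilate-+′ k k (D (tail f)) (tail f) n) ⟨
        + suc k ℤ.* dilate k k _ n ℤ.+ + 0                   ≡⟨ cong (λ w → + suc k ℤ.* w ℤ.+ + 0) (dilate-cong′ k k n (λ m → expand (+ m) (f (suc m)))) ⟨
        + suc k ℤ.* dilate k k (tail (D f)) n ℤ.+ + 0        ∎
        where
        open ≡-Reasoning
        x y : ℤ
        x = dilate k k (tail f) n
        y = dilate k k (D (tail f)) n

  -- recip-tail is the private auxiliary function of Defs.inverse: abstracting the terms suc n and 2 from the unfolded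
  -- equation makes its arguments variables, so that unification can recover it.
  mutual
    recip-tail : Series → ℕ → ℕ → ℕ → ℤ
    recip-tail = _

    recip-tail-def : ∀ c n → inverse c (suc (suc n)) ≡ ℤ.- (c 1 ℤ.* inverse c (suc n) ℤ.+ recip-tail c (suc n) 2 n)
    recip-tail-def c n with suc n | 2
    ... | n′ | m = refl

  opaque
    unfolding _+_
    inverse-*ʳ : ∀ c → c 0 ≡ + 1 → c * inverse c ≈ ι (+ 1)
    inverse-*ʳ c c0 = coeffwise λ
      { zero → cong (ℤ._* + 1) c0
      ; (suc n) → trans (cong₂ (λ a b → a ℤ.* inverse c (suc n) ℤ.+ b) c0 (sym (tail-conv n 1 (tail c) n (λ i → refl))))
          (trans (cong (λ w → w ℤ.+ recip-tail c n 1 n) (ℤₚ.*-identityˡ (inverse c (suc n)))) (ℤₚ.+-inverseˡ (recip-tail c n 1 n))) }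
      where
      tail-conv : ∀ n′ m d n → (∀ i → d i ≡ c (m ℕ.+ i)) → recip-tail c n′ m n ≡ conv d (inverse c) n
      tail-conv n′ m d zero p = trans (ℤₚ.+-identityʳ _) (cong (ℤ._* + 1) (sym (trans (p 0) (cong c (ℕₚ.+-identityʳ m)))))
      tail-conv n′ m d (suc n) p = cong₂ (λ a b → a ℤ.* inverse c (suc n) ℤ.+ b)
        (sym (trans (p 0) (cong c (ℕₚ.+-identityʳ m))))
        (tail-conv n′ (suc m) (tail d) n (λ i → trans (p (suc i)) (cong c (ℕₚ.+-suc m i))))

  -- The operators U and V, and dissection modulo 5

  V : Series → Series
  V = dilate 4 0

  ext : ℕ → Series → Series
  ext r f n = f (r ℕ.+ n ℕ.* 5)

  U : Series → Series
  U = ext 0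

  ext-cong : ∀ r {f g} → f ≈ g → ext r f ≈ ext r g
  ext-cong r p = coeffwise λ n → coeff p (r ℕ.+ n ℕ.* 5)

  opaque
    unfolding _+_
    ext-+ : ∀ r f g → ext r (f + g) ≈ ext r f + ext r g
    ext-+ r f g = coeffwise λ n → refl

    ext-neg : ∀ r f → ext r (- f) ≈ - ext r f
    ext-neg r f = coeffwise λ n → refl

    -- The projection formula: in a convolution with `V h` each coefficient of `h` is followed by
    -- four zeros, so at an index 5n only the coefficients of `g` at multiples of 5 enter.
    U-V* : ∀ h g → U (V h * g) ≈ h * U g
    U-V* h g = coeffwise (go h g)
      where
      go : ∀ h g n → conv (V h) g (n ℕ.* 5) ≡ conv h (U g) n
      go h g zero = refl
      go h g (suc n) = cong (λ w → h 0 ℤ.* g (suc n ℕ.* 5) ℤ.+ w)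
        (trans (ℤₚ.+-identityˡ _) (trans (ℤₚ.+-identityˡ _) (trans (ℤₚ.+-identityˡ _) (trans (ℤₚ.+-identityˡ _) (go (tail h) g n)))))

  ext-ι* : ∀ r z f → ext r (ι z * f) ≈ ι z * ext r f
  ext-ι* r z f = coeffwise λ n → trans (ι-* z f (r ℕ.+ n ℕ.* 5)) (sym (ι-* z (ext r f) n))

  dilate-off : ∀ j → j ℕ.< 4 → ∀ f n → dilate 4 (suc j) f (n ℕ.* 5) ≡ + 0
  dilate-off j p f zero = refl
  dilate-off 0 p f (suc n) = dilate-off 0 p (tail f) n
  dilate-off 1 p f (suc n) = dilate-off 1 p (tail f) n
  dilate-off 2 p f (suc n) = dilate-off 2 p (tail f) n
  dilate-off 3 p f (suc n) = dilate-off 3 p (tail f) n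
  dilate-off (suc (suc (suc (suc j)))) (s≤s (s≤s (s≤s (s≤s ())))) f (suc n)

  V-values : ∀ f n → V f (n ℕ.* 5) ≡ f n
  V-values f zero = refl
  V-values f (suc n) = V-values (tail f) n

  U-V : ∀ f → U (V f) ≈ f
  U-V f = coeffwise (V-values f)

  U-dilate-off : ∀ j → j ℕ.< 4 → ∀ f → U (dilate 4 (suc j) f) ≈ ι (+ 0)
  U-dilate-off j p f = coeffwise λ n → trans (dilate-off j p f n) (sym (ι0-coeff n))

  ext₂-dilate-0 : ∀ f → ext 2 (dilate 4 0 f) ≈ ι (+ 0)
  ext₂-dilate-0 f = coeffwise λ n → trans (dilate-off 2 (s≤s (s≤s (s≤s z≤n))) (tail f) n) (sym (ι0-coeff n))

  ext₂-dilate-1 : ∀ f → ext 2 (dilate 4 1 f) ≈ ι (+ 0)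
  ext₂-dilate-1 f = coeffwise λ n → trans (dilate-off 3 (s≤s (s≤s (s≤s (s≤s z≤n)))) (tail f) n) (sym (ι0-coeff n))

  ext₂-dilate-2 : ∀ f → ext 2 (dilate 4 2 f) ≈ f
  ext₂-dilate-2 f = coeffwise (V-values f)

  ext₂-dilate-3 : ∀ f → ext 2 (dilate 4 3 f) ≈ ι (+ 0)
  ext₂-dilate-3 f = coeffwise λ n → trans (dilate-off 0 (s≤s z≤n) f n) (sym (ι0-coeff n))

  ext₂-dilate-4 : ∀ f → ext 2 (dilate 4 4 f) ≈ ι (+ 0)
  ext₂-dilate-4 f = coeffwise λ n → trans (dilate-off 1 (s≤s (s≤s z≤n)) f n) (sym (ι0-coeff n))

  opaque
    unfolding _+_
    dissection : ∀ f → f ≈ dilate 4 0 (ext 0 f) + (dilate 4 1 (ext 1 f) + (dilate 4 2 (ext 2 f) + (dilate 4 3 (ext 3 f) + dilate 4 4 (ext 4 f))))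
    dissection f = coeffwise (go f)
      where
      go : ∀ f n → f n ≡ dilate 4 0 (ext 0 f) n ℤ.+ (dilate 4 1 (ext 1 f) n ℤ.+ (dilate 4 2 (ext 2 f) n ℤ.+ (dilate 4 3 (ext 3 f) n ℤ.+ dilate 4 4 (ext 4 f) n)))
      go f 0 = sym (ℤₚ.+-identityʳ (f 0))
      go f 1 = sym (trans (ℤₚ.+-identityˡ _) (ℤₚ.+-identityʳ (f 1)))
      go f 2 = sym (trans (ℤₚ.+-identityˡ _) (trans (ℤₚ.+-identityˡ _) (ℤₚ.+-identityʳ (f 2))))
      go f 3 = sym (trans (ℤₚ.+-identityˡ _) (trans (ℤₚ.+-identityˡ _) (trans (ℤₚ.+-identityˡ _) (ℤₚ.+-identityʳ (f 3)))))
      go f 4 = sym (trans (ℤₚ.+-identityˡ _) (trans (ℤₚ.+-identityˡ _) (trans (ℤₚ.+-identityˡ _) (ℤₚ.+-identityˡ (f 4)))))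
      go f (suc (suc (suc (suc (suc n))))) = go (λ i → f (5 ℕ.+ i)) n

  -- Cancellation, and uniqueness from differential and functional equations

  opaque
    unfolding _+_
    *-const : ∀ {f g} → f 0 ≡ + 1 → g 0 ≡ + 1 → (f * g) 0 ≡ + 1
    *-const = cong₂ ℤ._*_

    mono-cancel : ∀ k {f g} → mono k * f ≈ mono k * g → f ≈ g
    mono-cancel k {f} {g} p = coeffwise λ n → trans (sym (at k f n)) (trans (coeff p (k ℕ.+ n)) (at k g n))
      where
      at : ∀ k f n → (mono k * f) (k ℕ.+ n) ≡ f n
      at zero f n = mono-0-* f n
      at (suc k) f n = trans (mono-suc-*-suc k f (k ℕ.+ n)) (at k f n)

  ^-const : ∀ {f} n → f 0 ≡ + 1 → (f ^ n) 0 ≡ + 1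
  ^-const zero p = ι-coeff-0 (+ 1)
  ^-const (suc n) p = *-const p (^-const n p)

  unit-cancel : ∀ u {f g} → u 0 ≡ + 1 → u * f ≈ u * g → f ≈ g
  unit-cancel u {f} {g} u0 p = begin
    f                       ≈⟨ expand f ⟩
    inverse u * (u * f)     ≈⟨ *-congˡ p ⟩
    inverse u * (u * g)     ≈⟨ expand g ⟨
    g                       ∎
    where
    open ≈R
    expand : ∀ h → h ≈ inverse u * (u * h)
    expand h = begin
      h                      ≈⟨ *-identityˡ h ⟨
      ι (+ 1) * h            ≈⟨ *-congʳ (inverse-*ʳ u u0) ⟨
      u * inverse u * h      ≈⟨ solve 3 (λ u i h → u :* i :* h := i :* (u :* h)) ≈-refl u (inverse u) h ⟩
      inverse u * (u * h)    ∎

  ι-cancel : ∀ k .{{_ : ℕ.NonZero k}} {f g} → ι (+ k) * f ≈ ι (+ k) * g → f ≈ g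
  ι-cancel (suc k) {f} {g} p = coeffwise λ n → ℤₚ.*-cancelˡ-≡ (+ suc k) (f n) (g n)
    (trans (sym (ι-* (+ suc k) f n)) (trans (coeff p n) (ι-* (+ suc k) g n)))

  D-zero : ∀ f → D f ≈ ι (+ 0) → f ≈ ι (f 0)
  D-zero f p = coeffwise λ { zero → sym (ι-coeff-0 (f 0)) ; (suc n) → trans
    (ℤₚ.*-cancelˡ-≡ (+ suc n) (f (suc n)) (+ 0) (trans (sym (D-coeff f (suc n))) (trans (coeff p (suc n)) (trans (ι0-coeff (suc n)) (sym (ℤₚ.*-zeroʳ (+ suc n)))))))
    (sym (ι-coeff-suc (f 0) n)) }

  opaque
    unfolding _+_
    D-inverse : ∀ {h N} → N 0 ≡ + 1 → D N ≈ h * N → D (inverse N) ≈ - (h * inverse N)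
    D-inverse {h} {N} N0 p = unit-cancel N N0 (
      product ▸⁺ p ▸
      solve 5 (λ N i h d e → N :* e := N :* :- (h :* i) :+ (d :* i :+ N :* e :- # 0) :+ :- i :* (d :- h :* N))
        ≈-refl N (inverse N) h (D N) (D (inverse N)))
      where
      product : D N * inverse N + N * D (inverse N) ≈ ι (+ 0)
      product = ≈-trans (≈-sym (D-* N (inverse N))) (≈-trans (D-cong (inverse-*ʳ N N0)) (D-ι (+ 1)))

    -- The quotient M/N has derivative zero, hence is constant, and both constant terms are 1.
    ode-unique : ∀ {h M N} → M 0 ≡ + 1 → N 0 ≡ + 1 → D M ≈ h * M → D N ≈ h * N → M ≈ N
    ode-unique {h} {M} {N} M0 N0 p q = unit-cancel (inverse N) refl (≈-trans (*-comm _ M) (≈-trans (D-zero (M * inverse N) flat)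
      (≈-trans (coeffwise λ n → cong (λ c → ι c n) (cong (ℤ._* + 1) M0)) (≈-trans (≈-sym (inverse-*ʳ N N0)) (*-comm N _)))))
      where
      flat : D (M * inverse N) ≈ ι (+ 0)
      flat = ≈-trans (D-* M (inverse N)) (≈-trans (+-cong (*-congʳ p) (*-congˡ (D-inverse N0 q)))
        (solve 3 (λ h M i → h :* M :* i :+ M :* (:- (h :* i)) := # 0) ≈-refl h M (inverse N)))

  -- A coefficient of `h` at a positive n is z times the one at n/5, or zero when 5 does not divide
  -- n, so strong induction spreads the vanishing from the constant term.
  descent : ∀ z {h} → h ≈ ι z * V h → h 0 ≡ + 0 → h ≈ ι (+ 0)
  descent z {h} p h0 = coeffwise λ n → trans (vanish n) (sym (ι0-coeff n))
    where
    sections : ∀ f n → (∀ m → m ℕ.* 5 ℕ.≤ n → f m ≡ + 0) → V f n ≡ + 0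
    sections f 0 q = q 0 z≤n
    sections f 1 q = refl
    sections f 2 q = refl
    sections f 3 q = refl
    sections f 4 q = refl
    sections f (suc (suc (suc (suc (suc n))))) q = sections (tail f) n λ m m≤n → q (suc m) (s≤s (s≤s (s≤s (s≤s (s≤s m≤n)))))
    vanish : ∀ n → h n ≡ + 0
    vanish = ℕᵢ.<-rec (λ n → h n ≡ + 0) λ
      { zero rec → h0
      ; (suc n) rec → trans (coeff p (suc n)) (trans (ι-* z (V h) (suc n)) (trans (cong (z ℤ.*_)
          (sections h (suc n) λ { zero _ → h0 ; (suc m) le → rec (ℕₚ.<-≤-trans (ℕₚ.m<m*n (suc m) 5 (s≤s (s≤s z≤n))) le) }))
          (ℤₚ.*-zeroʳ z))) }

  -- Polynomial identities by computation with coefficient lists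

  horner : List ℤ → Series → Series
  horner [] x = ι (+ 0)
  horner (c ∷ p) x = ι c + x * horner p x

  infixl 6 _⊞_
  infixl 7 _⊠_

  _⊞_ _⊠_ : List ℤ → List ℤ → List ℤ
  [] ⊞ q = q
  (a ∷ p) ⊞ [] = a ∷ p
  (a ∷ p) ⊞ (b ∷ q) = a ℤ.+ b ∷ p ⊞ q

  scaleBy : ℤ → List ℤ → List ℤ
  scaleBy z [] = []
  scaleBy z (a ∷ p) = z ℤ.* a ∷ scaleBy z p

  [] ⊠ q = []
  (a ∷ p) ⊠ q = scaleBy a q ⊞ (+ 0 ∷ p ⊠ q)

  horner-⊞ : ∀ p q x → horner (p ⊞ q) x ≈ horner p x + horner q x
  horner-⊞ [] q x = ≈-sym (+-identityˡ _)
  horner-⊞ (a ∷ p) [] x = ≈-sym (+-identityʳ _)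
  horner-⊞ (a ∷ p) (b ∷ q) x = ≈-trans (+-cong (ι-+-homo a b) (*-congˡ (horner-⊞ p q x)))
    (
      solve 5 (λ a b x p q → a :+ b :+ x :* (p :+ q) := a :+ x :* p :+ (b :+ x :* q))
        ≈-refl (ι a) (ι b) x (horner p x) (horner q x))

  horner-scaleBy : ∀ z p x → horner (scaleBy z p) x ≈ ι z * horner p x
  horner-scaleBy z [] x = ≈-sym (zeroʳ (ι z))
  horner-scaleBy z (a ∷ p) x = ≈-trans (+-cong (ι-*-homo z a) (*-congˡ (horner-scaleBy z p x)))
    (solve 4 (λ z a x p → z :* a :+ x :* (z :* p) := z :* (a :+ x :* p)) ≈-refl (ι z) (ι a) x (horner p x))

  horner-⊠ : ∀ p q x → horner (p ⊠ q) x ≈ horner p x * horner q x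
  horner-⊠ [] q x = ≈-sym (zeroˡ _)
  horner-⊠ (a ∷ p) q x = ≈-trans (horner-⊞ (scaleBy a q) (+ 0 ∷ p ⊠ q) x)
    (≈-trans (+-cong (horner-scaleBy a q x) (+-congˡ (*-congˡ (horner-⊠ p q x))))
    (solve 4 (λ a x p q → a :* q :+ (# 0 :+ x :* (p :* q)) := (a :+ x :* p) :* q) ≈-refl (ι a) x (horner p x) (horner q x)))

  power : List ℤ → ℕ → List ℤ
  power p zero = + 1 ∷ []
  power p (suc n) = p ⊠ power p n

  coeffs : Polynomial 1 → List ℤ
  coeffs (op [+] e f) = coeffs e ⊞ coeffs f
  coeffs (op [*] e f) = coeffs e ⊠ coeffs f
  coeffs (con z) = z ∷ []
  coeffs (var _) = + 0 ∷ + 1 ∷ []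
  coeffs (e :^ n) = power (coeffs e) n
  coeffs (:- e) = scaleBy -[1+ 0 ] (coeffs e)

  horner-coeffs : ∀ e x → horner (coeffs e) x ≈ ⟦ e ⟧ (x ∷ [])
  horner-coeffs (op [+] e f) x = ≈-trans (horner-⊞ (coeffs e) (coeffs f) x) (+-cong (horner-coeffs e x) (horner-coeffs f x))
  horner-coeffs (op [*] e f) x = ≈-trans (horner-⊠ (coeffs e) (coeffs f) x) (*-cong (horner-coeffs e x) (horner-coeffs f x))
  horner-coeffs (con z) x = solve 2 (λ z x → z :+ x :* # 0 := z) ≈-refl (ι z) x
  horner-coeffs (var 0F) x = solve 1 (λ x → # 0 :+ x :* (# 1 :+ x :* # 0) := x) ≈-refl x
  horner-coeffs (e :^ zero) x = solve 1 (λ x → # 1 :+ x :* # 0 := # 1) ≈-refl x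
  horner-coeffs (e :^ suc n) x = ≈-trans (horner-⊠ (coeffs e) (power (coeffs e) n) x) (*-cong (horner-coeffs e x) (horner-coeffs (e :^ n) x))
  horner-coeffs (:- e) x = ≈-trans (horner-scaleBy -[1+ 0 ] (coeffs e) x) (≈-trans (*-cong (ι-‿-homo (+ 1)) (horner-coeffs e x))
    (solve 1 (λ f → :- # 1 :* f := :- f) ≈-refl (⟦ e ⟧ (x ∷ []))))

  null : List ℤ → Bool
  null [] = true
  null (a ∷ p) = does (a ℤ.≟ + 0) ∧ null p

  horner-null : ∀ p x → T (null p) → horner p x ≈ ι (+ 0)
  horner-null [] x t = ≈-refl
  horner-null (a ∷ p) x t with a ℤ.≟ + 0
  ... | yes refl = ≈-trans (+-congˡ (*-congˡ (horner-null p x t))) (solve 1 (λ x → # 0 :+ x :* # 0 := # 0) ≈-refl x)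

  infix 5 _≐_
  _≐_ : List ℤ → List ℤ → Bool
  p ≐ q = null (p ⊞ scaleBy -[1+ 0 ] q)

  horner-≐ : ∀ p q → T (p ≐ q) → ∀ x → horner p x ≈ horner q x
  horner-≐ p q t x = vanishes ▸⁺ solve 2 (λ p q → p := q :+ (p :- q :- # 0)) ≈-refl (horner p x) (horner q x)
    where
    vanishes : horner p x - horner q x ≈ ι (+ 0)
    vanishes = begin
      horner p x - horner q x                        ≈⟨
        solve 2 (λ p q → p :- q := p :+ :- # 1 :* q)
          ≈-refl (horner p x) (horner q x) ⟩
      horner p x + - ι (+ 1) * horner q x            ≈⟨ +-congˡ (*-congʳ (ι-‿-homo (+ 1))) ⟨
      horner p x + ι -[1+ 0 ] * horner q x           ≈⟨ +-congˡ (horner-scaleBy -[1+ 0 ] q x) ⟨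
      horner p x + horner (scaleBy -[1+ 0 ] q) x     ≈⟨ horner-⊞ p (scaleBy -[1+ 0 ] q) x ⟨
      horner (p ⊞ scaleBy -[1+ 0 ] q) x              ≈⟨ horner-null (p ⊞ scaleBy -[1+ 0 ] q) x t ⟩
      ι (+ 0)                                        ∎
      where open ≈R

  -- The comparison runs on lists of integers: for concrete expressions the hypothesis evaluates to
  -- the unit type and is filled by `_`. The identities of high degree in `r` are checked in this
  -- way.
  identity : ∀ e f → T (coeffs e ≐ coeffs f) → ∀ x → ⟦ e ⟧ (x ∷ []) ≈ ⟦ f ⟧ (x ∷ [])
  identity e f t x = ≈-trans (≈-sym (horner-coeffs e x)) (≈-trans (horner-≐ (coeffs e) (coeffs f) t x) (horner-coeffs f x))

  every₅ : ℕ → List ℤ → List ℤ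
  every₅ i [] = []
  every₅ zero (c ∷ p) = c ∷ every₅ 4 p
  every₅ (suc i) (c ∷ p) = every₅ i p

  -- Since v is q times a series in q^5, the power v^j has only exponents congruent to j modulo 5.
  -- Hence U keeps, from a polynomial in v times `V h`, the powers v^(5m) and turns them into ξ^m.
  module Dissection (v ν ξ : Series) (v≈ : v ≈ mono 1 * V ν) (ξ≈ : v ^ 5 ≈ V ξ) where

    U-power : ∀ j → j ℕ.< 4 → ∀ h → U (v ^ suc j * V h) ≈ ι (+ 0)
    U-power j j<4 h = ≈-trans (ext-cong 0 (≈-trans (*-congʳ (split j)) (≈-trans (
      solve 3 (λ m n h → m :* n :* h := m :* (n :* h))
        ≈-refl (mono (suc j)) (V (ν ^ suc j)) (V h))
       (≈-trans (*-congˡ (≈-sym (dilate-* 4 0 (ν ^ suc j) h))) (dilate-mono 4 (suc j) (ν ^ suc j * h))))))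
       (U-dilate-off j j<4 (ν ^ suc j * h))
      where
      split : ∀ j → v ^ suc j ≈ mono (suc j) * V (ν ^ suc j)
      split zero = ≈-trans (solve 1 (λ v → v :* # 1 := v) ≈-refl v) (≈-trans v≈ (*-congˡ (dilate-cong 4 0 (solve 1 (λ ν → ν := ν :* # 1) ≈-refl ν))))
      split (suc j) = ≈-trans (*-cong v≈ (split j)) (≈-trans (
        solve 4 (λ a b c d → a :* b :* (c :* d) := a :* c :* (b :* d))
          ≈-refl (mono 1) (V ν) (mono (suc j)) (V (ν ^ suc j)))
        (*-cong (mono-* 1 (suc j)) (≈-sym (dilate-* 4 0 ν (ν ^ suc j)))))

    U-horner : ∀ p h → U (horner p v * V h) ≈ horner (every₅ 0 p) ξ * h
    -- Here the leading entry of `p` belongs to v^(suc j), so 4 - j = suc i entries are dropped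
    -- before the next multiple of 5.
    U-horner′ : ∀ j i → j ℕ.+ i ≡ 3 → ∀ p h → U (v ^ suc j * horner p v * V h) ≈ ξ * horner (every₅ (suc i) p) ξ * h
    U-horner [] h = ≈-trans (ext-cong 0 (solve 1 (λ h → # 0 :* h := # 0 :* h) ≈-refl (V h))) (≈-trans (ext-ι* 0 (+ 0) (V h)) (
      solve 2 (λ a h → # 0 :* a := # 0 :* h)
        ≈-refl (U (V h)) h))
    U-horner (c ∷ p) h = begin
      U ((ι c + v * horner p v) * V h)                       ≈⟨ ext-cong 0 (
        solve 4 (λ c v p h → (c :+ v :* p) :* h := c :* h :+ v :^ 1 :* p :* h)
          ≈-refl (ι c) v (horner p v) (V h)) ⟩
      U (ι c * V h + v ^ 1 * horner p v * V h)                ≈⟨ ext-+ 0 (ι c * V h) (v ^ 1 * horner p v * V h) ⟩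
      U (ι c * V h) + U (v ^ 1 * horner p v * V h)            ≈⟨ +-cong (≈-trans (ext-ι* 0 c (V h)) (*-congˡ (U-V h))) (U-horner′ 0 3 refl p h) ⟩
      ι c * h + ξ * horner (every₅ 4 p) ξ * h                 ≈⟨
        solve 4 (λ c x p h → c :* h :+ x :* p :* h := (c :+ x :* p) :* h)
          ≈-refl (ι c) ξ (horner (every₅ 4 p) ξ) h ⟩
      (ι c + ξ * horner (every₅ 4 p) ξ) * h                   ∎
      where open ≈R
    U-horner′ j i e [] h = ≈-trans (ext-cong 0 (solve 2 (λ h v → v :* # 0 :* h := # 0 :* h) ≈-refl (V h) (v ^ suc j))) (≈-trans (ext-ι* 0 (+ 0) (V h)) (
      solve 3 (λ a x h → # 0 :* a := x :* # 0 :* h)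
        ≈-refl (U (V h)) ξ h))
    U-horner′ j i e (c ∷ p) h = begin
      U (v ^ suc j * (ι c + v * horner p v) * V h)
        ≈⟨ ext-cong 0 (
            solve 5 (λ w c v p h → w :* (c :+ v :* p) :* h := c :* (w :* h) :+ v :* w :* p :* h)
              ≈-refl (v ^ suc j) (ι c) v (horner p v) (V h)) ⟩
      U (ι c * (v ^ suc j * V h) + v ^ suc (suc j) * horner p v * V h)
        ≈⟨ ext-+ 0 (ι c * (v ^ suc j * V h)) (v ^ suc (suc j) * horner p v * V h) ⟩
      U (ι c * (v ^ suc j * V h)) + U (v ^ suc (suc j) * horner p v * V h)
        ≈⟨ +-congʳ (≈-trans (ext-ι* 0 c (v ^ suc j * V h)) (*-congˡ (U-power j (s≤s (ℕₚ.≤-trans (ℕₚ.m≤m+n j i) (ℕₚ.≤-reflexive e))) h))) ⟩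
      ι c * ι (+ 0) + U (v ^ suc (suc j) * horner p v * V h)
        ≈⟨ solve 2 (λ c z → c :* # 0 :+ z := z) ≈-refl (ι c) (U (v ^ suc (suc j) * horner p v * V h)) ⟩
      U (v ^ suc (suc j) * horner p v * V h)
        ≈⟨ next j i e ⟩
      ξ * horner (every₅ i p) ξ * h                          ∎
      where
      open ≈R
      next : ∀ j i → j ℕ.+ i ≡ 3 → U (v ^ suc (suc j) * horner p v * V h) ≈ ξ * horner (every₅ i p) ξ * h
      next j (suc i) e = U-horner′ (suc j) i (trans (sym (ℕₚ.+-suc j i)) e) p h
      next j zero e with trans (sym (ℕₚ.+-identityʳ j)) e
      ... | refl = ≈-trans (ext-cong 0 (≈-trans (*-congʳ (*-congʳ ξ≈)) (
        solve 3 (λ x p h → x :* p :* h := x :* (p :* h))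
          ≈-refl (V ξ) (horner p v) (V h))))
        (≈-trans (U-V* ξ (horner p v * V h)) (≈-trans (*-congˡ (U-horner p h)) (
          solve 3 (λ x p h → x :* (p :* h) := x :* p :* h)
            ≈-refl ξ (horner (every₅ 0 p) ξ) h)))

    U-identity : ∀ e f → T (every₅ 0 (coeffs e) ≐ coeffs f) → ∀ h → U (⟦ e ⟧ (v ∷ []) * V h) ≈ ⟦ f ⟧ (ξ ∷ []) * h
    U-identity e f t h = ≈-trans (ext-cong 0 (*-congʳ (≈-sym (horner-coeffs e v)))) (≈-trans (U-horner (coeffs e) h)
      (*-congʳ (≈-trans (horner-≐ (every₅ 0 (coeffs e)) (coeffs f) t ξ) (horner-coeffs f ξ))))

  -- V and D on polynomial expressions

  V-poly : ∀ {n} (e : Polynomial n) ρ → V (⟦ e ⟧ ρ) ≈ ⟦ e ⟧ (Vec.map V ρ)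
  V-poly (op [+] e f) ρ = ≈-trans (dilate-+ 4 0 (⟦ e ⟧ ρ) (⟦ f ⟧ ρ)) (+-cong (V-poly e ρ) (V-poly f ρ))
  V-poly (op [*] e f) ρ = ≈-trans (dilate-* 4 0 (⟦ e ⟧ ρ) (⟦ f ⟧ ρ)) (*-cong (V-poly e ρ) (V-poly f ρ))
  V-poly (con c) ρ = dilate-ι 4 c
  V-poly (var i) ρ rewrite lookup-map i V ρ = ≈-refl
  V-poly (e :^ zero) ρ = dilate-ι 4 (+ 1)
  V-poly (e :^ suc n) ρ = ≈-trans (dilate-* 4 0 (⟦ e ⟧ ρ) (⟦ e ⟧ ρ ^ n)) (*-cong (V-poly e ρ) (V-poly (e :^ n) ρ))
  V-poly (:- e) ρ = ≈-trans (dilate-neg 4 0 (⟦ e ⟧ ρ)) (-‿cong (V-poly e ρ))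

  embed : ∀ {n} → Polynomial n → Polynomial (n ℕ.+ n)
  embed (op o e f) = op o (embed e) (embed f)
  embed (con c) = con c
  embed {n} (var i) = var (i ↑ˡ n)
  embed (e :^ k) = embed e :^ k
  embed (:- e) = :- embed e

  -- The first n variables of the result are the given series, the last n their derivatives.
  differential : ∀ {n} → Polynomial n → Polynomial (n ℕ.+ n)
  differential (op [+] e f) = differential e :+ differential f
  differential (op [*] e f) = differential e :* embed f :+ embed e :* differential f
  differential (con c) = con (+ 0)
  differential {n} (var i) = var (n ↑ʳ i)
  differential (e :^ zero) = con (+ 0)
  differential (e :^ suc k) = con (+ suc k) :* embed e :^ k :* differential e
  differential (:- e) = :- differential e

  ⟦embed⟧ : ∀ {n} (e : Polynomial n) ρ σ → ⟦ embed e ⟧ (ρ ++ σ) ≈ ⟦ e ⟧ ρ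
  ⟦embed⟧ (op [+] e f) ρ σ = +-cong (⟦embed⟧ e ρ σ) (⟦embed⟧ f ρ σ)
  ⟦embed⟧ (op [*] e f) ρ σ = *-cong (⟦embed⟧ e ρ σ) (⟦embed⟧ f ρ σ)
  ⟦embed⟧ (con c) ρ σ = ≈-refl
  ⟦embed⟧ (var i) ρ σ rewrite lookup-++ˡ ρ σ i = ≈-refl
  ⟦embed⟧ (e :^ zero) ρ σ = ≈-refl
  ⟦embed⟧ (e :^ suc k) ρ σ = *-cong (⟦embed⟧ e ρ σ) (⟦embed⟧ (e :^ k) ρ σ)
  ⟦embed⟧ (:- e) ρ σ = -‿cong (⟦embed⟧ e ρ σ)

  D-pow : ∀ f k → D (f ^ suc k) ≈ ι (+ suc k) * f ^ k * D f
  D-pow f zero = ≈-trans (D-cong (solve 1 (λ f → f :* # 1 := f) ≈-refl f)) (solve 1 (λ d → d := # 1 :* # 1 :* d) ≈-refl (D f))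
  D-pow f (suc k) =
    D-* f (f ^ suc k) ▸⁺ D-pow f k ▸ ι-+-homo (+ 1) (+ suc k) ▸
    solve 7 (λ a b d f p m n →
      a := n :* (f :* p) :* d :+ (a :- (d :* (f :* p) :+ f :* b)) :+ f :* (b :- m :* p :* d) :+ :- (f :* p :* d) :* (n :- (# 1 :+ m)))
      ≈-refl (D (f ^ suc (suc k))) (D (f ^ suc k)) (D f) f (f ^ k) (ι (+ suc k)) (ι (+ suc (suc k)))

  D-poly : ∀ {n} (e : Polynomial n) ρ → D (⟦ e ⟧ ρ) ≈ ⟦ differential e ⟧ (ρ ++ Vec.map D ρ)
  D-poly (op [+] e f) ρ = ≈-trans (D-+ (⟦ e ⟧ ρ) (⟦ f ⟧ ρ)) (+-cong (D-poly e ρ) (D-poly f ρ))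
  D-poly (op [*] e f) ρ = ≈-trans (D-* (⟦ e ⟧ ρ) (⟦ f ⟧ ρ)) (+-cong (*-cong (D-poly e ρ) (≈-sym (⟦embed⟧ f ρ _))) (*-cong (≈-sym (⟦embed⟧ e ρ _)) (D-poly f ρ)))
  D-poly (con c) ρ = D-ι c
  D-poly {n} (var i) ρ rewrite lookup-++ʳ ρ (Vec.map D ρ) i | lookup-map i D ρ = ≈-refl
  D-poly (e :^ zero) ρ = D-ι (+ 1)
  D-poly (e :^ suc k) ρ = ≈-trans (D-pow (⟦ e ⟧ ρ) k) (*-cong (*-congˡ (≈-sym (⟦embed⟧ (e :^ k) ρ _))) (D-poly e ρ))
  D-poly (:- e) ρ = ≈-trans (D-neg (⟦ e ⟧ ρ)) (-‿cong (D-poly e ρ))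

  -- Limits of stabilising sequences, and (q;q)_∞ with its partial products

  limit : (ℕ → Series) → Series
  limit S n = S n n

  limit-≈[] : ∀ S → (∀ n → S (suc n) ≈[ n ] S n) → ∀ {N M} → N ℕ.≤ M → limit S ≈[ N ] S M
  limit-≈[] S stable {N} {M} N≤M = below λ m m≤N → sym (trans
    (cong (λ k → S k m) (sym (ℕₚ.m+[n∸m]≡n (ℕₚ.≤-trans m≤N N≤M)))) (go m (M ℕ.∸ m)))
    where
    go : ∀ m j → S (m ℕ.+ j) m ≡ S m m
    go m zero = cong (λ k → S k m) (ℕₚ.+-identityʳ m)
    go m (suc j) = trans (cong (λ k → S k m) (ℕₚ.+-suc m j))
      (trans (coeff≤ (stable (m ℕ.+ j)) m (ℕₚ.m≤m+n m j)) (go m j))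

  -- `euler` takes its nth coefficient from the nth partial product, so it is `limit p` by
  -- definition.
  E : Series
  E = euler

  p : ℕ → Series
  p = partialEuler

  opaque
    unfolding _+_
    oneMinusQ^-suc : ∀ k → oneMinusQ^ (suc k) ≈ ι (+ 1) - mono (suc k)
    oneMinusQ^-suc k = coeffwise λ { zero → refl ; (suc m) → go m }
      where
      go : ∀ m → oneMinusQ^ (suc k) (suc m) ≡ + 0 ℤ.+ ℤ.- mono k m
      go m with suc m ℕₚ.≟ suc k
      ... | yes refl = cong (λ z → + 0 ℤ.+ ℤ.- z) (sym (mono-diag m))
      ... | no ne = cong (λ z → + 0 ℤ.+ ℤ.- z) (sym (mono-off k m λ e → ne (cong suc (sym e))))

    p-0 : p 0 ≈ ι (+ 1)
    p-0 = coeffwise λ { zero → refl ; (suc n) → refl }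

    p-const : ∀ n → p n 0 ≡ + 1
    p-const zero = refl
    p-const (suc n) = trans (coeff (⊛≈* (p n) (oneMinusQ^ (suc n))) 0) (cong (ℤ._* + 1) (p-const n))

  p-suc : ∀ n → p (suc n) ≈ p n * (ι (+ 1) - mono (suc n))
  p-suc n = ≈-trans (⊛≈* (p n) (oneMinusQ^ (suc n))) (*-congˡ (oneMinusQ^-suc n))

  p-stable : ∀ n → p (suc n) ≈[ n ] p n
  p-stable n = []-trans (≈⇒≈[] (≈-trans (p-suc n) (
    solve 2 (λ p m → p :* (# 1 :- m) := p :+ m :* :- p)
      ≈-refl (p n) (mono (suc n)))))
    ([]-trans ([]-+ (≈⇒≈[] ≈-refl) (mono-small (- p n) ℕₚ.≤-refl)) (≈⇒≈[] (+-identityʳ (p n))))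

  E≈p : ∀ {N M} → N ℕ.≤ M → E ≈[ N ] p M
  E≈p = limit-≈[] p p-stable

  E-const : E 0 ≡ + 1
  E-const = p-const 0

  ip : ℕ → Series
  ip n = inverse (p n)

  p*ip : ∀ n → p n * ip n ≈ ι (+ 1)
  p*ip n = inverse-*ʳ (p n) (p-const n)

  ip-suc : ∀ n → ip n ≈ ip (suc n) * (ι (+ 1) - mono (suc n))
  ip-suc n = unit-cancel (p (suc n)) (p-const (suc n)) (
    p-suc n ▸ p*ip n ▸ p*ip (suc n) ▸
    solve 5 (λ a b i j m →
      b :* i := b :* (j :* (# 1 :- m)) :+ i :* (b :- a :* (# 1 :- m)) :+ (# 1 :- m) :* (a :* i :- # 1) :+ :- (# 1 :- m) :* (b :* j :- # 1))
      ≈-refl (p n) (p (suc n)) (ip n) (ip (suc n)) (mono (suc n)))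

  -- The pentagonal number theorem, by Shanks' finite form

  tri : ℕ → ℕ
  tri zero = 0
  tri (suc n) = suc n ℕ.+ tri n

  σ : ℕ → ℤ
  σ zero = + 1
  σ (suc n) = ℤ.- σ n

  sg : ℕ → Series
  sg n = ι (σ n)

  sg-suc : ∀ n → sg (suc n) ≈ - sg n
  sg-suc n = ι-‿-homo (σ n)

  mono-cong : ∀ {a b} → a ≡ b → mono a ≈ mono b
  mono-cong refl = ≈-refl

  mono-split : ∀ {c} a b → c ≡ a ℕ.+ b → mono c ≈ mono a * mono b
  mono-split a b refl = ≈-sym (mono-* a b)

  sumTo : ℕ → (ℕ → Series) → Series
  sumTo zero f = ι (+ 0)
  sumTo (suc n) f = sumTo n f + f n

  shanks : ℕ → ℕ → Series
  shanks n s = sg s * (p n * ip s) * mono (tri s ℕ.+ n ℕ.* s)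

  -- The companion of `shanks` in a telescoping pair: the increment of `shanks` from n to suc n at s
  -- equals `shanksRest n s - shanksRest n (suc s)`.
  shanksRest : ℕ → ℕ → Series
  shanksRest n zero = ι (+ 0)
  shanksRest n (suc s) = sg s * (p n * ip s) * mono (tri s ℕ.+ suc n ℕ.* suc s)

  shanks-step : ∀ n s → shanks (suc n) s + shanksRest n (suc s) ≈ shanks n s + shanksRest n s
  shanks-step n zero =
    p-suc n ▸ exponent (suc n) ▸ exponent n ▸ top ▸
    solve 8 (λ σ i a b m x y z →
      σ :* (b :* i) :* x :+ σ :* (a :* i) :* z := σ :* (a :* i) :* y :+ # 0 :+ σ :* i :* x :* (b :- a :* (# 1 :- m))
        :+ σ :* a :* i :* (# 1 :- m) :* (x :- # 1) :+ :- (σ :* a :* i) :* (y :- # 1) :+ σ :* a :* i :* (z :- m))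
      ≈-refl (sg 0) (ip 0) (p n) (p (suc n)) (mono (suc n)) (mono (suc n ℕ.* 0)) (mono (n ℕ.* 0)) (mono (suc n ℕ.* 1))
    where
    exponent : ∀ n → mono (n ℕ.* 0) ≈ ι (+ 1)
    exponent n = ≈-trans (mono-cong (ℕₚ.*-zeroʳ n)) mono-0
    top : mono (suc n ℕ.* 1) ≈ mono (suc n)
    top = mono-cong (ℕₚ.*-identityʳ (suc n))
  shanks-step n (suc s) =
    eqx ▸ eqy ▸ eqz ▸ p-suc n ▸ ip-suc s ▸ sg-suc s ▸
    solve 12 (λ σ τ i j a b u w M x y z →
      τ :* (b :* j) :* x :+ τ :* (a :* j) :* y := τ :* (a :* j) :* M :+ σ :* (a :* i) :* z :+ τ :* b :* j :* (x :- M :* u)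
        :+ τ :* a :* j :* (y :- M :* (u :* w)) :+ :- (σ :* a :* i) :* (z :- M) :+ τ :* j :* M :* u :* (b :- a :* (# 1 :- w))
        :+ :- (σ :* a :* M) :* (i :- j :* (# 1 :- u)) :+ a :* j :* M :* (u :- # 1) :* (τ :- :- σ))
      ≈-refl (sg s) (sg (suc s)) (ip s) (ip (suc s)) (p n) (p (suc n)) (mono (suc s)) (mono (suc n)) (mono (tri (suc s) ℕ.+ n ℕ.* suc s))
        (mono (tri (suc s) ℕ.+ suc n ℕ.* suc s)) (mono (tri (suc s) ℕ.+ suc n ℕ.* suc (suc s))) (mono (tri s ℕ.+ suc n ℕ.* suc s))
    where
    eqx : mono (tri (suc s) ℕ.+ suc n ℕ.* suc s) ≈ mono (tri (suc s) ℕ.+ n ℕ.* suc s) * mono (suc s)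
    eqx = mono-split (tri (suc s) ℕ.+ n ℕ.* suc s) (suc s) (arith n s (tri s))
      where
      arith : ∀ n s t → (suc s ℕ.+ t) ℕ.+ suc n ℕ.* suc s ≡ ((suc s ℕ.+ t) ℕ.+ n ℕ.* suc s) ℕ.+ suc s
      arith = ℕˢ.solve-∀
    eqy : mono (tri (suc s) ℕ.+ suc n ℕ.* suc (suc s)) ≈ mono (tri (suc s) ℕ.+ n ℕ.* suc s) * (mono (suc s) * mono (suc n))
    eqy = ≈-trans (mono-split (tri (suc s) ℕ.+ n ℕ.* suc s) (suc s ℕ.+ suc n) (arith n s (tri s))) (*-congˡ (mono-split (suc s) (suc n) refl))
      where
      arith : ∀ n s t → (suc s ℕ.+ t) ℕ.+ suc n ℕ.* suc (suc s) ≡ ((suc s ℕ.+ t) ℕ.+ n ℕ.* suc s) ℕ.+ (suc s ℕ.+ suc n)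
      arith = ℕˢ.solve-∀
    eqz : mono (tri s ℕ.+ suc n ℕ.* suc s) ≈ mono (tri (suc s) ℕ.+ n ℕ.* suc s)
    eqz = mono-cong (arith n s (tri s))
      where
      arith : ∀ n s t → t ℕ.+ suc n ℕ.* suc s ≡ (suc s ℕ.+ t) ℕ.+ n ℕ.* suc s
      arith = ℕˢ.solve-∀

  shanks-telescope : ∀ n m → sumTo m (shanks (suc n)) + shanksRest n m ≈ sumTo m (shanks n)
  shanks-telescope n zero = +-identityʳ (ι (+ 0))
  shanks-telescope n (suc m) =
    shanks-step n m ▸⁺ shanks-telescope n m ▸⁺
    solve 6 (λ A a B C c b → A :+ a :+ B := C :+ c :+ (a :+ B :- (c :+ b)) :+ (A :+ b :- C))
      ≈-refl (sumTo m (shanks (suc n))) (shanks (suc n) m) (shanksRest n (suc m)) (sumTo m (shanks n)) (shanks n m) (shanksRest n m)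

  pentA pentB : ℕ → ℕ
  pentA n = tri n ℕ.+ suc n ℕ.* suc n
  pentB n = tri (suc n) ℕ.+ suc n ℕ.* suc n

  pentagonal : ℕ → Series
  pentagonal zero = ι (+ 1)
  pentagonal (suc n) = pentagonal n + sg (suc n) * (mono (pentA n) + mono (pentB n))

  -- The range of summation grows with n, so two terms appear at suc n: the telescoping remainder
  -- `shanksRest n (suc n)`, which is sg n q^(pentA n) and enters with the opposite sign, and the
  -- new summand s = suc n, which is sg (suc n) q^(pentB n).
  shanks-sum : ∀ n → sumTo (suc n) (shanks n) ≈ pentagonal n
  shanks-sum zero =
    mono-0 ▸ p*ip 0 ▸ ≈-refl ▸⁺
    solve 4 (λ σ i a m → # 0 :+ σ :* (a :* i) :* m := # 1 :+ σ :* a :* i :* (m :- # 1) :+ σ :* (a :* i :- # 1) :+ (σ :- # 1))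
      ≈-refl (sg 0) (ip 0) (p 0) (mono 0)
  shanks-sum (suc n) =
    shanks-telescope n (suc n) ▸⁺ shanks-sum n ▸⁺ p*ip n ▸ p*ip (suc n) ▸ sg-suc n ▸
    solve 11 (λ A C F σ τ a i b j x y →
      A :+ τ :* (b :* j) :* y := F :+ τ :* (x :+ y) :+ (A :+ σ :* (a :* i) :* x :- C) :+ (C :- F) :+ :- (σ :* x) :* (a :* i :- # 1)
        :+ τ :* y :* (b :* j :- # 1) :+ :- x :* (τ :- :- σ))
      ≈-refl (sumTo (suc n) (shanks (suc n))) (sumTo (suc n) (shanks n)) (pentagonal n) (sg n) (sg (suc n)) (p n) (ip n) (p (suc n))
        (ip (suc n)) (mono (pentA n)) (mono (pentB n))

  -- The summand s = 0 is p n, and for s >= 1 the exponent tri s + n s exceeds n.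
  sum-small : ∀ n m → sumTo (suc m) (shanks n) ≈[ n ] p n
  sum-small n zero = ≈⇒≈[] (
    exponent ▸ ≈-refl ▸ p*ip 0 ▸ p-0 ▸
    solve 5 (λ σ i a b m →
      # 0 :+ σ :* (a :* i) :* m := a :+ σ :* a :* i :* (m :- # 1) :+ a :* i :* (σ :- # 1) :+ a :* (b :* i :- # 1)
        :+ :- (a :* i) :* (b :- # 1))
      ≈-refl (sg 0) (ip 0) (p n) (p 0) (mono (n ℕ.* 0)))
    where
    exponent : mono (n ℕ.* 0) ≈ ι (+ 1)
    exponent = ≈-trans (mono-cong (ℕₚ.*-zeroʳ n)) mono-0
  sum-small n (suc m) = []-trans ([]-+ (sum-small n m) small) (≈⇒≈[] (+-identityʳ (p n)))
    where
    small : shanks n (suc m) ≈[ n ] ι (+ 0)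
    small = []-trans (≈⇒≈[] (*-comm _ _)) (mono-small _ (s≤s (ℕₚ.≤-trans (ℕₚ.m≤m*n n (suc m)) (ℕₚ.m≤n+m (n ℕ.* suc m) (m ℕ.+ tri m)))))

  E≈pentagonal : ∀ n → E ≈[ n ] pentagonal n
  E≈pentagonal n = []-trans (E≈p ℕₚ.≤-refl) ([]-trans ([]-sym (sum-small n n)) (≈⇒≈[] (shanks-sum n)))

  -- Residues modulo 5 of triangular and pentagonal exponents

  ext-mono-off : ∀ r k → k ℕ.% 5 ≢ r ℕ.% 5 → ext r (mono k) ≈ ι (+ 0)
  ext-mono-off r k ne = coeffwise λ n → trans (mono-off k (r ℕ.+ n ℕ.* 5) λ e → ne (trans (cong (ℕ._% 5) e) (ℕᵐ.[m+kn]%n≡m%n r n 5))) (sym (ι0-coeff n))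

  tri-period : ∀ n → tri (5 ℕ.+ n) ≡ tri n ℕ.+ (n ℕ.+ 3) ℕ.* 5
  tri-period n = arith n (tri n)
    where
    arith : ∀ n t → (5 ℕ.+ n) ℕ.+ ((4 ℕ.+ n) ℕ.+ ((3 ℕ.+ n) ℕ.+ ((2 ℕ.+ n) ℕ.+ ((1 ℕ.+ n) ℕ.+ t)))) ≡ t ℕ.+ (n ℕ.+ 3) ℕ.* 5
    arith = ℕˢ.solve-∀

  Periodic : (ℕ → ℕ) → Set
  Periodic f = ∀ n → f (5 ℕ.+ n) ℕ.% 5 ≡ f n ℕ.% 5

  tri-periodic : Periodic tri
  tri-periodic n = trans (cong (ℕ._% 5) (tri-period n)) (ℕᵐ.[m+kn]%n≡m%n (tri n) (n ℕ.+ 3) 5)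

  pentA-periodic : Periodic pentA
  pentA-periodic n = trans (cong (ℕ._% 5) (trans (cong (ℕ._+ (6 ℕ.+ n) ℕ.* (6 ℕ.+ n)) (tri-period n)) (arith n (tri n))))
    (ℕᵐ.[m+kn]%n≡m%n (pentA n) (3 ℕ.* n ℕ.+ 10) 5)
    where
    arith : ∀ n t → t ℕ.+ (n ℕ.+ 3) ℕ.* 5 ℕ.+ (6 ℕ.+ n) ℕ.* (6 ℕ.+ n) ≡ t ℕ.+ (1 ℕ.+ n) ℕ.* (1 ℕ.+ n) ℕ.+ (3 ℕ.* n ℕ.+ 10) ℕ.* 5
    arith = ℕˢ.solve-∀

  pentB-periodic : Periodic pentB
  pentB-periodic n = trans (cong (ℕ._% 5) (trans (cong (ℕ._+ (6 ℕ.+ n) ℕ.* (6 ℕ.+ n)) (tri-period (suc n))) (arith n (tri (suc n)))))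
    (ℕᵐ.[m+kn]%n≡m%n (pentB n) (3 ℕ.* n ℕ.+ 11) 5)
    where
    arith : ∀ n t → t ℕ.+ (suc n ℕ.+ 3) ℕ.* 5 ℕ.+ (6 ℕ.+ n) ℕ.* (6 ℕ.+ n) ≡ t ℕ.+ (1 ℕ.+ n) ℕ.* (1 ℕ.+ n) ℕ.+ (3 ℕ.* n ℕ.+ 11) ℕ.* 5
    arith = ℕˢ.solve-∀

  periodic-at : ∀ f → Periodic f → ∀ c n → f (c ℕ.+ n ℕ.* 5) ℕ.% 5 ≡ f c ℕ.% 5
  periodic-at f per c zero = cong (λ k → f k ℕ.% 5) (ℕₚ.+-identityʳ c)
  periodic-at f per c (suc n) = trans (cong (λ k → f k ℕ.% 5) (arith c (n ℕ.* 5))) (trans (per (c ℕ.+ n ℕ.* 5)) (periodic-at f per c n))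
    where
    arith : ∀ c m → c ℕ.+ (5 ℕ.+ m) ≡ 5 ℕ.+ (c ℕ.+ m)
    arith = ℕˢ.solve-∀

  avoids : ∀ f {r} → Periodic f → f 0 ℕ.% 5 ≢ r → f 1 ℕ.% 5 ≢ r → f 2 ℕ.% 5 ≢ r → f 3 ℕ.% 5 ≢ r → f 4 ℕ.% 5 ≢ r →
           ∀ n → f n ℕ.% 5 ≢ r
  avoids f per a b c d e 0 = a
  avoids f per a b c d e 1 = b
  avoids f per a b c d e 2 = c
  avoids f per a b c d e 3 = d
  avoids f per a b c d e 4 = e
  avoids f per a b c d e (suc (suc (suc (suc (suc n))))) q = avoids f per a b c d e n (trans (sym (per n)) q)

  ext-sg* : ∀ r n f g → ext r (sg n * (f + g)) ≈ sg n * (ext r f + ext r g)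
  ext-sg* r n f g = ≈-trans (ext-ι* r (σ n) (f + g)) (*-congˡ (ext-+ r f g))

  ext-off-E : ∀ r → r ≡ r ℕ.% 5 → (∀ n → pentA n ℕ.% 5 ≢ r) → (∀ n → pentB n ℕ.% 5 ≢ r) → 0 ≢ r → ext r E ≈ ι (+ 0)
  ext-off-E r r%5 offA offB 0≢r = coeffwise λ n → trans (coeff≤ (E≈pentagonal (r ℕ.+ n ℕ.* 5)) _ ℕₚ.≤-refl) (coeff (go (r ℕ.+ n ℕ.* 5)) n)
    where
    off : ∀ k → k ℕ.% 5 ≢ r → ext r (mono k) ≈ ι (+ 0)
    off k ne = ext-mono-off r k λ e → ne (trans e (sym r%5))
    go : ∀ m → ext r (pentagonal m) ≈ ι (+ 0)
    go zero = ≈-trans (ext-cong r (≈-sym mono-0)) (off 0 0≢r)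
    go (suc m) = ≈-trans (ext-+ r (pentagonal m) _) (
      ext-sg* r (suc m) (mono (pentA m)) (mono (pentB m)) ▸⁺ go m ▸⁺ off (pentA m) (offA m) ▸ off (pentB m) (offB m) ▸
      solve 5 (λ a b σ x y → a :+ b := # 0 :+ (b :- σ :* (x :+ y)) :+ (a :- # 0) :+ σ :* (x :- # 0) :+ σ :* (y :- # 0))
        ≈-refl (ext r (pentagonal m)) (ext r (sg (suc m) * (mono (pentA m) + mono (pentB m)))) (sg (suc m)) (ext r (mono (pentA m)))
          (ext r (mono (pentB m))))

  -- Generalised pentagonal numbers are 0, 1 or 2 modulo 5.
  ext₃-E : ext 3 E ≈ ι (+ 0)
  ext₃-E = ext-off-E 3 refl (avoids pentA pentA-periodic (λ ()) (λ ()) (λ ()) (λ ()) (λ ())) (avoids pentB pentB-periodic (λ ()) (λ ()) (λ ()) (λ ()) (λ ())) (λ ())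

  ext₄-E : ext 4 E ≈ ι (+ 0)
  ext₄-E = ext-off-E 4 refl (avoids pentA pentA-periodic (λ ()) (λ ()) (λ ()) (λ ()) (λ ())) (avoids pentB pentB-periodic (λ ()) (λ ()) (λ ()) (λ ()) (λ ())) (λ ())

  V-mono : ∀ g → V (mono g) ≈ mono (g ℕ.* 5)
  V-mono g = coeffwise (go g)
    where
    go : ∀ g n → V (mono g) n ≡ mono (g ℕ.* 5) n
    go zero zero = refl
    go zero (suc n) = dilate-zero 4 4 n
    go (suc g) zero = refl
    go (suc g) (suc n) = coeff (≈-trans (≈-sym (dilate-mono 4 4 (mono g))) (≈-trans (*-congˡ (coeffwise (go g))) (mono-* 4 (g ℕ.* 5)))) n

  ext₁-mono : ∀ g → ext 1 (mono (1 ℕ.+ g ℕ.* 5 ℕ.* 5)) ≈ V (mono g)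
  ext₁-mono g = coeffwise λ n → trans (values (g ℕ.* 5) n) (sym (coeff (V-mono g) n))
    where
    values : ∀ x n → mono (x ℕ.* 5) (n ℕ.* 5) ≡ mono x n
    values zero zero = refl
    values zero (suc n) = refl
    values (suc x) zero = refl
    values (suc x) (suc n) = values x n

  tri-5 : ∀ n → tri (n ℕ.* 5) ℕ.+ 10 ℕ.* n ≡ 25 ℕ.* tri n
  tri-5 zero = refl
  tri-5 (suc n) = trans (cong (ℕ._+ 10 ℕ.* suc n) (tri-period (n ℕ.* 5))) (trans (arith n (tri (n ℕ.* 5)))
    (trans (cong (λ w → w ℕ.+ 25 ℕ.* suc n) (tri-5 n)) (arith′ n (tri n))))
    where
    arith : ∀ n t → t ℕ.+ (n ℕ.* 5 ℕ.+ 3) ℕ.* 5 ℕ.+ 10 ℕ.* suc n ≡ t ℕ.+ 10 ℕ.* n ℕ.+ 25 ℕ.* suc n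
    arith = ℕˢ.solve-∀
    arith′ : ∀ n t → 25 ℕ.* t ℕ.+ 25 ℕ.* suc n ≡ 25 ℕ.* (suc n ℕ.+ t)
    arith′ = ℕˢ.solve-∀

  pentA-5 : ∀ n → pentA (5 ℕ.+ n ℕ.* 5) ≡ 1 ℕ.+ pentB n ℕ.* 5 ℕ.* 5
  pentA-5 n = trans (cong (ℕ._+ (6 ℕ.+ n ℕ.* 5) ℕ.* (6 ℕ.+ n ℕ.* 5)) (tri-period (n ℕ.* 5))) (trans (arith n (tri (n ℕ.* 5)))
    (trans (cong (λ w → w ℕ.+ (51 ℕ.+ 75 ℕ.* n ℕ.+ 25 ℕ.* n ℕ.* n)) (tri-5 n)) (arith′ n (tri n))))
    where
    arith : ∀ n t → t ℕ.+ (n ℕ.* 5 ℕ.+ 3) ℕ.* 5 ℕ.+ (6 ℕ.+ n ℕ.* 5) ℕ.* (6 ℕ.+ n ℕ.* 5) ≡ t ℕ.+ 10 ℕ.* n ℕ.+ (51 ℕ.+ 75 ℕ.* n ℕ.+ 25 ℕ.* n ℕ.* n)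
    arith = ℕˢ.solve-∀
    arith′ : ∀ n t → 25 ℕ.* t ℕ.+ (51 ℕ.+ 75 ℕ.* n ℕ.+ 25 ℕ.* n ℕ.* n) ≡ 1 ℕ.+ (suc n ℕ.+ t ℕ.+ suc n ℕ.* suc n) ℕ.* 5 ℕ.* 5
    arith′ = ℕˢ.solve-∀

  pentB-5 : ∀ n → pentB (3 ℕ.+ n ℕ.* 5) ≡ 1 ℕ.+ pentA n ℕ.* 5 ℕ.* 5
  pentB-5 n = trans (arith n (tri (n ℕ.* 5))) (trans (cong (λ w → w ℕ.+ (26 ℕ.+ 50 ℕ.* n ℕ.+ 25 ℕ.* n ℕ.* n)) (tri-5 n)) (arith′ n (tri n)))
    where
    arith : ∀ n t → ((4 ℕ.+ n ℕ.* 5) ℕ.+ ((3 ℕ.+ n ℕ.* 5) ℕ.+ ((2 ℕ.+ n ℕ.* 5) ℕ.+ ((1 ℕ.+ n ℕ.* 5) ℕ.+ t)))) ℕ.+ (4 ℕ.+ n ℕ.* 5) ℕ.* (4 ℕ.+ n ℕ.* 5) ≡ t ℕ.+ 10 ℕ.* n ℕ.+ (26 ℕ.+ 50 ℕ.* n ℕ.+ 25 ℕ.* n ℕ.* n)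
    arith = ℕˢ.solve-∀
    arith′ : ∀ n t → 25 ℕ.* t ℕ.+ (26 ℕ.+ 50 ℕ.* n ℕ.+ 25 ℕ.* n ℕ.* n) ≡ 1 ℕ.+ (t ℕ.+ suc n ℕ.* suc n) ℕ.* 5 ℕ.* 5
    arith′ = ℕˢ.solve-∀

  σ-5 : ∀ n → σ (n ℕ.* 5) ≡ σ n
  σ-5 zero = refl
  σ-5 (suc n) = trans (cong (λ z → ℤ.- (ℤ.- (ℤ.- (ℤ.- (ℤ.- z))))) (σ-5 n)) (trans (ℤₚ.neg-involutive _) (ℤₚ.neg-involutive _))

  -- For a pentagonal number g, 24g + 1 is a square. If g ≡ 1 modulo 5, this square is divisible by
  -- 5, hence by 25, and g = 1 + 25 g' with g' again pentagonal. These g are the first exponent 1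
  -- and the two families in `pentB-5` and `pentA-5`; the cut-off 2 + 5n includes exactly those
  -- whose g' occurs in `pentagonal n`.
  ext₁-pentagonal : ∀ n → ext 1 (pentagonal (2 ℕ.+ n ℕ.* 5)) ≈ - V (pentagonal n)
  ext₁-pentagonal n = go n
    where
    z : Series
    z = ι (+ 0)
    term : ℕ → Series
    term m = sg (suc m) * (mono (pentA m) + mono (pentB m))
    ext-term : ∀ m {a b} → ext 1 (mono (pentA m)) ≈ a → ext 1 (mono (pentB m)) ≈ b → ext 1 (term m) ≈ sg (suc m) * (a + b)
    ext-term m α β = ≈-trans (ext-sg* 1 (suc m) (mono (pentA m)) (mono (pentB m))) (*-congˡ (+-cong α β))
    offA : ∀ c n → pentA c ℕ.% 5 ≢ 1 → ext 1 (mono (pentA (c ℕ.+ n ℕ.* 5))) ≈ z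
    offA c n ne = ext-mono-off 1 (pentA (c ℕ.+ n ℕ.* 5)) λ e → ne (trans (sym (periodic-at pentA pentA-periodic c n)) e)
    offB : ∀ c n → pentB c ℕ.% 5 ≢ 1 → ext 1 (mono (pentB (c ℕ.+ n ℕ.* 5))) ≈ z
    offB c n ne = ext-mono-off 1 (pentB (c ℕ.+ n ℕ.* 5)) λ e → ne (trans (sym (periodic-at pentB pentB-periodic c n)) e)
    extend : ∀ m {a b} → ext 1 (pentagonal m) ≈ a → ext 1 (term m) ≈ b → ext 1 (pentagonal (suc m)) ≈ a + b
    extend m α β = ≈-trans (ext-+ 1 (pentagonal m) (term m)) (+-cong α β)
    go : ∀ n → ext 1 (pentagonal (2 ℕ.+ n ℕ.* 5)) ≈ - V (pentagonal n)
    go zero = ≈-trans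
      (extend 1 (extend 0 (≈-trans (ext-cong 1 (≈-sym mono-0)) (ext-mono-off 1 0 λ ()))
        (ext-term 0 (ext₁-mono 0) (ext-mono-off 1 2 λ ())))
        (ext-term 1 (ext-mono-off 1 5 λ ()) (ext-mono-off 1 7 λ ())))
      (
        sg-suc 0 ▸ ≈-refl ▸ dilate-cong 4 0 mono-0 ▸⁻
        solve 5 (λ σ τ ρ m v → # 0 :+ τ :* (m :+ # 0) :+ ρ :* (# 0 :+ # 0) := :- v :+ m :* (τ :- :- σ) :+ :- m :* (σ :- # 1) :- (m :- v))
          ≈-refl (sg 0) (sg 1) (sg 2) (V (mono 0)) (V (ι (+ 1))))
    go (suc n) = ≈-trans
      (extend (6 ℕ.+ n ℕ.* 5) (extend (5 ℕ.+ n ℕ.* 5) (extend (4 ℕ.+ n ℕ.* 5) (extend (3 ℕ.+ n ℕ.* 5) (extend (2 ℕ.+ n ℕ.* 5) (go n)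
        (ext-term (2 ℕ.+ n ℕ.* 5) (offA 2 n λ ()) (offB 2 n λ ())))
        (ext-term (3 ℕ.+ n ℕ.* 5) (offA 3 n λ ()) (≈-trans (ext-cong 1 (mono-cong (pentB-5 n))) (ext₁-mono (pentA n)))))
        (ext-term (4 ℕ.+ n ℕ.* 5) (offA 4 n λ ()) (offB 4 n λ ())))
        (ext-term (5 ℕ.+ n ℕ.* 5) (≈-trans (ext-cong 1 (mono-cong (pentA-5 n))) (ext₁-mono (pentB n))) (offB 5 n λ ())))
        (ext-term (6 ℕ.+ n ℕ.* 5) (offA 6 n λ ()) (offB 6 n λ ())))
      (
        ≈-trans (ι-cong sign₄) (ι-‿-homo (σ (suc n))) ▸ ≈-trans (ι-cong sign₆) (ι-‿-homo (σ (suc n))) ▸ V-next ▸⁻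
        solve 10 (λ F G r s t u w σ a b →
          :- F :+ r :* (# 0 :+ # 0) :+ s :* (# 0 :+ a) :+ t :* (# 0 :+ # 0) :+ u :* (b :+ # 0) :+ w :* (# 0 :+ # 0) := :- G
            :+ a :* (s :- :- σ) :+ b :* (u :- :- σ) :- (F :+ σ :* (a :+ b) :- G))
          ≈-refl (V (pentagonal n)) (V (pentagonal (suc n))) (sg (3 ℕ.+ n ℕ.* 5)) (sg (4 ℕ.+ n ℕ.* 5)) (sg (5 ℕ.+ n ℕ.* 5))
            (sg (6 ℕ.+ n ℕ.* 5)) (sg (7 ℕ.+ n ℕ.* 5)) (sg (suc n)) (V (mono (pentA n))) (V (mono (pentB n))))
      where
      ι-cong : ∀ {a b} → a ≡ b → ι a ≈ ι b
      ι-cong refl = ≈-refl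
      sign₄ : σ (4 ℕ.+ n ℕ.* 5) ≡ ℤ.- σ (suc n)
      sign₄ = trans (ℤₚ.neg-involutive _) (trans (ℤₚ.neg-involutive _) (trans (σ-5 n) (sym (ℤₚ.neg-involutive (σ n)))))
      sign₆ : σ (6 ℕ.+ n ℕ.* 5) ≡ ℤ.- σ (suc n)
      sign₆ = trans (ℤₚ.neg-involutive _) sign₄
      V-next : V (pentagonal n) + sg (suc n) * (V (mono (pentA n)) + V (mono (pentB n))) ≈ V (pentagonal (suc n))
      V-next = ≈-sym (≈-trans (dilate-+ 4 0 (pentagonal n) (term n)) (+-congˡ (≈-trans (dilate-* 4 0 (sg (suc n)) (mono (pentA n) + mono (pentB n)))
        (*-cong (dilate-ι 4 (σ (suc n))) (dilate-+ 4 0 (mono (pentA n)) (mono (pentB n)))))))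

  ext₁-E : ext 1 E ≈ - V E
  ext₁-E = coeffwise λ n → trans (coeff≤ (E≈pentagonal (2 ℕ.+ n ℕ.* 5)) (1 ℕ.+ n ℕ.* 5) (ℕₚ.n≤1+n _))
    (trans (coeff (ext₁-pentagonal n) n) (trans (-‿coeff (V (pentagonal n)) n)
    (trans (cong ℤ.-_ (coeff≤ ([]-sym (dilate-[] 4 0 (E≈pentagonal n))) n ℕₚ.≤-refl)) (sym (-‿coeff (V E) n)))))

  dilate-multiple : ∀ k f m → dilate k 0 f (m ℕ.* suc k) ≡ f m
  dilate-multiple k f zero = refl
  dilate-multiple k f (suc m) = trans (dilate-shift k k (tail f) (m ℕ.* suc k)) (dilate-multiple k (tail f) m)

  dilate-gap : ∀ k j f n → (∀ m → n ≢ j ℕ.+ m ℕ.* suc k) → dilate k j f n ≡ + 0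
  dilate-gap k zero f zero h = ⊥-elim (h 0 refl)
  dilate-gap k (suc j) f zero h = refl
  dilate-gap k zero f (suc n) h = dilate-gap k k (tail f) n λ m e → h (suc m) (cong suc e)
  dilate-gap k (suc j) f (suc n) h = dilate-gap k j f n λ m e → h m (cong suc e)

  dilate-nondivisor : ∀ k f n → ¬ suc k ∣ n → dilate k 0 f n ≡ + 0
  dilate-nondivisor k f n ∤ = dilate-gap k 0 f n λ m e → ∤ (divides m e)

  -- Lambert series

  geo lin : Series
  geo n = + 1
  lin n = + n

  geo-unit : (ι (+ 1) - mono 1) * geo ≈ ι (+ 1)
  geo-unit = shift ▸⁺ solve 2 (λ q i → (# 1 :- q) :* i := # 1 :+ (i :- (# 1 :+ q :* i))) ≈-refl (mono 1) geo
    where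
    opaque
      unfolding _+_
      shift : geo ≈ ι (+ 1) + mono 1 * geo
      shift = coeffwise λ { zero → refl ; (suc n) → sym (trans (ℤₚ.+-identityˡ _) (trans (mono-suc-*-suc 0 geo n) (mono-0-* geo n))) }

  D-geo : D geo ≈ lin
  D-geo = coeffwise λ n → trans (D-coeff geo n) (ℤₚ.*-identityʳ (+ n))

  D-sub : ∀ f g → D (f - g) ≈ D f - D g
  D-sub f g = ≈-trans (D-+ f (- g)) (+-congˡ (D-neg g))

  D-ι* : ∀ z f → D (ι z * f) ≈ ι z * D f
  D-ι* z f =
    D-* (ι z) f ▸⁺ D-ι z ▸
    solve 5 (λ a b z f c → a := z :* c :+ (a :- (b :* f :+ z :* c)) :+ f :* (b :- # 0))
      ≈-refl (D (ι z * f)) (D (ι z)) (ι z) f (D f)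

  lin≈ : lin ≈ geo * geo - geo
  lin≈ =
    D-geo ▸⁻ geo-unit ▸ ≈-trans (D-cong geo-unit) (D-ι (+ 1)) ▸ D-* (ι (+ 1) - mono 1) geo ▸ D-sub (ι (+ 1)) (mono 1) ▸ D-ι (+ 1) ▸
    D-mono 1 ▸ geo-unit ▸
    solve 8 (λ q i lin a b c d e →
      lin := i :* i :- i :- (a :- lin) :+ :- a :* ((# 1 :- q) :* i :- # 1) :+ i :* (b :- # 0) :+ :- i :* (b :- (c :* i :+ (# 1 :- q) :* a))
        :+ :- (i :* i) :* (c :- (d :- e)) :+ :- (i :* i) :* (d :- # 0) :+ i :* i :* (e :- # 1 :* q) :+ :- i :* ((# 1 :- q) :* i :- # 1))
      ≈-refl (mono 1) geo lin (D geo) (D ((ι (+ 1) - mono 1) * geo)) (D (ι (+ 1) - mono 1)) (D (ι (+ 1))) (D (mono 1))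

  mono-lin : mono 1 ≈ (ι (+ 1) - mono 1) ^ 2 * lin
  mono-lin =
    lin≈ ▸ geo-unit ▸ geo-unit ▸
    solve 3 (λ q i lin →
      q := (# 1 :- q) :^ 2 :* lin :+ :- ((# 1 :- q) :^ 2) :* (lin :- (i :* i :- i)) :+ :- ((# 1 :- q) :* i) :* ((# 1 :- q) :* i :- # 1)
        :+ :- q :* ((# 1 :- q) :* i :- # 1))
      ≈-refl (mono 1) geo lin

  D-square : ∀ f → D (f * f) ≈ ι (+ 2) * f * D f
  D-square f = ≈-trans (D-* f f) (solve 2 (λ f d → d :* f :+ f :* d := # 2 :* f :* d) ≈-refl f (D f))

  -- This is (1 + q)/(1 - q), the logarithmic derivative of `lin` = q/(1 - q)^2. As its square is 4
  -- `lin` + 1, even iterates of D send `lin` to polynomials in `lin`.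
  slope : Series
  slope = ι (+ 2) * geo - ι (+ 1)

  D-slope : D slope ≈ ι (+ 2) * lin
  D-slope =
    D-sub (ι (+ 2) * geo) (ι (+ 1)) ▸⁺ D-ι* (+ 2) geo ▸⁺ D-ι (+ 1) ▸⁻ D-geo ▸
    solve 5 (λ a b c d lin → a := # 2 :* lin :+ (a :- (b :- c)) :+ (b :- # 2 :* d) :- (c :- # 0) :+ # 2 :* (d :- lin))
      ≈-refl (D slope) (D (ι (+ 2) * geo)) (D (ι (+ 1))) (D geo) lin

  slope² : slope * slope ≈ ι (+ 4) * lin + ι (+ 1)
  slope² =
    lin≈ ▸
    solve 2 (λ i lin → (# 2 :* i :- # 1) :* (# 2 :* i :- # 1) := # 4 :* lin :+ # 1 :+ :- # 4 :* (lin :- (i :* i :- i)))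
      ≈-refl geo lin

  D-lin : D lin ≈ slope * lin
  D-lin =
    D-cong lin≈ ▸⁺ D-sub (geo * geo) geo ▸⁺ D-square geo ▸⁺ D-geo ▸
    solve 6 (λ i lin a b c d →
      a := (# 2 :* i :- # 1) :* lin :+ (a :- b) :+ (b :- (c :- d)) :+ (c :- # 2 :* i :* d) :+ (# 2 :* i :- # 1) :* (d :- lin))
      ≈-refl geo lin (D lin) (D (geo * geo - geo)) (D (geo * geo)) (D geo)

  D²lin : D (D lin) ≈ lin + ι (+ 6) * (lin * lin)
  D²lin =
    D-cong D-lin ▸⁺ D-* slope lin ▸⁺ D-slope ▸ D-lin ▸ slope² ▸
    solve 6 (λ slope lin a b c d →
      a := lin :+ # 6 :* (lin :* lin) :+ (a :- b) :+ (b :- (c :* lin :+ slope :* d)) :+ lin :* (c :- # 2 :* lin)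
        :+ slope :* (d :- slope :* lin) :+ lin :* (slope :* slope :- (# 4 :* lin :+ # 1)))
      ≈-refl slope lin (D (D lin)) (D (slope * lin)) (D slope) (D lin)

  D³lin : D (D (D lin)) ≈ slope * (lin + ι (+ 12) * (lin * lin))
  D³lin =
    D-cong D²lin ▸⁺ D-+ lin (ι (+ 6) * (lin * lin)) ▸⁺ D-ι* (+ 6) (lin * lin) ▸⁺ D-square lin ▸ D-lin ▸
    solve 7 (λ slope lin a b c d e →
      a := slope :* (lin :+ # 12 :* (lin :* lin)) :+ (a :- b) :+ (b :- (d :+ c)) :+ (c :- # 6 :* e) :+ # 6 :* (e :- # 2 :* lin :* d)
        :+ (# 1 :+ # 12 :* lin) :* (d :- slope :* lin))
      ≈-refl slope lin (D (D (D lin))) (D (lin + ι (+ 6) * (lin * lin))) (D (ι (+ 6) * (lin * lin))) (D lin) (D (lin * lin))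

  D⁴lin : D (D (D (D lin))) ≈ lin + ι (+ 30) * (lin * lin) + ι (+ 120) * (lin * lin * lin)
  D⁴lin =
    D-cong D³lin ▸⁺ D-* slope (lin + ι (+ 12) * (lin * lin)) ▸⁺ D-slope ▸ D-+ lin (ι (+ 12) * (lin * lin)) ▸ D-ι* (+ 12) (lin * lin) ▸
    D-square lin ▸ D-lin ▸ slope² ▸
    solve 9 (λ slope lin a b h g c d e →
      a := lin :+ # 30 :* (lin :* lin) :+ # 120 :* (lin :* lin :* lin) :+ (a :- b)
        :+ (b :- (g :* (lin :+ # 12 :* (lin :* lin)) :+ slope :* h)) :+ (lin :+ # 12 :* (lin :* lin)) :* (g :- # 2 :* lin)
        :+ slope :* (h :- (d :+ c)) :+ slope :* (c :- # 12 :* e) :+ # 12 :* slope :* (e :- # 2 :* lin :* d)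
        :+ slope :* (# 1 :+ # 24 :* lin) :* (d :- slope :* lin) :+ lin :* (# 1 :+ # 24 :* lin) :* (slope :* slope :- (# 4 :* lin :+ # 1)))
      ≈-refl slope lin (D (D (D (D lin)))) (D (slope * (lin + ι (+ 12) * (lin * lin)))) (D (lin + ι (+ 12) * (lin * lin))) (D slope)
        (D (ι (+ 12) * (lin * lin))) (D lin) (D (lin * lin))

  fifth : Series
  fifth n = + (n ℕ.^ 5)

  fifth≈ : fifth ≈ lin + ι (+ 30) * (lin * lin) + ι (+ 120) * (lin * lin * lin)
  fifth≈ = ≈-trans (coeffwise values) D⁴lin
    where
    values : ∀ n → fifth n ≡ D (D (D (D lin))) n
    values n = sym (trans (step (D (D (D lin)))) (trans (cong (+ n ℤ.*_) (trans (step (D (D lin))) (cong (+ n ℤ.*_) (trans (step (D lin)) (cong (+ n ℤ.*_) (step lin))))))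
      (trans (cong (λ z → + n ℤ.* (+ n ℤ.* (+ n ℤ.* z))) (sym (ℤₚ.pos-* n n)))
      (trans (cong (λ z → + n ℤ.* (+ n ℤ.* z)) (sym (ℤₚ.pos-* n (n ℕ.* n))))
      (trans (cong (λ z → + n ℤ.* z) (sym (ℤₚ.pos-* n (n ℕ.* (n ℕ.* n)))))
      (trans (sym (ℤₚ.pos-* n (n ℕ.* (n ℕ.* (n ℕ.* n))))) (cong (λ z → + (n ℕ.* (n ℕ.* (n ℕ.* (n ℕ.* z))))) (sym (ℕₚ.*-identityʳ n)))))))))
      where
      step : ∀ f → D f n ≡ + n ℤ.* f n
      step f = D-coeff f n

  v : ℕ → Series
  v k = dilate k 0 lin

  mono-dilate : ∀ k g → dilate k 0 (mono g) ≈ mono (g ℕ.* suc k)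
  mono-dilate k g = coeffwise (go g)
    where
    go : ∀ g n → dilate k 0 (mono g) n ≡ mono (g ℕ.* suc k) n
    go zero zero = refl
    go zero (suc n) = dilate-zero k k n
    go (suc g) zero = refl
    go (suc g) (suc n) = coeff (≈-trans (≈-sym (dilate-mono k k (mono g))) (≈-trans (*-congˡ (coeffwise (go g))) (mono-* k (g ℕ.* suc k)))) n

  mono-v : ∀ k → mono (suc k) ≈ (ι (+ 1) - mono (suc k)) ^ 2 * v k
  mono-v k =
    pow ▸⁻ dilate-cong k 0 mono-lin ▸⁺ dilate-* k 0 ((ι (+ 1) - mono 1) ^ 2) lin ▸⁺ square ▸ linear ▸
    solve 6 (λ m v d e f g →
      m := (# 1 :- m) :^ 2 :* v :- (d :- m) :+ (d :- e) :+ (e :- f :* v) :+ v :* (f :- g :* g) :+ v :* (g :+ # 1 :- m) :* (g :- (# 1 :- m)))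
      ≈-refl (mono (suc k)) (v k) (dilate k 0 (mono 1)) (dilate k 0 ((ι (+ 1) - mono 1) ^ 2 * lin)) (dilate k 0 ((ι (+ 1) - mono 1) ^ 2))
        (dilate k 0 (ι (+ 1) - mono 1))
    where
    pow : dilate k 0 (mono 1) ≈ mono (suc k)
    pow = ≈-trans (mono-dilate k 1) (mono-cong (ℕₚ.*-identityˡ (suc k)))
    linear : dilate k 0 (ι (+ 1) - mono 1) ≈ ι (+ 1) - mono (suc k)
    linear = ≈-trans (dilate-+ k 0 (ι (+ 1)) (- mono 1)) (+-cong (dilate-ι k (+ 1)) (≈-trans (dilate-neg k 0 (mono 1)) (-‿cong pow)))
    square : dilate k 0 ((ι (+ 1) - mono 1) ^ 2) ≈ dilate k 0 (ι (+ 1) - mono 1) * dilate k 0 (ι (+ 1) - mono 1)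
    square = ≈-trans (dilate-cong k 0 (solve 1 (λ q → (# 1 :- q) :^ 2 := (# 1 :- q) :* (# 1 :- q)) ≈-refl (mono 1))) (dilate-* k 0 (ι (+ 1) - mono 1) (ι (+ 1) - mono 1))

  fifth-v : ∀ k → dilate k 0 fifth ≈ v k + ι (+ 30) * (v k * v k) + ι (+ 120) * (v k * v k * v k)
  fifth-v k = begin
    dilate k 0 fifth                                                          ≈⟨ dilate-cong k 0 fifth≈ ⟩
    dilate k 0 (lin + ι (+ 30) * (lin * lin) + ι (+ 120) * (lin * lin * lin))              ≈⟨ dilate-+ k 0 _ _ ⟩
    dilate k 0 (lin + ι (+ 30) * (lin * lin)) + dilate k 0 (ι (+ 120) * (lin * lin * lin)) ≈⟨ +-cong (≈-trans (dilate-+ k 0 _ _) (+-congˡ (scaled (+ 30) (lin * lin)))) (scaled (+ 120) (lin * lin * lin)) ⟩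
    v k + ι (+ 30) * dilate k 0 (lin * lin) + ι (+ 120) * dilate k 0 (lin * lin * lin)  ≈⟨ +-cong (+-congˡ (*-congˡ (dilate-* k 0 lin lin))) (*-congˡ (≈-trans (dilate-* k 0 (lin * lin) lin) (*-congʳ (dilate-* k 0 lin lin)))) ⟩
    v k + ι (+ 30) * (v k * v k) + ι (+ 120) * (v k * v k * v k)              ∎
    where
    open ≈R
    scaled : ∀ z f → dilate k 0 (ι z * f) ≈ ι z * dilate k 0 f
    scaled z f = ≈-trans (dilate-* k 0 (ι z) f) (*-congʳ (dilate-ι k z))

  dilate-low : ∀ k f → f 0 ≡ + 0 → dilate k 0 f ≈[ k ] ι (+ 0)
  dilate-low k f f0 = below λ m m≤k → trans (go m m≤k) (sym (ι0-coeff m))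
    where
    low : ∀ j g m → m ℕ.< j → dilate k j g m ≡ + 0
    low (suc j) g zero _ = refl
    low (suc j) g (suc m) (s≤s m<j) = low j g m m<j
    go : ∀ m → m ℕ.≤ k → dilate k 0 f m ≡ + 0
    go zero _ = f0
    go (suc m) m<k = low k (tail f) m m<k

  sum-stable : ∀ f → (∀ k → f k ≈[ k ] ι (+ 0)) → ∀ n → sumTo (suc n) f ≈[ n ] sumTo n f
  sum-stable f small n = []-trans ([]-+ (≈⇒≈[] ≈-refl) (small n)) (≈⇒≈[] (+-identityʳ (sumTo n f)))

  -- With d = k + 1 the term v k is q^d/(1 - q^d)^2. `G` is the Lambert form of Σ σ(n) q^n, and
  -- `L₂`, `L₃` are the power sums of the same terms, in which the Taylor coefficients of the triple
  -- product are expressed.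
  G L₂ L₃ S₅ : Series
  G = limit λ n → sumTo n v
  L₂ = limit λ n → sumTo n λ k → v k * v k
  L₃ = limit λ n → sumTo n λ k → v k * v k * v k
  S₅ = limit λ n → sumTo n λ k → dilate k 0 fifth

  v-low : ∀ k → v k ≈[ k ] ι (+ 0)
  v-low k = dilate-low k lin refl

  v²-low : ∀ k → v k * v k ≈[ k ] ι (+ 0)
  v²-low k = []-trans ([]-* (v-low k) (v-low k)) (≈⇒≈[] (zeroˡ _))

  v³-low : ∀ k → v k * v k * v k ≈[ k ] ι (+ 0)
  v³-low k = []-trans ([]-* (v²-low k) (v-low k)) (≈⇒≈[] (zeroˡ _))

  G≈ : ∀ {N M} → N ℕ.≤ M → G ≈[ N ] sumTo M v
  G≈ = limit-≈[] _ (sum-stable v v-low)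

  L₂≈ : ∀ {N M} → N ℕ.≤ M → L₂ ≈[ N ] sumTo M λ k → v k * v k
  L₂≈ = limit-≈[] _ (sum-stable _ v²-low)

  L₃≈ : ∀ {N M} → N ℕ.≤ M → L₃ ≈[ N ] sumTo M λ k → v k * v k * v k
  L₃≈ = limit-≈[] _ (sum-stable _ v³-low)

  S₅≈L : S₅ ≈ G + ι (+ 30) * L₂ + ι (+ 120) * L₃
  S₅≈L = []-limit λ N → []-trans (limit-≈[] _ (sum-stable _ λ k → dilate-low k fifth refl) (ℕₚ.≤-refl {N}))
    ([]-trans (≈⇒≈[] (sums N)) ([]-sym ([]-+ ([]-+ (G≈ ℕₚ.≤-refl) ([]-* (≈⇒≈[] ≈-refl) (L₂≈ ℕₚ.≤-refl))) ([]-* (≈⇒≈[] ≈-refl) (L₃≈ ℕₚ.≤-refl)))))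
    where
    sums : ∀ n → sumTo n (λ k → dilate k 0 fifth) ≈ sumTo n v + ι (+ 30) * sumTo n (λ k → v k * v k) + ι (+ 120) * sumTo n (λ k → v k * v k * v k)
    sums zero = solve 0 (# 0 := # 0 :+ # 30 :* # 0 :+ # 120 :* # 0) ≈-refl
    sums (suc n) = ≈-trans (+-cong (sums n) (fifth-v n))
      (
        solve 4 (λ a b c x →
          a :+ # 30 :* b :+ # 120 :* c :+ (x :+ # 30 :* (x :* x) :+ # 120 :* (x :* x :* x)) :=
            a :+ x :+ # 30 :* (b :+ x :* x) :+ # 120 :* (c :+ x :* x :* x))
          ≈-refl (sumTo n v) (sumTo n (λ k → v k * v k)) (sumTo n (λ k → v k * v k * v k)) (v n))

  scale-divisor : ∀ x {k} y m → suc k ℕ.* x ≡ 1 ℕ.+ y ℕ.* 5 → suc k ∣ m ℕ.* 5 → suc k ∣ m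
  scale-divisor x {k} y m e d = ∣m+n∣m⇒∣n {m = m ℕ.* 5 ℕ.* y} {n = m}
    (≡.subst (suc k ∣_) (trans (cong (m ℕ.*_) e) (arith m y)) (∣n⇒∣m*n m (m∣m*n x)))
    (∣m⇒∣m*n y d)
    where
    arith : ∀ m y → m ℕ.* (1 ℕ.+ y ℕ.* 5) ≡ m ℕ.* 5 ℕ.* y ℕ.+ m
    arith = ℕˢ.solve-∀

  -- The term v k is Σ m q^(m d) with d = suc k. When d has an inverse x modulo 5, an exponent m d
  -- is divisible by 5 only through m, and replacing m by 5m brings out the factor 5.
  U-v-coprime : ∀ x y k → suc k ℕ.* x ≡ 1 ℕ.+ y ℕ.* 5 → U (v k) ≈ ι (+ 5) * v k
  U-v-coprime x y k e = coeffwise λ n → trans (go n) (sym (ι-* (+ 5) (v k) n))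
    where
    go : ∀ n → v k (n ℕ.* 5) ≡ + 5 ℤ.* v k n
    go n with suc k ∣? n
    ... | yes (divides m refl) = trans (cong (v k) (arith m (suc k))) (trans (dilate-multiple k lin (m ℕ.* 5))
            (trans (ℤₚ.pos-* m 5) (trans (ℤₚ.*-comm (+ m) (+ 5)) (cong (+ 5 ℤ.*_) (sym (dilate-multiple k lin m))))))
      where
      arith : ∀ m k → m ℕ.* k ℕ.* 5 ≡ m ℕ.* 5 ℕ.* k
      arith = ℕˢ.solve-∀
    ... | no ∤ = trans (dilate-nondivisor k lin (n ℕ.* 5) λ d → ∤ (scale-divisor x y n e d))
            (sym (trans (cong (+ 5 ℤ.*_) (dilate-nondivisor k lin n ∤)) (ℤₚ.*-zeroʳ (+ 5))))

  V-v : ∀ k f → V (dilate k 0 f) ≈ dilate (4 ℕ.+ k ℕ.* 5) 0 f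
  V-v k f = coeffwise go
    where
    go : ∀ n → V (dilate k 0 f) n ≡ dilate (4 ℕ.+ k ℕ.* 5) 0 f n
    go n with 5 ∣? n
    ... | no ∤ = trans (dilate-nondivisor 4 _ n ∤) (sym (dilate-nondivisor (4 ℕ.+ k ℕ.* 5) f n λ { (divides m refl) → ∤ (divides (m ℕ.* suc k) (sym (ℕₚ.*-assoc m (suc k) 5))) }))
    ... | yes (divides x refl) with suc k ∣? x
    ...   | yes (divides m refl) = trans (dilate-multiple 4 (dilate k 0 f) (m ℕ.* suc k)) (trans (dilate-multiple k f m)
              (sym (trans (cong (dilate (4 ℕ.+ k ℕ.* 5) 0 f) (ℕₚ.*-assoc m (suc k) 5)) (dilate-multiple (4 ℕ.+ k ℕ.* 5) f m))))
    ...   | no ∤ = trans (dilate-multiple 4 (dilate k 0 f) x) (trans (dilate-nondivisor k f x ∤)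
              (sym (dilate-nondivisor (4 ℕ.+ k ℕ.* 5) f (x ℕ.* 5) λ { (divides m e) → ∤ (divides m (ℕₚ.*-cancelʳ-≡ x (m ℕ.* suc k) 5 (trans e (sym (ℕₚ.*-assoc m (suc k) 5))))) })))

  -- Divisors are taken in blocks of five. Those prime to 5 give 5 v each, which is 5 times the
  -- whole sum minus the part from multiples of 5, namely `V (sumTo n v)`. A divisor 5d contributes
  -- U (V v) = v, taken at d.
  U-sum : ∀ n → U (sumTo (n ℕ.* 5) v) ≈ ι (+ 5) * sumTo (n ℕ.* 5) v - ι (+ 5) * V (sumTo n v) + sumTo n v
  U-sum zero =
    (coeffwise λ n → trans (ι0-coeff (n ℕ.* 5)) (sym (ι0-coeff n))) ▸⁺ dilate-ι 4 (+ 0) ▸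
    solve 2 (λ a b → a := # 5 :* # 0 :- # 5 :* b :+ # 0 :+ (a :- # 0) :+ # 5 :* (b :- # 0))
      ≈-refl (U (ι (+ 0))) (V (ι (+ 0)))
  U-sum (suc n) = ≈-trans five (
    U-sum n ▸⁺ ≈-trans (dilate-+ 4 0 (sumTo n v) (v n)) (+-congˡ (V-v n lin)) ▸
    solve 11 (λ A S T a b c d e f X Y →
      A :+ # 5 :* a :+ # 5 :* b :+ # 5 :* c :+ # 5 :* d :+ f := # 5 :* (S :+ a :+ b :+ c :+ d :+ e) :- # 5 :* Y :+ (T :+ f)
        :+ (A :- (# 5 :* S :- # 5 :* X :+ T)) :+ # 5 :* (Y :- (X :+ e)))
      ≈-refl (U (sumTo m v)) (sumTo m v) (sumTo n v) (v m) (v (1 ℕ.+ m)) (v (2 ℕ.+ m)) (v (3 ℕ.+ m)) (v (4 ℕ.+ m)) (v n) (V (sumTo n v))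
        (V (sumTo (suc n) v)))
    where
    m : ℕ
    m = n ℕ.* 5
    step : ∀ k {a b} → U (sumTo k v) ≈ a → U (v k) ≈ b → U (sumTo (suc k) v) ≈ a + b
    step k α β = ≈-trans (ext-+ 0 (sumTo k v) (v k)) (+-cong α β)
    -- The inverses of 1, 2, 3, 4 modulo 5 are 1, 3, 2, 4.
    r₁ : ∀ m n → m ≡ n ℕ.* 5 → suc m ℕ.* 1 ≡ 1 ℕ.+ n ℕ.* 5
    r₁ m n refl = ℕₚ.*-identityʳ (suc m)
    r₂ : ∀ n → (2 ℕ.+ n ℕ.* 5) ℕ.* 3 ≡ 1 ℕ.+ (1 ℕ.+ n ℕ.* 3) ℕ.* 5
    r₂ = ℕˢ.solve-∀
    r₃ : ∀ n → (3 ℕ.+ n ℕ.* 5) ℕ.* 2 ≡ 1 ℕ.+ (1 ℕ.+ n ℕ.* 2) ℕ.* 5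
    r₃ = ℕˢ.solve-∀
    r₄ : ∀ n → (4 ℕ.+ n ℕ.* 5) ℕ.* 4 ≡ 1 ℕ.+ (3 ℕ.+ n ℕ.* 4) ℕ.* 5
    r₄ = ℕˢ.solve-∀
    five : U (sumTo (5 ℕ.+ m) v) ≈ U (sumTo m v) + ι (+ 5) * v m + ι (+ 5) * v (1 ℕ.+ m) + ι (+ 5) * v (2 ℕ.+ m) + ι (+ 5) * v (3 ℕ.+ m) + v n
    five = step (4 ℕ.+ m) (step (3 ℕ.+ m) (step (2 ℕ.+ m) (step (1 ℕ.+ m) (step m ≈-refl
      (U-v-coprime 1 n m (r₁ m n refl)))
      (U-v-coprime 3 (1 ℕ.+ n ℕ.* 3) (1 ℕ.+ m) (r₂ n)))
      (U-v-coprime 2 (1 ℕ.+ n ℕ.* 2) (2 ℕ.+ m) (r₃ n)))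
      (U-v-coprime 4 (3 ℕ.+ n ℕ.* 4) (3 ℕ.+ m) (r₄ n)))
      (≈-trans (ext-cong 0 (≈-sym (V-v n lin))) (U-V (v n)))

  -- The eigenvalue equation of the Hecke operator U + 5V, with eigenvalue σ(5) = 6.
  U-G : U G ≈ ι (+ 6) * G - ι (+ 5) * V G
  U-G = coeffwise λ n → trans (coeff≤ (G≈ {n ℕ.* 5} ℕₚ.≤-refl) (n ℕ.* 5) ℕₚ.≤-refl) (trans (coeff (U-sum n) n) (coeff≤ (close n) n ℕₚ.≤-refl))
    where
    close : ∀ n → ι (+ 5) * sumTo (n ℕ.* 5) v - ι (+ 5) * V (sumTo n v) + sumTo n v ≈[ n ] ι (+ 6) * G - ι (+ 5) * V G
    close n = []-trans ([]-+ ([]-+ ([]-* (≈⇒≈[] ≈-refl) ([]-sym (G≈ (ℕₚ.m≤m*n n 5)))) (≈⇒≈[] ≈-refl)) ([]-sym (G≈ ℕₚ.≤-refl)))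
      ([]-trans (≈⇒≈[] (solve 2 (λ g x → # 5 :* g :- # 5 :* x :+ g := # 6 :* g :+ :- # 5 :* x) ≈-refl G (V (sumTo n v)))) ([]-trans ([]-+ (≈⇒≈[] ≈-refl) ([]-* (≈⇒≈[] ≈-refl) (dilate-[] 4 0 ([]-sym (G≈ ℕₚ.≤-refl)))))
      (≈⇒≈[] (solve 2 (λ g x → # 6 :* g :+ :- # 5 :* x := # 6 :* g :- # 5 :* x) ≈-refl G (V G)))))

  -- Divisor sums as double sums

  Σ< : ℕ → (ℕ → ℤ) → ℤ
  Σ< zero h = + 0
  Σ< (suc n) h = Σ< n h ℤ.+ h n

  Σ<-cong : ∀ n {g h} → (∀ k → g k ≡ h k) → Σ< n g ≡ Σ< n h
  Σ<-cong zero e = refl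
  Σ<-cong (suc n) e = cong₂ ℤ._+_ (Σ<-cong n e) (e n)

  Σ<-front : ∀ n h → Σ< (suc n) h ≡ h 0 ℤ.+ Σ< n (h ∘ suc)
  Σ<-front zero h = trans (ℤₚ.+-identityˡ (h 0)) (sym (ℤₚ.+-identityʳ (h 0)))
  Σ<-front (suc n) h = trans (cong (ℤ._+ h (suc n)) (Σ<-front n h)) (ℤₚ.+-assoc (h 0) _ _)

  Σ<-+ : ∀ n g h → Σ< n (λ k → g k ℤ.+ h k) ≡ Σ< n g ℤ.+ Σ< n h
  Σ<-+ zero g h = refl
  Σ<-+ (suc n) g h = trans (cong (ℤ._+ (g n ℤ.+ h n)) (Σ<-+ n g h)) (arith (Σ< n g) (Σ< n h) (g n) (h n))
    where
    arith : ∀ a b c d → a ℤ.+ b ℤ.+ (c ℤ.+ d) ≡ a ℤ.+ c ℤ.+ (b ℤ.+ d)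
    arith = solve-∀

  Σ<-* : ∀ n z h → Σ< n (λ k → z ℤ.* h k) ≡ z ℤ.* Σ< n h
  Σ<-* zero z h = sym (ℤₚ.*-zeroʳ z)
  Σ<-* (suc n) z h = trans (cong (ℤ._+ z ℤ.* h n) (Σ<-* n z h)) (sym (ℤₚ.*-distribˡ-+ z _ _))

  Σ<-swap : ∀ m n (f : ℕ → ℕ → ℤ) → Σ< m (λ i → Σ< n (f i)) ≡ Σ< n (λ j → Σ< m (λ i → f i j))
  Σ<-swap zero n f = sym (zeros n)
    where
    zeros : ∀ n → Σ< n (λ _ → + 0) ≡ + 0
    zeros zero = refl
    zeros (suc n) = trans (ℤₚ.+-identityʳ _) (zeros n)
  Σ<-swap (suc m) n f = trans (cong (ℤ._+ Σ< n (f m)) (Σ<-swap m n f)) (sym (Σ<-+ n (λ j → Σ< m (λ i → f i j)) (f m)))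

  opaque
    unfolding _+_
    sumTo-coeff : ∀ n f m → sumTo n f m ≡ Σ< n (λ k → f k m)
    sumTo-coeff zero f m = ι0-coeff m
    sumTo-coeff (suc n) f m = cong (ℤ._+ f n m) (sumTo-coeff n f m)

  dilate-Σ : ∀ k j f n → dilate k j f n ≡ Σ< (suc n) (λ m → f m ℤ.* mono (j ℕ.+ m ℕ.* suc k) n)
  dilate-Σ k zero f zero = sym (trans (ℤₚ.+-identityˡ _) (ℤₚ.*-identityʳ (f 0)))
  dilate-Σ k (suc j) f zero = sym (trans (ℤₚ.+-identityˡ _) (ℤₚ.*-zeroʳ (f 0)))
  dilate-Σ k (suc j) f (suc n) = trans (dilate-Σ k j f n) (sym (trans (cong (λ z → Σ< (suc n) (λ m → f m ℤ.* mono (j ℕ.+ m ℕ.* suc k) n) ℤ.+ f (suc n) ℤ.* z)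
      (mono-off (j ℕ.+ suc n ℕ.* suc k) n λ e → ℕₚ.<⇒≢ (ℕₚ.≤-trans (ℕₚ.m≤m*n (suc n) (suc k)) (ℕₚ.m≤n+m _ j)) (sym e)))
    (trans (cong (λ z → Σ< (suc n) (λ m → f m ℤ.* mono (j ℕ.+ m ℕ.* suc k) n) ℤ.+ z) (ℤₚ.*-zeroʳ (f (suc n)))) (ℤₚ.+-identityʳ _))))
  dilate-Σ k zero f (suc n) = trans (dilate-Σ k k (tail f) n) (sym (trans (Σ<-front (suc n) (λ m → f m ℤ.* mono (m ℕ.* suc k) (suc n)))
    (trans (cong (ℤ._+ Σ< (suc n) (λ m → f (suc m) ℤ.* mono (k ℕ.+ m ℕ.* suc k) n)) (ℤₚ.*-zeroʳ (f 0))) (ℤₚ.+-identityˡ _))))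

  dilate-suc-Σ : ∀ k f n → f 0 ℤ.* mono 0 (suc n) ≡ + 0 → dilate k 0 f (suc n) ≡ Σ< (suc n) (λ m → f (suc m) ℤ.* mono (suc m ℕ.* suc k) (suc n))
  dilate-suc-Σ k f n z = trans (dilate-Σ k 0 f (suc n)) (trans (Σ<-front (suc n) (λ m → f m ℤ.* mono (m ℕ.* suc k) (suc n)))
    (trans (cong (ℤ._+ Σ< (suc n) (λ m → f (suc m) ℤ.* mono (suc m ℕ.* suc k) (suc n))) z) (ℤₚ.+-identityˡ _)))

  -- `dilate k 0 geo` is 1/(1 - q^(k+1)), whose nth coefficient is the indicator of k + 1 dividing
  -- n; it replaces the list filter in `σ₅`.
  σ₅-Σ : ∀ n → + σ₅ n ≡ Σ< n (λ k → fifth (suc k) ℤ.* dilate k 0 geo n)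
  σ₅-Σ n = trans (cong (λ xs → + sumℕ (map (λ d → d ℕ.^ 5) (filter (λ d → d ∣? n) xs))) (map-upTo suc n)) (go (λ k → k) n)
    where
    indicator : ℕ → ℤ
    indicator zero = + 0
    indicator (suc k) = dilate k 0 geo n
    go : ∀ (g : ℕ → ℕ) m → + sumℕ (map (λ d → d ℕ.^ 5) (filter (λ d → d ∣? n) (applyUpTo (suc ∘ g) m))) ≡ Σ< m (λ k → fifth (suc (g k)) ℤ.* indicator (suc (g k)))
    go g zero = refl
    go g (suc m) with suc (g 0) ∣? n
    ... | yes d = trans (cong (λ xs → + sumℕ (map (λ d → d ℕ.^ 5) xs)) (filter-accept (λ d → d ∣? n) d))
          (trans (ℤₚ.pos-+ (suc (g 0) ℕ.^ 5) _) (trans (cong₂ ℤ._+_ (sym (trans (cong (fifth (suc (g 0)) ℤ.*_) (one d)) (ℤₚ.*-identityʳ (fifth (suc (g 0)))))) (go (g ∘ suc) m))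
          (sym (Σ<-front m (λ k → fifth (suc (g k)) ℤ.* indicator (suc (g k)))))))
      where
      one : ∀ {k} → suc k ∣ n → dilate k 0 geo n ≡ + 1
      one {k} (divides q refl) = dilate-multiple k geo q
    ... | no ∤ = trans (cong (λ xs → + sumℕ (map (λ d → d ℕ.^ 5) xs)) (filter-reject (λ d → d ∣? n) ∤))
          (trans (go (g ∘ suc) m) (sym (trans (Σ<-front m (λ k → fifth (suc (g k)) ℤ.* indicator (suc (g k))))
          (trans (cong (ℤ._+ Σ< m (λ k → fifth (suc (g (suc k))) ℤ.* indicator (suc (g (suc k))))) (trans (cong (fifth (suc (g 0)) ℤ.*_) (dilate-nondivisor (g 0) geo n ∤)) (ℤₚ.*-zeroʳ (fifth (suc (g 0))))))
          (ℤₚ.+-identityˡ _)))))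

  -- In `S₅` the weight m^5 sits on the cofactor m of d = k + 1; exchanging the two sums moves it to
  -- the divisor.
  S₅-coeff : ∀ n → S₅ (suc n) ≡ + σ₅ (suc n)
  S₅-coeff n = begin
    S₅ N                                                                       ≡⟨ sumTo-coeff N (λ k → dilate k 0 fifth) N ⟩
    Σ< N (λ k → dilate k 0 fifth N)                                            ≡⟨ Σ<-cong N (λ k → dilate-suc-Σ k fifth n refl) ⟩
    Σ< N (λ k → Σ< N (λ m → fifth (suc m) ℤ.* mono (suc m ℕ.* suc k) N))       ≡⟨ Σ<-swap N N (λ k m → fifth (suc m) ℤ.* mono (suc m ℕ.* suc k) N) ⟩
    Σ< N (λ m → Σ< N (λ k → fifth (suc m) ℤ.* mono (suc m ℕ.* suc k) N))       ≡⟨ Σ<-cong N (λ m → Σ<-* N (fifth (suc m)) (λ k → mono (suc m ℕ.* suc k) N)) ⟩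
    Σ< N (λ m → fifth (suc m) ℤ.* Σ< N (λ k → mono (suc m ℕ.* suc k) N))       ≡⟨ Σ<-cong N (λ m → cong (fifth (suc m) ℤ.*_) (Σ<-cong N (commute m))) ⟩
    Σ< N (λ m → fifth (suc m) ℤ.* Σ< N (λ k → + 1 ℤ.* mono (suc k ℕ.* suc m) N)) ≡⟨ Σ<-cong N (λ m → cong (fifth (suc m) ℤ.*_) (dilate-suc-Σ m geo n refl)) ⟨
    Σ< N (λ m → fifth (suc m) ℤ.* dilate m 0 geo N)                            ≡⟨ σ₅-Σ N ⟨
    + σ₅ N                                                                     ∎
    where
    open ≡.≡-Reasoning
    N : ℕ
    N = suc n
    commute : ∀ m k → mono (suc m ℕ.* suc k) N ≡ + 1 ℤ.* mono (suc k ℕ.* suc m) N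
    commute m k = trans (cong (λ e → mono e N) (ℕₚ.*-comm (suc m) (suc k))) (sym (ℤₚ.*-identityˡ (mono (suc k ℕ.* suc m) N)))

  opaque
    unfolding _+_
    E₆≈S₅ : E₆ ≈ ι (+ 1) - ι (+ 504) * S₅
    E₆≈S₅ = coeffwise λ { zero → refl ; (suc n) → sym (trans (ℤₚ.+-identityˡ _) (cong ℤ.-_ (trans (ι-* (+ 504) S₅ (suc n)) (cong (+ 504 ℤ.*_) (S₅-coeff n))))) }

  -- The finite Jacobi triple product

  -- ρ n j = 1/(q;q)_{n-j}, which is 0 for j > n.
  ρ : ℕ → ℕ → Series
  ρ n zero = ip n
  ρ zero (suc j) = ι (+ 0)
  ρ (suc n) (suc j) = ρ n j

  ρ-suc : ∀ n j → ρ n j ≈ ρ (suc n) j * (ι (+ 1) - mono (suc n ℕ.∸ j))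
  ρ-suc n zero = ip-suc n
  ρ-suc zero (suc zero) = mono-0 ▸ solve 2 (λ i m → # 0 := i :* (# 1 :- m) :+ i :* (m :- # 1)) ≈-refl (ip 0) (mono 0)
  ρ-suc zero (suc (suc j)) = solve 1 (λ m → # 0 := # 0 :* (# 1 :- m)) ≈-refl (mono (zero ℕ.∸ suc j))
  ρ-suc (suc n) (suc j) = ρ-suc n j

  -- The factor q makes the exponent agree with the one in `ρ-suc` and gives q - q = 0 at j = n,
  -- where the left side vanishes.
  ρ-next : ∀ n j → mono 1 * ρ n (suc j) ≈ ρ n j * (mono 1 - mono (suc n ℕ.∸ j))
  ρ-next zero zero = solve 2 (λ q i → q :* # 0 := i :* (q :- q)) ≈-refl (mono 1) (ip 0)
  ρ-next zero (suc j) = solve 2 (λ q m → q :* # 0 := # 0 :* (q :- m)) ≈-refl (mono 1) (mono (zero ℕ.∸ j))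
  ρ-next (suc n) zero =
    ip-suc n ▸ mono-split 1 (suc n) refl ▸
    solve 5 (λ q i j m l → q :* i := j :* (q :- l) :+ q :* (i :- j :* (# 1 :- m)) :+ j :* (l :- q :* m))
      ≈-refl (mono 1) (ip n) (ip (suc n)) (mono (suc n)) (mono (suc (suc n)))
  ρ-next (suc n) (suc j) = ρ-next n j

  -- The two exponents add up to suc n only if j <= suc n. For larger j truncated subtraction spoils
  -- this, but then `ρ (suc n) j` is zero.
  ρ-shift : ∀ n j → ρ (suc n) j * (mono (suc n ℕ.∸ j) * mono j) ≈ ρ (suc n) j * mono (suc n)
  ρ-shift n zero =
    mono-0 ▸
    solve 3 (λ i m o → i :* (m :* o) := i :* m :+ i :* m :* (o :- # 1))
      ≈-refl (ip (suc n)) (mono (suc n)) (mono 0)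
  ρ-shift zero (suc zero) =
    mono-0 ▸
    solve 3 (λ i m o → i :* (o :* m) := i :* m :+ i :* m :* (o :- # 1))
      ≈-refl (ip 0) (mono 1) (mono 0)
  ρ-shift zero (suc (suc j)) =
    solve 3 (λ a b m → # 0 :* (a :* b) := # 0 :* m)
      ≈-refl (mono (zero ℕ.∸ suc j)) (mono (suc (suc j))) (mono 1)
  ρ-shift (suc n) (suc j) =
    mono-split 1 j refl ▸ ρ-shift n j ▸ mono-split 1 (suc n) refl ▸
    solve 7 (λ r a b c q m l → r :* (a :* b) := r :* m :+ r :* a :* (b :- q :* c) :+ q :* (r :* (a :* c) :- r :* l) :+ :- r :* (m :- q :* l))
      ≈-refl (ρ (suc n) j) (mono (suc n ℕ.∸ j)) (mono (suc j)) (mono j) (mono 1) (mono (suc (suc n))) (mono (suc n))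

  -- K n j is the coefficient of z^-j + … + z^j in ∏_{k ≤ n} (1 - z q^k) (1 - q^k/z), and W sums K against the values of
  -- z^-j + … + z^j or of its derivatives.
  K : ℕ → ℕ → Series
  K n j = sg j * mono (tri j) * (p (suc (n ℕ.+ n)) * ρ n j * ip (suc (n ℕ.+ j)))

  p-double : ∀ n → p (suc (suc n ℕ.+ suc n)) ≈ p (suc (n ℕ.+ n)) * (ι (+ 1) - mono (suc n) * mono (suc n)) * (ι (+ 1) - mono 1 * mono (suc n) * mono (suc n))
  p-double n rewrite ℕₚ.+-suc n n =
    p-suc (2 ℕ.+ (n ℕ.+ n)) ▸⁺ p-suc (suc (n ℕ.+ n)) ▸ y≈ ▸ mono-split 1 (2 ℕ.+ (n ℕ.+ n)) refl ▸ y≈ ▸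
    solve 7 (λ a b c x y N q →
      a := c :* (# 1 :- N :* N) :* (# 1 :- q :* N :* N) :+ (a :- b :* (# 1 :- x)) :+ (# 1 :- x) :* (b :- c :* (# 1 :- y))
        :+ :- ((# 1 :- x) :* c) :* (y :- N :* N) :+ :- (c :* (# 1 :- N :* N)) :* (x :- q :* y)
        :+ :- (c :* (# 1 :- N :* N) :* q) :* (y :- N :* N))
      ≈-refl (p (3 ℕ.+ (n ℕ.+ n))) (p (2 ℕ.+ (n ℕ.+ n))) (p (suc (n ℕ.+ n))) (mono (3 ℕ.+ (n ℕ.+ n))) (mono (2 ℕ.+ (n ℕ.+ n)))
        (mono (suc n)) (mono 1)
    where
    y≈ : mono (2 ℕ.+ (n ℕ.+ n)) ≈ mono (suc n) * mono (suc n)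
    y≈ = mono-split (suc n) (suc n) (cong suc (sym (ℕₚ.+-suc n n)))

  ip-cong : ∀ {a b} → a ≡ b → ip a ≈ ip b
  ip-cong refl = ≈-refl

  -- The new factor is (1 - z N)(1 - N/z) = 1 + N^2 - N (z + 1/z) with N = q^(n+1), and s_j = z^-j +
  -- ... + z^j satisfies (z + 1/z) s_j = s_(j-1) + s_(j+1). For the verification all four values of
  -- K are written over the same P, R and I, and `ρ-shift` supplies a x = N.
  K-suc-suc : ∀ n j → K (suc n) (suc j) ≈ (ι (+ 1) + mono (suc n) * mono (suc n)) * K n (suc j) - mono (suc n) * (K n j + K n (suc (suc j)))
  K-suc-suc n j =
    k≈ ▸⁺ k₁≈ ▸ k₂≈ ▸ k₃≈ ▸ ρ-shift n (suc j) ▸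
    solve 13 (λ k k₁ k₂ k₃ N q x σ τ P R I a →
      k := (# 1 :+ N :* N) :* k₁ :- N :* (k₂ :+ k₃) :+ (k :- :- (σ :* τ :* x :* (P :* (# 1 :- N :* N) :* (# 1 :- q :* N :* N) :* R :* I)))
        :+ :- (# 1 :+ N :* N) :* (k₁ :- :- (σ :* τ :* x :* (P :* (R :* (# 1 :- a)) :* (I :* (# 1 :- q :* x :* N)))))
        :+ N :* (k₂ :- σ :* τ :* (P :* R :* (I :* (# 1 :- q :* x :* N) :* (# 1 :- x :* N))))
        :+ N :* (k₃ :- σ :* τ :* (x :* x) :* (P :* (R :* (# 1 :- a) :* (q :- a)) :* I))
        :+ (:- (# 1 :+ N :* N) :* σ :* τ :* P :* I :* (# 1 :- q :* x :* N) :- N :* σ :* τ :* P :* I :* x :* q :- N :* σ :* τ :* P :* I :*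
        x :+ N :* σ :* τ :* P :* I :* (a :* x :+ N)) :* (R :* (a :* x) :- R :* N))
      ≈-refl (K (suc n) (suc j)) (K n (suc j)) (K n j) (K n (suc (suc j))) N (mono 1) (mono (suc j)) (sg j) (mono (tri j)) P R I a
    where
    N P R I a : Series
    N = mono (suc n)
    P = p (suc (n ℕ.+ n))
    R = ρ (suc n) (suc j)
    I = ip (suc (suc n ℕ.+ suc j))
    a = mono (suc n ℕ.∸ suc j)
    I₁ I₀ : Series
    I₁ = ip (suc (n ℕ.+ suc j))
    I₀ = ip (suc (n ℕ.+ j))
    q x : Series
    q = mono 1
    x = mono (suc j)
    mx : mono (tri (suc j)) ≈ mono (suc j) * mono (tri j)
    mx = mono-split (suc j) (tri j) refl
    mxx : mono (tri (suc (suc j))) ≈ mono 1 * mono (suc j) * (mono (suc j) * mono (tri j))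
    mxx = ≈-trans (mono-split (suc (suc j)) (tri (suc j)) refl) (*-cong (mono-split 1 (suc j) refl) mx)
    I₁≈ : I₁ ≈ I * (ι (+ 1) - q * x * N)
    I₁≈ = ≈-trans (ip-suc (suc (n ℕ.+ suc j))) (*-congˡ (+-congˡ (-‿cong (≈-trans (mono-split (suc (suc j)) (suc n) (arith n j)) (*-congʳ (mono-split 1 (suc j) refl))))))
      where
      arith : ∀ n j → suc (suc (n ℕ.+ suc j)) ≡ suc (suc j) ℕ.+ suc n
      arith = ℕˢ.solve-∀
    I₀≈ : I₀ ≈ I₁ * (ι (+ 1) - x * N)
    I₀≈ = ≈-trans (ip-suc (suc (n ℕ.+ j))) (*-cong (ip-cong (cong suc (sym (ℕₚ.+-suc n j)))) (+-congˡ (-‿cong (mono-split (suc j) (suc n) (arith n j)))))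
      where
      arith : ∀ n j → suc (suc (n ℕ.+ j)) ≡ suc j ℕ.+ suc n
      arith = ℕˢ.solve-∀
    k≈ : K (suc n) (suc j) ≈ - (sg j * mono (tri j) * x * (P * (ι (+ 1) - N * N) * (ι (+ 1) - q * N * N) * R * I))
    k≈ =
      sg-suc j ▸ mx ▸ p-double n ▸
      solve 11 (λ s σ t τ x p P N q R I →
        s :* t :* (p :* R :* I) := :- (σ :* τ :* x :* (P :* (# 1 :- N :* N) :* (# 1 :- q :* N :* N) :* R :* I))
          :+ t :* p :* R :* I :* (s :- :- σ) :+ :- (σ :* p :* R :* I) :* (t :- x :* τ)
          :+ :- (σ :* τ :* x :* R :* I) :* (p :- P :* (# 1 :- N :* N) :* (# 1 :- q :* N :* N)))
        ≈-refl (sg (suc j)) (sg j) (mono (tri (suc j))) (mono (tri j)) x (p (suc (suc n ℕ.+ suc n))) P N q R I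
    k₁≈ : K n (suc j) ≈ - (sg j * mono (tri j) * x * (P * (R * (ι (+ 1) - a)) * (I * (ι (+ 1) - q * x * N))))
    k₁≈ =
      sg-suc j ▸ mx ▸ ρ-suc n (suc j) ▸ I₁≈ ▸
      solve 13 (λ s σ t τ x P N q R I a r i →
        s :* t :* (P :* r :* i) := :- (σ :* τ :* x :* (P :* (R :* (# 1 :- a)) :* (I :* (# 1 :- q :* x :* N))))
          :+ t :* P :* r :* i :* (s :- :- σ) :+ :- (σ :* P :* r :* i) :* (t :- x :* τ)
          :+ :- (σ :* τ :* x :* P :* i) :* (r :- R :* (# 1 :- a))
          :+ :- (σ :* τ :* x :* P :* R :* (# 1 :- a)) :* (i :- I :* (# 1 :- q :* x :* N)))
        ≈-refl (sg (suc j)) (sg j) (mono (tri (suc j))) (mono (tri j)) x P N q R I a (ρ n (suc j)) I₁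
    k₂≈ : K n j ≈ sg j * mono (tri j) * (P * R * (I * (ι (+ 1) - q * x * N) * (ι (+ 1) - x * N)))
    k₂≈ =
      I₀≈ ▸ I₁≈ ▸
      solve 10 (λ σ τ x P N q R I j i →
        σ :* τ :* (P :* R :* j) := σ :* τ :* (P :* R :* (I :* (# 1 :- q :* x :* N) :* (# 1 :- x :* N)))
          :+ σ :* τ :* P :* R :* (j :- i :* (# 1 :- x :* N)) :+ σ :* τ :* P :* R :* (# 1 :- x :* N) :* (i :- I :* (# 1 :- q :* x :* N)))
        ≈-refl (sg j) (mono (tri j)) x P N q R I I₀ I₁
    k₃≈ : K n (suc (suc j)) ≈ sg j * mono (tri j) * (x * x) * (P * (R * (ι (+ 1) - a) * (q - a)) * I)
    k₃≈ =
      sg-suc (suc j) ▸ sg-suc j ▸ mxx ▸ ρ-next n (suc j) ▸ ρ-suc n (suc j) ▸ ip-cong (cong suc (ℕₚ.+-suc n (suc j))) ▸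
      solve 14 (λ s u σ t τ x P q R I a r h i →
        s :* t :* (P :* h :* i) := σ :* τ :* (x :* x) :* (P :* (R :* (# 1 :- a) :* (q :- a)) :* I) :+ t :* P :* h :* i :* (s :- :- u)
          :+ :- (t :* P :* h :* i) :* (u :- :- σ) :+ σ :* P :* h :* i :* (t :- q :* x :* (x :* τ))
          :+ σ :* x :* x :* τ :* P :* i :* (q :* h :- r :* (q :- a)) :+ σ :* x :* x :* τ :* P :* i :* (q :- a) :* (r :- R :* (# 1 :- a))
          :+ σ :* x :* x :* τ :* P :* (q :- a) :* R :* (# 1 :- a) :* (i :- I))
        ≈-refl (sg (suc (suc j))) (sg (suc j)) (sg j) (mono (tri (suc (suc j)))) (mono (tri j)) x P q R I a (ρ n (suc j))
          (ρ n (suc (suc j))) (ip (suc (n ℕ.+ suc (suc j))))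

  -- At the edge (z + 1/z) s_0 = s_1 - s_0, that is, s_(-1) = - s_0.
  K-suc-zero : ∀ n → K (suc n) 0 ≈ (ι (+ 1) + mono (suc n) * mono (suc n)) * K n 0 - mono (suc n) * (K n 1 - K n 0)
  K-suc-zero n =
    p-double n ▸ ip-suc n ▸ i≈ ▸ sg-suc 0 ▸ ip-cong (cong suc (ℕₚ.+-suc n 0)) ▸ ρ-next n 0 ▸ ip-suc n ▸ mono-0 ▸
    solve 13 (λ σ s τ q N P p R r h I i j →
      σ :* τ :* (p :* R :* I) := (# 1 :+ N :* N) :* (σ :* τ :* (P :* r :* i)) :- N :* (s :* q :* (P :* h :* j) :- σ :* τ :* (P :* r :* i))
        :+ σ :* τ :* R :* I :* (p :- P :* (# 1 :- N :* N) :* (# 1 :- q :* N :* N))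
        :+ :- ((# 1 :+ N :+ N :* N) :* σ :* τ :* P :* i) :* (r :- R :* (# 1 :- N))
        :+ :- ((# 1 :+ N :+ N :* N) :* σ :* τ :* P :* R :* (# 1 :- N)) :* (i :- I :* (# 1 :- q :* N))
        :+ N :* q :* P :* h :* j :* (s :- :- σ) :+ :- (N :* q :* P :* h :* σ) :* (j :- I)
        :+ :- (N :* P :* I :* σ) :* (q :* h :- r :* (q :- N)) :+ :- (N :* P :* I :* σ :* (q :- N)) :* (r :- R :* (# 1 :- N))
        :+ σ :* P :* R :* I :* ((# 1 :- N :* N) :* (# 1 :- q :* N :* N) :- (# 1 :+ N :+ N :* N) :* (# 1 :- N) :* (# 1 :- q :* N)) :* (τ :-
        # 1))
      ≈-refl (sg 0) (sg 1) (mono 0) (mono 1) (mono (suc n)) (p (suc (n ℕ.+ n))) (p (suc (suc n ℕ.+ suc n))) (ip (suc n)) (ip n) (ρ n 1)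
        (ip (suc (suc n ℕ.+ 0))) (ip (suc (n ℕ.+ 0))) (ip (suc (n ℕ.+ 1)))
    where
    i≈ : ip (suc (n ℕ.+ 0)) ≈ ip (suc (suc n ℕ.+ 0)) * (ι (+ 1) - mono 1 * mono (suc n))
    i≈ = ≈-trans (ip-suc (suc (n ℕ.+ 0))) (*-congˡ (+-congˡ (-‿cong (mono-split 1 (suc n) (cong (λ m → suc (suc m)) (ℕₚ.+-identityʳ n))))))

  K-0-0 : K 0 0 ≈ ι (+ 1)
  K-0-0 =
    ≈-refl ▸ mono-0 ▸ p*ip 1 ▸ p*ip 0 ▸⁺ p-0 ▸
    solve 6 (λ σ m a i b j →
      σ :* m :* (a :* i :* j) := # 1 :+ m :* a :* i :* j :* (σ :- # 1) :+ a :* i :* j :* (m :- # 1) :+ i :* (a :* j :- # 1)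
        :+ (b :* i :- # 1) :+ :- i :* (b :- # 1))
      ≈-refl (sg 0) (mono 0) (p 1) (ip 0) (p 0) (ip 1)

  K-beyond : ∀ n j → n ℕ.< j → K n j ≈ ι (+ 0)
  K-beyond n j n<j = ≈-trans (*-congˡ (*-congʳ (*-congˡ (≡⇒≈ (vanish n j n<j))))) (
    solve 3 (λ a b c → a :* (b :* # 0 :* c) := # 0)
      ≈-refl (sg j * mono (tri j)) (p (suc (n ℕ.+ n))) (ip (suc (n ℕ.+ j))))
    where
    ≡⇒≈ : ∀ {f g : Series} → f ≡ g → f ≈ g
    ≡⇒≈ refl = ≈-refl
    vanish : ∀ n j → n ℕ.< j → ρ n j ≡ ι (+ 0)
    vanish zero (suc j) _ = refl
    vanish (suc n) (suc j) (s≤s n<j) = vanish n j n<j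

  Weight : Set
  Weight = ℕ → ℤ

  -- The relation extends d to negative indices by d (-1) = - d 0.
  record SecondDifference (d e : Weight) (c : ℤ) : Set where
    field
      first : d 1 ℤ.- d 0 ≡ + 2 ℤ.* d 0 ℤ.+ c ℤ.* e 0
      rest  : ∀ j → d (suc (suc j)) ℤ.+ d j ≡ + 2 ℤ.* d (suc j) ℤ.+ c ℤ.* e (suc j)
  open SecondDifference

  W : ℕ → ℕ → Weight → Series
  W M n d = sumTo M λ j → K n j * ι (d j)

  ι-linear : ∀ a b c d e → a ℤ.+ b ≡ + 2 ℤ.* c ℤ.+ d ℤ.* e → ι a + ι b ≈ ι (+ 2) * ι c + ι d * ι e
  ι-linear a b c d e eq = begin
    ι a + ι b                          ≈⟨ ι-+-homo a b ⟨
    ι (a ℤ.+ b)                        ≡⟨ cong ι eq ⟩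
    ι (+ 2 ℤ.* c ℤ.+ d ℤ.* e)          ≈⟨ ι-+-homo (+ 2 ℤ.* c) (d ℤ.* e) ⟩
    ι (+ 2 ℤ.* c) + ι (d ℤ.* e)        ≈⟨ +-cong (ι-*-homo (+ 2) c) (ι-*-homo d e) ⟩
    ι (+ 2) * ι c + ι d * ι e          ∎
    where open ≈R

  -- Summation by parts: the neighbours in the recurrence of K are shifted onto d, where d (j+1) + d
  -- (j-1) = 2 d j + c e j. The last bracket is the boundary term at M, which vanishes once K does.
  by-parts : ∀ {d e c} → SecondDifference d e c → ∀ n M →
    W (suc M) (suc n) d ≈ (ι (+ 1) - mono (suc n)) ^ 2 * W (suc M) n d - mono (suc n) * (ι c * W (suc M) n e + (K n (suc M) * ι (d M) - K n M * ι (d (suc M))))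
  by-parts {d} {e} {c} sd n zero =
    K-suc-zero n ▸ ι-linear (d 1) (ℤ.- d 0) (d 0) c (e 0) (first sd) ▸ ι-‿-homo (d 0) ▸
    solve 9 (λ N k k₀ k₁ x y z c m →
      # 0 :+ k :* x := (# 1 :- N) :^ 2 :* (# 0 :+ k₀ :* x) :- N :* (c :* (# 0 :+ k₀ :* z) :+ (k₁ :* x :- k₀ :* y))
        :+ x :* (k :- ((# 1 :+ N :* N) :* k₀ :- N :* (k₁ :- k₀))) :+ N :* k₀ :* :- # 1 :* (y :+ m :- (# 2 :* x :+ c :* z))
        :+ N :* k₀ :* (m :- :- x))
      ≈-refl (mono (suc n)) (K (suc n) 0) (K n 0) (K n 1) (ι (d 0)) (ι (d 1)) (ι (e 0)) (ι c) (ι (ℤ.- d 0))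
  by-parts {d} {e} {c} sd n (suc M) =
    by-parts sd n M ▸⁺ K-suc-suc n M ▸ ι-linear (d (suc (suc M))) (d M) (d (suc M)) c (e (suc M)) (rest sd M) ▸
    solve 13 (λ N A B C k k₀ k₁ k₂ x y z w c →
      A :+ k :* y := (# 1 :- N) :^ 2 :* (B :+ k₁ :* y) :- N :* (c :* (C :+ k₁ :* w) :+ (k₂ :* y :- k₁ :* z))
        :+ (A :- ((# 1 :- N) :^ 2 :* B :- N :* (c :* C :+ (k₁ :* x :- k₀ :* y)))) :+ y :* (k :- ((# 1 :+ N :* N) :* k₁ :- N :* (k₀ :+ k₂)))
        :+ :- (N :* k₁) :* (z :+ x :- (# 2 :* y :+ c :* w)))
      ≈-refl (mono (suc n)) (W (suc M) (suc n) d) (W (suc M) n d) (W (suc M) n e) (K (suc n) (suc M)) (K n M) (K n (suc M))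
        (K n (suc (suc M))) (ι (d M)) (ι (d (suc M))) (ι (d (suc (suc M)))) (ι (e (suc M))) (ι c)

  W-suc : ∀ {d e c} → SecondDifference d e c → ∀ n M → suc n ℕ.< M →
    W M (suc n) d ≈ (ι (+ 1) - mono (suc n)) ^ 2 * W M n d - mono (suc n) * (ι c * W M n e)
  W-suc {d} {e} {c} sd n (suc M) (s≤s n<M) =
    by-parts sd n M ▸⁺ K-beyond n (suc M) (ℕₚ.m≤n⇒m≤1+n n<M) ▸ K-beyond n M n<M ▸
    solve 9 (λ N A B C k l x y c →
      A := (# 1 :- N) :^ 2 :* B :- N :* (c :* C) :+ (A :- ((# 1 :- N) :^ 2 :* B :- N :* (c :* C :+ (l :* x :- k :* y))))
        :+ :- (N :* x) :* (l :- # 0) :+ N :* y :* (k :- # 0))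
      ≈-refl (mono (suc n)) (W (suc M) (suc n) d) (W (suc M) n d) (W (suc M) n e) (K n M) (K n (suc M)) (ι (d M)) (ι (d (suc M))) (ι c)

  W-0 : ∀ d M → W (suc M) 0 d ≈ ι (d 0)
  W-0 d zero = K-0-0 ▸ solve 2 (λ k x → # 0 :+ k :* x := x :+ x :* (k :- # 1)) ≈-refl (K 0 0) (ι (d 0))
  W-0 d (suc M) =
    W-0 d M ▸⁺ K-beyond 0 (suc M) (s≤s z≤n) ▸
    solve 4 (λ A k x y → A :+ k :* y := x :+ (A :- x) :+ y :* (k :- # 0))
      ≈-refl (W (suc M) 0 d) (K 0 (suc M)) (ι (d 0)) (ι (d (suc M)))

  -- d₀, d₁, d₂, d₃ at j are, up to constant factors, the Taylor coefficients at z = 1 of z^-j + … + z^j in the variable z + 1/z - 2.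
  poly₀ poly₁ poly₂ poly₃ : ℤ → ℤ
  poly₀ z = + 2 ℤ.* z ℤ.+ + 1
  poly₁ z = poly₀ z ℤ.* (z ℤ.* (z ℤ.+ + 1))
  poly₂ z = poly₁ z ℤ.* (z ℤ.* (z ℤ.+ + 1) ℤ.- + 2)
  poly₃ z = poly₂ z ℤ.* (z ℤ.* (z ℤ.+ + 1) ℤ.- + 6)

  d₀ d₁ d₂ d₃ : Weight
  d₀ j = poly₀ (+ j)
  d₁ j = poly₁ (+ j)
  d₂ j = poly₂ (+ j)
  d₃ j = poly₃ (+ j)

  sd₀ : SecondDifference d₀ (λ _ → + 0) (+ 0)
  sd₀ = record { first = refl ; rest = λ j → arith (+ j) }
    where
    arith : ∀ z → (+ 2 ℤ.* (+ 2 ℤ.+ z) ℤ.+ + 1) ℤ.+ (+ 2 ℤ.* z ℤ.+ + 1) ≡ + 2 ℤ.* (+ 2 ℤ.* (+ 1 ℤ.+ z) ℤ.+ + 1) ℤ.+ + 0 ℤ.* + 0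
    arith = solve-∀

  -- With u = z + 1/z - 2, multiplication by u is the second difference in j, and `d₁`, `d₂`, `d₃`
  -- are 3!, 5!, 7! times the coefficients of u, u^2, u^3 in z^-j + ... + z^j. Hence the constants 6
  -- = 2·3, 20 = 4·5 and 42 = 6·7.
  sd₁ : SecondDifference d₁ d₀ (+ 6)
  sd₁ = record { first = refl ; rest = λ j → arith (+ j) }
    where
    arith : ∀ z → (+ 2 ℤ.* (+ 2 ℤ.+ z) ℤ.+ + 1) ℤ.* ((+ 2 ℤ.+ z) ℤ.* ((+ 2 ℤ.+ z) ℤ.+ + 1)) ℤ.+ (+ 2 ℤ.* z ℤ.+ + 1) ℤ.* (z ℤ.* (z ℤ.+ + 1))
       ≡ + 2 ℤ.* ((+ 2 ℤ.* (+ 1 ℤ.+ z) ℤ.+ + 1) ℤ.* ((+ 1 ℤ.+ z) ℤ.* ((+ 1 ℤ.+ z) ℤ.+ + 1))) ℤ.+ + 6 ℤ.* (+ 2 ℤ.* (+ 1 ℤ.+ z) ℤ.+ + 1)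
    arith = solve-∀

  sd₂ : SecondDifference d₂ d₁ (+ 20)
  sd₂ = record { first = refl ; rest = λ j → arith (+ j) }
    where
    arith : ∀ z → (+ 2 ℤ.* (+ 2 ℤ.+ z) ℤ.+ + 1) ℤ.* ((+ 2 ℤ.+ z) ℤ.* ((+ 2 ℤ.+ z) ℤ.+ + 1)) ℤ.* ((+ 2 ℤ.+ z) ℤ.* ((+ 2 ℤ.+ z) ℤ.+ + 1) ℤ.- + 2)
       ℤ.+ (+ 2 ℤ.* z ℤ.+ + 1) ℤ.* (z ℤ.* (z ℤ.+ + 1)) ℤ.* (z ℤ.* (z ℤ.+ + 1) ℤ.- + 2)
       ≡ + 2 ℤ.* ((+ 2 ℤ.* (+ 1 ℤ.+ z) ℤ.+ + 1) ℤ.* ((+ 1 ℤ.+ z) ℤ.* ((+ 1 ℤ.+ z) ℤ.+ + 1)) ℤ.* ((+ 1 ℤ.+ z) ℤ.* ((+ 1 ℤ.+ z) ℤ.+ + 1) ℤ.- + 2))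
       ℤ.+ + 20 ℤ.* ((+ 2 ℤ.* (+ 1 ℤ.+ z) ℤ.+ + 1) ℤ.* ((+ 1 ℤ.+ z) ℤ.* ((+ 1 ℤ.+ z) ℤ.+ + 1)))
    arith = solve-∀

  sd₃ : SecondDifference d₃ d₂ (+ 42)
  sd₃ = record { first = refl ; rest = λ j → arith (+ j) }
    where
    arith : ∀ z → (+ 2 ℤ.* (+ 2 ℤ.+ z) ℤ.+ + 1) ℤ.* ((+ 2 ℤ.+ z) ℤ.* ((+ 2 ℤ.+ z) ℤ.+ + 1)) ℤ.* ((+ 2 ℤ.+ z) ℤ.* ((+ 2 ℤ.+ z) ℤ.+ + 1) ℤ.- + 2) ℤ.* ((+ 2 ℤ.+ z) ℤ.* ((+ 2 ℤ.+ z) ℤ.+ + 1) ℤ.- + 6)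
       ℤ.+ (+ 2 ℤ.* z ℤ.+ + 1) ℤ.* (z ℤ.* (z ℤ.+ + 1)) ℤ.* (z ℤ.* (z ℤ.+ + 1) ℤ.- + 2) ℤ.* (z ℤ.* (z ℤ.+ + 1) ℤ.- + 6)
       ≡ + 2 ℤ.* ((+ 2 ℤ.* (+ 1 ℤ.+ z) ℤ.+ + 1) ℤ.* ((+ 1 ℤ.+ z) ℤ.* ((+ 1 ℤ.+ z) ℤ.+ + 1)) ℤ.* ((+ 1 ℤ.+ z) ℤ.* ((+ 1 ℤ.+ z) ℤ.+ + 1) ℤ.- + 2) ℤ.* ((+ 1 ℤ.+ z) ℤ.* ((+ 1 ℤ.+ z) ℤ.+ + 1) ℤ.- + 6))
       ℤ.+ + 42 ℤ.* ((+ 2 ℤ.* (+ 1 ℤ.+ z) ℤ.+ + 1) ℤ.* ((+ 1 ℤ.+ z) ℤ.* ((+ 1 ℤ.+ z) ℤ.+ + 1)) ℤ.* ((+ 1 ℤ.+ z) ℤ.* ((+ 1 ℤ.+ z) ℤ.+ + 1) ℤ.- + 2))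
    arith = solve-∀

  -- Up to the same constants, the Taylor coefficients of ∏ (1 - z q^k) (1 - q^k/z) / (1 - q^k)^2.

  e₁ e₂ e₃ : ℕ → Series
  e₁ n = ι (+ 6) * - sumTo n v
  e₂ n = ι (+ 60) * (sumTo n v * sumTo n v - sumTo n (λ k → v k * v k))
  e₃ n = ι (+ 840) * - (sumTo n v * sumTo n v * sumTo n v - ι (+ 3) * sumTo n v * sumTo n (λ k → v k * v k) + ι (+ 2) * sumTo n (λ k → v k * v k * v k))

  -- With u = z + 1/z - 2 and v = q^k/(1 - q^k)^2, the factor (1 - z q^k)(1 - q^k/z) is (1 - q^k)^2
  -- (1 - u v). So the coefficient of u^i in the product is (p n)^2 times (-1)^i times the ith
  -- elementary symmetric function of the v's. Here i = 0; `W₁`, `W₂`, `W₃` give the next three by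
  -- power sums.
  W₀ : ∀ n M → n ℕ.< M → W M n d₀ ≈ p n * p n
  W₀ zero (suc M) _ =
    W-0 d₀ M ▸⁺ p-0 ▸
    solve 2 (λ W p → W := p :* p :+ (W :- # 1) :+ (:- # 1 :- p) :* (p :- # 1))
      ≈-refl (W (suc M) 0 d₀) (p 0)
  W₀ (suc n) M n<M =
    W-suc sd₀ n M n<M ▸⁺ W₀ n M (ℕₚ.<-trans (ℕₚ.n<1+n n) n<M) ▸ p-suc n ▸
    solve 6 (λ A B C N p P →
      A := P :* P :+ (A :- ((# 1 :- N) :^ 2 :* B :- N :* (# 0 :* C))) :+ (# 1 :- N) :^ 2 :* (B :- p :* p)
        :+ (:- P :- p :* (# 1 :- N)) :* (P :- p :* (# 1 :- N)))
      ≈-refl (W M (suc n) d₀) (W M n d₀) (W M n (λ _ → + 0)) (mono (suc n)) (p n) (p (suc n))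

  W₁ : ∀ n M → n ℕ.< M → W M n d₁ ≈ p n * p n * e₁ n
  W₁ zero (suc M) _ = W-0 d₁ M ▸⁺ solve 2 (λ W p → W := p :* p :* (# 6 :* :- # 0) :+ (W :- # 0)) ≈-refl (W (suc M) 0 d₁) (p 0)
  W₁ (suc n) M n<M =
    W-suc sd₁ n M n<M ▸⁺ W₁ n M n<M′ ▸ W₀ n M n<M′ ▸ p-suc n ▸ mono-v n ▸
    solve 8 (λ A B C N p P g v →
      A := P :* P :* (# 6 :* :- (g :+ v)) :+ (A :- ((# 1 :- N) :^ 2 :* B :- N :* (# 6 :* C)))
        :+ (# 1 :- N) :^ 2 :* (B :- p :* p :* (# 6 :* :- g)) :+ :- # 6 :* N :* (C :- p :* p)
        :+ # 6 :* (g :+ v) :* (P :+ p :* (# 1 :- N)) :* (P :- p :* (# 1 :- N)) :+ :- # 6 :* p :* p :* (N :- (# 1 :- N) :^ 2 :* v))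
      ≈-refl (W M (suc n) d₁) (W M n d₁) (W M n d₀) (mono (suc n)) (p n) (p (suc n)) (sumTo n v) (v n)
    where n<M′ = ℕₚ.<-trans (ℕₚ.n<1+n n) n<M

  W₂ : ∀ n M → n ℕ.< M → W M n d₂ ≈ p n * p n * e₂ n
  W₂ zero (suc M) _ =
    W-0 d₂ M ▸⁺
    solve 2 (λ W p → W := p :* p :* (# 60 :* (# 0 :* # 0 :- # 0)) :+ (W :- # 0))
      ≈-refl (W (suc M) 0 d₂) (p 0)
  W₂ (suc n) M n<M =
    W-suc sd₂ n M n<M ▸⁺ W₂ n M n<M′ ▸ W₁ n M n<M′ ▸ p-suc n ▸ mono-v n ▸
    solve 9 (λ A B C N p P g l v →
      A := P :* P :* (# 60 :* ((g :+ v) :* (g :+ v) :- (l :+ v :* v))) :+ (A :- ((# 1 :- N) :^ 2 :* B :- N :* (# 20 :* C)))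
        :+ (# 1 :- N) :^ 2 :* (B :- p :* p :* (# 60 :* (g :* g :- l))) :+ :- # 20 :* N :* (C :- p :* p :* (# 6 :* :- g))
        :+ :- # 60 :* ((g :+ v) :* (g :+ v) :- (l :+ v :* v)) :* (P :+ p :* (# 1 :- N)) :* (P :- p :* (# 1 :- N))
        :+ # 120 :* g :* p :* p :* (N :- (# 1 :- N) :^ 2 :* v))
      ≈-refl (W M (suc n) d₂) (W M n d₂) (W M n d₁) (mono (suc n)) (p n) (p (suc n)) (sumTo n v) (sumTo n (λ k → v k * v k)) (v n)
    where n<M′ = ℕₚ.<-trans (ℕₚ.n<1+n n) n<M

  W₃ : ∀ n M → n ℕ.< M → W M n d₃ ≈ p n * p n * e₃ n
  W₃ zero (suc M) _ =
    W-0 d₃ M ▸⁺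
    solve 2 (λ W p → W := p :* p :* (# 840 :* :- (# 0 :* # 0 :* # 0 :- # 3 :* # 0 :* # 0 :+ # 2 :* # 0)) :+ (W :- # 0))
      ≈-refl (W (suc M) 0 d₃) (p 0)
  W₃ (suc n) M n<M =
    W-suc sd₃ n M n<M ▸⁺ W₃ n M n<M′ ▸ W₂ n M n<M′ ▸ p-suc n ▸ mono-v n ▸
    solve 10 (λ A B C N p P g l m v →
      A := P :* P :* (# 840 :* :- ((g :+ v) :* (g :+ v) :* (g :+ v) :- # 3 :* (g :+ v) :* (l :+ v :* v) :+ # 2 :* (m :+ v :* v :* v)))
        :+ (A :- ((# 1 :- N) :^ 2 :* B :- N :* (# 42 :* C)))
        :+ (# 1 :- N) :^ 2 :* (B :- p :* p :* (# 840 :* :- (g :* g :* g :- # 3 :* g :* l :+ # 2 :* m)))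
        :+ :- # 42 :* N :* (C :- p :* p :* (# 60 :* (g :* g :- l)))
        :+ # 840 :* ((g :+ v) :* (g :+ v) :* (g :+ v) :- # 3 :* (g :+ v) :* (l :+ v :* v) :+ # 2 :* (m :+ v :* v :* v)) :* (P :+ p :* (# 1
        :- N)) :* (P :- p :* (# 1 :- N)) :+ :- # 2520 :* (g :* g :- l) :* p :* p :* (N :- (# 1 :- N) :^ 2 :* v))
      ≈-refl (W M (suc n) d₃) (W M n d₃) (W M n d₂) (mono (suc n)) (p n) (p (suc n)) (sumTo n v) (sumTo n (λ k → v k * v k))
        (sumTo n (λ k → v k * v k * v k)) (v n)
    where n<M′ = ℕₚ.<-trans (ℕₚ.n<1+n n) n<M

  -- Limit of the finite triple product: theta series

  []-refl : ∀ {N f} → f ≈[ N ] f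
  []-refl = ≈⇒≈[] ≈-refl

  []-neg : ∀ {N f g} → f ≈[ N ] g → - f ≈[ N ] - g
  []-neg {f = f} {g} f≈g = []-trans (≈⇒≈[] (solve 1 (λ f → :- f := :- # 1 :* f) ≈-refl f)) ([]-trans ([]-* []-refl f≈g) (≈⇒≈[] (
    solve 1 (λ g → :- # 1 :* g := :- g)
      ≈-refl g)))

  ip≈ : ∀ {N m} → N ℕ.≤ m → ip m ≈[ N ] inverse E
  ip≈ {N} {m} N≤m = []-trans (≈⇒≈[] (
    inverse-*ʳ E E-const ▸
    solve 3 (λ i e r → i := i :* e :* r :+ :- i :* (e :* r :- # 1))
      ≈-refl (ip m) E (inverse E)))
    ([]-trans ([]-* ([]-* []-refl (E≈p N≤m)) []-refl)
    (≈⇒≈[] (p*ip m ▸ solve 3 (λ i p r → i :* p :* r := r :+ r :* (p :* i :- # 1)) ≈-refl (ip m) (p m) (inverse E))))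

  tri≥ : ∀ j → j ℕ.≤ tri j
  tri≥ zero = z≤n
  tri≥ (suc j) = ℕₚ.m≤m+n (suc j) (tri j)

  ρ-≤ : ∀ n j → j ℕ.≤ n → ρ n j ≡ ip (n ℕ.∸ j)
  ρ-≤ n zero _ = refl
  ρ-≤ (suc n) (suc j) (s≤s j≤n) = ρ-≤ n j j≤n

  -- The bracket in `K` tends to E · E^-1 · E^-1. Taking n = 2N leaves n - j >= N for j <= N, so its
  -- three factors have stabilised up to degree N; for j > N both sides have order above N.
  E*K : ∀ N j → E * K (N ℕ.+ N) j ≈[ N ] sg j * mono (tri j)
  E*K N j with j ℕₚ.≤? N
  ... | no j≰N = []-trans (≈⇒≈[] (
    solve 4 (λ e s m x → e :* (s :* m :* x) := m :* (e :* s :* x))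
      ≈-refl E (sg j) (mono (tri j)) (p (suc (n ℕ.+ n)) * ρ n j * ip (suc (n ℕ.+ j)))))
          ([]-trans (mono-small _ N<tri) ([]-trans ([]-sym (mono-small (sg j) N<tri)) (≈⇒≈[] (*-comm _ _))))
    where
    n = N ℕ.+ N
    N<tri = ℕₚ.<-≤-trans (ℕₚ.≰⇒> j≰N) (tri≥ j)
  ... | yes j≤N rewrite ρ-≤ (N ℕ.+ N) j (ℕₚ.≤-trans j≤N (ℕₚ.m≤m+n N N)) = []-trans
          ([]-* []-refl ([]-* []-refl ([]-* ([]-* ([]-sym (E≈p N≤₁)) (ip≈ N≤₂)) (ip≈ N≤₃))))
          (≈⇒≈[] (
            inverse-*ʳ E E-const ▸
            solve 4 (λ e s m r → e :* (s :* m :* (e :* r :* r)) := s :* m :+ s :* m :* (e :* r :+ # 1) :* (e :* r :- # 1))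
              ≈-refl E (sg j) (mono (tri j)) (inverse E)))
    where
    N≤₁ : N ℕ.≤ suc (N ℕ.+ N ℕ.+ (N ℕ.+ N))
    N≤₁ = ℕₚ.m≤n⇒m≤1+n (ℕₚ.≤-trans (ℕₚ.m≤m+n N N) (ℕₚ.m≤m+n (N ℕ.+ N) (N ℕ.+ N)))
    N≤₂ : N ℕ.≤ N ℕ.+ N ℕ.∸ j
    N≤₂ = ℕₚ.≤-trans (ℕₚ.≤-reflexive (sym (ℕₚ.m+n∸n≡m N N))) (ℕₚ.∸-monoʳ-≤ (N ℕ.+ N) j≤N)
    N≤₃ : N ℕ.≤ suc (N ℕ.+ N ℕ.+ j)
    N≤₃ = ℕₚ.m≤n⇒m≤1+n (ℕₚ.≤-trans (ℕₚ.m≤m+n N N) (ℕₚ.m≤m+n (N ℕ.+ N) j))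

  theta : ℕ → Weight → Series
  theta M d = sumTo M λ j → sg j * mono (tri j) * ι (d j)

  E*W : ∀ N M d → E * W M (N ℕ.+ N) d ≈[ N ] theta M d
  E*W N zero d = ≈⇒≈[] (zeroʳ E)
  E*W N (suc M) d = []-trans (≈⇒≈[] (
    solve 4 (λ e w k x → e :* (w :+ k :* x) := e :* w :+ e :* k :* x)
      ≈-refl E (W M (N ℕ.+ N) d) (K (N ℕ.+ N) M) (ι (d M))))
    ([]-+ (E*W N M d) ([]-* (E*K N M) []-refl))

  E³ : Series
  E³ = E * E * E

  E³≈theta : ∀ N {d e f} → W (suc (N ℕ.+ N)) (N ℕ.+ N) d ≈ p (N ℕ.+ N) * p (N ℕ.+ N) * e → f ≈[ N ] e → E³ * f ≈[ N ] theta (suc (N ℕ.+ N)) d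
  E³≈theta N {d} {e} {f} w f≈e = []-trans ([]-* ([]-* ([]-* []-refl (E≈p N≤)) (E≈p N≤)) f≈e)
    ([]-trans (≈⇒≈[] (
      w ▸
      solve 4 (λ e p f w → e :* p :* p :* f := e :* w :+ :- e :* (w :- p :* p :* f))
        ≈-refl E (p (N ℕ.+ N)) e (W (suc (N ℕ.+ N)) (N ℕ.+ N) d))) (E*W N (suc (N ℕ.+ N)) d))
    where N≤ = ℕₚ.m≤m+n N N

  tri-double : ∀ j → 2 ℕ.* tri j ≡ j ℕ.* (j ℕ.+ 1)
  tri-double zero = refl
  tri-double (suc j) = trans (arith j (tri j)) (trans (cong (λ w → 2 ℕ.* suc j ℕ.+ w) (tri-double j)) (arith′ j))
    where
    arith : ∀ j t → 2 ℕ.* (suc j ℕ.+ t) ≡ 2 ℕ.* suc j ℕ.+ 2 ℕ.* t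
    arith = ℕˢ.solve-∀
    arith′ : ∀ j → 2 ℕ.* suc j ℕ.+ j ℕ.* (j ℕ.+ 1) ≡ suc j ℕ.* (suc j ℕ.+ 1)
    arith′ = ℕˢ.solve-∀

  -- D multiplies q^(tri j) by j (j + 1)/2, so 2D - s multiplies the weights by j (j + 1) - s, which
  -- leads from each of `d₀`, `d₁`, `d₂` to the next.
  D-theta : ∀ s {d d′ : Weight} → (∀ j → d′ j ≡ d j ℤ.* (+ j ℤ.* (+ j ℤ.+ + 1) ℤ.- + s)) → ∀ M → theta M d′ ≈ ι (+ 2) * D (theta M d) - ι (+ s) * theta M d
  D-theta s {d} {d′} rel zero =
    D-ι (+ 0) ▸
    solve 2 (λ z s → # 0 := # 2 :* z :- s :* # 0 :+ :- # 2 :* (z :- # 0))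
      ≈-refl (D (ι (+ 0))) (ι (+ s))
  D-theta s {d} {d′} rel (suc M) =
    D-theta s rel M ▸⁺ D-+ (theta M d) (sg M * mono (tri M) * ι (d M)) ▸ term ▸ weight ▸ double ▸
    solve 12 (λ J I DI DS DT s σ m x y t z →
      J :+ σ :* m :* y := # 2 :* DS :- s :* (I :+ σ :* m :* x) :+ (J :- (# 2 :* DI :- s :* I)) :+ :- # 2 :* (DS :- (DI :+ DT))
        :+ :- # 2 :* (DT :- t :* (σ :* m :* x)) :+ σ :* m :* (y :- x :* (z :- s)) :+ :- (σ :* m :* x) :* (# 2 :* t :- z))
      ≈-refl (theta M d′) (theta M d) (D (theta M d)) (D (theta (suc M) d)) (D (sg M * mono (tri M) * ι (d M))) (ι (+ s)) (sg M)
        (mono (tri M)) (ι (d M)) (ι (d′ M)) (ι (+ tri M)) (ι (+ M ℤ.* (+ M ℤ.+ + 1)))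
    where
    weight : ι (d′ M) ≈ ι (d M) * (ι (+ M ℤ.* (+ M ℤ.+ + 1)) - ι (+ s))
    weight = ≈-trans (coeffwise λ n → cong (λ z → ι z n) (rel M)) (≈-trans (ι-*-homo (d M) _) (*-congˡ (≈-trans (ι-+-homo _ (ℤ.- + s)) (+-congˡ (ι-‿-homo (+ s))))))
    double : ι (+ 2) * ι (+ tri M) ≈ ι (+ M ℤ.* (+ M ℤ.+ + 1))
    double = ≈-trans (≈-sym (ι-*-homo (+ 2) (+ tri M))) (coeffwise λ n → cong (λ z → ι z n)
      (trans (sym (ℤₚ.pos-* 2 (tri M))) (trans (cong +_ (tri-double M)) (ℤₚ.pos-* M (M ℕ.+ 1)))))
    term : D (sg M * mono (tri M) * ι (d M)) ≈ ι (+ tri M) * (sg M * mono (tri M) * ι (d M))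
    term =
      D-* (sg M * mono (tri M)) (ι (d M)) ▸⁺ D-ι (d M) ▸ D-ι* (σ M) (mono (tri M)) ▸ D-mono (tri M) ▸
      solve 8 (λ a b c e σ m x t →
        a := t :* (σ :* m :* x) :+ (a :- (b :* x :+ σ :* m :* e)) :+ σ :* m :* (e :- # 0) :+ x :* (b :- σ :* c) :+ σ :* x :* (c :- t :* m))
        ≈-refl (D (sg M * mono (tri M) * ι (d M))) (D (sg M * mono (tri M))) (D (mono (tri M))) (D (ι (d M))) (sg M) (mono (tri M))
          (ι (d M)) (ι (+ tri M))

  -- Jacobi's identity and its first three derivatives

  X₁ X₂ X₃ : Series
  X₁ = ι (+ 6) * - G
  X₂ = ι (+ 60) * (G * G - L₂)
  X₃ = ι (+ 840) * - (G * G * G - ι (+ 3) * G * L₂ + ι (+ 2) * L₃)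

  module _ (N : ℕ) where
    private
      M : ℕ
      M = suc (N ℕ.+ N)
      N≤ : N ℕ.≤ N ℕ.+ N
      N≤ = ℕₚ.m≤m+n N N
      g = G≈ N≤
      l = L₂≈ N≤

    theta₀ : E³ * ι (+ 1) ≈[ N ] theta M d₀
    theta₀ = E³≈theta N (≈-trans (W₀ (N ℕ.+ N) M ℕₚ.≤-refl) (solve 1 (λ p → p :* p := p :* p :* # 1) ≈-refl (p (N ℕ.+ N)))) []-refl

    theta₁ : E³ * X₁ ≈[ N ] theta M d₁
    theta₁ = E³≈theta N (W₁ (N ℕ.+ N) M ℕₚ.≤-refl) ([]-* []-refl ([]-neg g))

    theta₂ : E³ * X₂ ≈[ N ] theta M d₂
    theta₂ = E³≈theta N (W₂ (N ℕ.+ N) M ℕₚ.≤-refl) ([]-* []-refl ([]-+ ([]-* g g) ([]-neg l)))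

    theta₃ : E³ * X₃ ≈[ N ] theta M d₃
    theta₃ = E³≈theta N (W₃ (N ℕ.+ N) M ℕₚ.≤-refl) ([]-* []-refl ([]-neg
      ([]-+ ([]-+ ([]-* ([]-* g g) g) ([]-neg ([]-* ([]-* []-refl g) l))) ([]-* []-refl (L₃≈ N≤)))))

  derive : ∀ s {f g : Series} {d d′ : Weight} → (∀ j → d′ j ≡ d j ℤ.* (+ j ℤ.* (+ j ℤ.+ + 1) ℤ.- + s)) →
    (∀ N → f ≈[ N ] theta (suc (N ℕ.+ N)) d) → (∀ N → g ≈[ N ] theta (suc (N ℕ.+ N)) d′) → g ≈ ι (+ 2) * D f - ι (+ s) * f
  derive s rel f≈ g≈ = []-limit λ N → []-trans (g≈ N) ([]-trans (≈⇒≈[] (D-theta s rel (suc (N ℕ.+ N))))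
    ([]-sym ([]-+ ([]-* []-refl (D-[] (f≈ N))) ([]-neg ([]-* []-refl (f≈ N))))))

  J₁ : E³ * X₁ ≈ ι (+ 2) * D (E³ * ι (+ 1)) - ι (+ 0) * (E³ * ι (+ 1))
  J₁ = derive 0 (λ j → arith (d₀ j) (+ j ℤ.* (+ j ℤ.+ + 1))) theta₀ theta₁
    where
    arith : ∀ a b → a ℤ.* b ≡ a ℤ.* (b ℤ.- + 0)
    arith = solve-∀

  J₂ : E³ * X₂ ≈ ι (+ 2) * D (E³ * X₁) - ι (+ 2) * (E³ * X₁)
  J₂ = derive 2 (λ j → refl) theta₁ theta₂

  J₃ : E³ * X₃ ≈ ι (+ 2) * D (E³ * X₂) - ι (+ 6) * (E³ * X₂)
  J₃ = derive 6 (λ j → refl) theta₂ theta₃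

  -- `J₁` says - 6 G E^3 = 2 D (E^3), so the logarithmic derivative of the product comes from the
  -- theta side.
  D-E : D E ≈ - (G * E)
  D-E = unit-cancel (E * E) (*-const E-const E-const) (ι-cancel 6 (
    J₁ ▸⁻ D-* E³ (ι (+ 1)) ▸ D-ι (+ 1) ▸ D-* (E * E) E ▸ D-* E E ▸
    solve 7 (λ E G d a b c e →
      # 6 :* (E :* E :* d) := # 6 :* (E :* E :* :- (G :* E)) :- (E :* E :* E :* (# 6 :* :- G) :- (# 2 :* a :- # 0 :* (E :* E :* E :* # 1)))
        :+ :- # 2 :* (a :- (b :* # 1 :+ E :* E :* E :* e)) :+ :- # 2 :* E :* E :* E :* (e :- # 0)
        :+ :- # 2 :* (b :- (c :* E :+ E :* E :* d)) :+ :- # 2 :* E :* (c :- (d :* E :+ E :* d)))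
      ≈-refl E G (D E) (D (E³ * ι (+ 1))) (D E³) (D (E * E)) (D (ι (+ 1)))))

  D-E³* : ∀ f → D (E³ * f) ≈ E³ * (D f - ι (+ 3) * G * f)
  D-E³* f =
    D-* E³ f ▸⁺ D-* (E * E) E ▸ D-* E E ▸ D-E ▸
    solve 8 (λ E G d a b c f e →
      a := E :* E :* E :* (e :- # 3 :* G :* f) :+ (a :- (b :* f :+ E :* E :* E :* e)) :+ f :* (b :- (c :* E :+ E :* E :* d))
        :+ f :* E :* (c :- (d :* E :+ E :* d)) :+ # 3 :* f :* E :* E :* (d :- :- (G :* E)))
      ≈-refl E G (D E) (D (E³ * f)) (D E³) (D (E * E)) f (D f)

  E³-const : E³ 0 ≡ + 1
  E³-const = *-const (*-const E-const E-const) E-const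

  -- `J₂` divided by E^3: comparing the second Taylor coefficient with the derivative of the first
  -- determines the power sum `L₂`.
  L₂-relation : ι (+ 5) * L₂ ≈ ι (+ 2) * (G * G) + D G - G
  L₂-relation = ι-cancel 12 (unit-cancel E³ E³-const (
    J₂ ▸⁻ D-E³* X₁ ▸ D-ι* (+ 6) (- G) ▸ D-neg G ▸
    solve 7 (λ X L G d a b c →
      X :* (# 12 :* (# 5 :* L)) := X :* (# 12 :* (# 2 :* (G :* G) :+ d :- G))
        :- (X :* (# 60 :* (G :* G :- L)) :- (# 2 :* a :- # 2 :* (X :* (# 6 :* :- G))))
        :+ :- # 2 :* (a :- X :* (b :- # 3 :* G :* (# 6 :* :- G))) :+ :- # 2 :* X :* (b :- # 6 :* c) :+ :- # 12 :* X :* (c :- :- d))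
      ≈-refl E³ L₂ G (D G) (D (E³ * X₁)) (D X₁) (D (- G))))

  -- Eisenstein series of weights 2, 4 and 6 as differential polynomials in G

  -- `Q₄` is E₄, introduced through Ramanujan's equation 12 D E₂ = E₂^2 - E₄ instead of σ₃.
  E₂ Q₄ : Series
  E₂ = ι (+ 1) - ι (+ 24) * G
  Q₄ = E₂ * E₂ - ι (+ 12) * D E₂

  L₃-relation : ι (+ 14) * L₃ ≈ D L₂ - ι (+ 2) * G * D G - ι (+ 4) * (G * G * G) + ι (+ 18) * G * L₂ + ι (+ 3) * (G * G) - ι (+ 3) * L₂
  L₃-relation = ι-cancel 120 (unit-cancel E³ E³-const (
    J₃ ▸⁻ D-E³* X₂ ▸ D-ι* (+ 60) (G * G - L₂) ▸ D-sub (G * G) L₂ ▸ D-square G ▸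
    solve 10 (λ X m l G g h a b c d →
      X :* (# 120 :* (# 14 :* m)) :=
        X :* (# 120 :* (h :- # 2 :* G :* g :- # 4 :* (G :* G :* G) :+ # 18 :* G :* l :+ # 3 :* (G :* G) :- # 3 :* l))
        :- (X :* (# 840 :* :- (G :* G :* G :- # 3 :* G :* l :+ # 2 :* m)) :- (# 2 :* a :- # 6 :* (X :* (# 60 :* (G :* G :- l)))))
        :+ :- # 2 :* (a :- X :* (b :- # 3 :* G :* (# 60 :* (G :* G :- l)))) :+ :- # 2 :* X :* (b :- # 60 :* c)
        :+ :- # 120 :* X :* (c :- (d :- h)) :+ :- # 120 :* X :* (d :- # 2 :* G :* g))
      ≈-refl E³ L₃ L₂ G (D G) (D L₂) (D (E³ * X₂)) (D X₂) (D (G * G - L₂)) (D (G * G))))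

  D-L₂ : ι (+ 5) * D L₂ ≈ ι (+ 4) * G * D G + D (D G) - D G
  D-L₂ =
    D-ι* (+ 5) L₂ ▸⁻ D-cong L₂-relation ▸⁺ D-sub (ι (+ 2) * (G * G) + D G) G ▸⁺ D-+ (ι (+ 2) * (G * G)) (D G) ▸⁺ D-ι* (+ 2) (G * G) ▸⁺
    D-square G ▸
    solve 9 (λ G g k h a b c d e →
      # 5 :* h := # 4 :* G :* g :+ k :- g :- (a :- # 5 :* h) :+ (a :- b) :+ (b :- (c :- g)) :+ (c :- (d :+ k)) :+ (d :- # 2 :* e)
        :+ # 2 :* (e :- # 2 :* G :* g))
      ≈-refl G (D G) (D (D G)) (D L₂) (D (ι (+ 5) * L₂)) (D (ι (+ 2) * (G * G) + D G - G)) (D (ι (+ 2) * (G * G) + D G))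
        (D (ι (+ 2) * (G * G))) (D (G * G))

  D-E₂ : D E₂ ≈ - (ι (+ 24) * D G)
  D-E₂ =
    D-sub (ι (+ 1)) (ι (+ 24) * G) ▸⁺ D-ι (+ 1) ▸⁺ D-ι* (+ 24) G ▸⁻
    solve 4 (λ a b c g → a := :- (# 24 :* g) :+ (a :- (b :- c)) :+ (b :- # 0) :- (c :- # 24 :* g))
      ≈-refl (D E₂) (D (ι (+ 1))) (D (ι (+ 24) * G)) (D G)

  D-Q₄ : D Q₄ ≈ ι (+ 288) * D (D G) - ι (+ 48) * E₂ * D G
  D-Q₄ =
    D-sub (E₂ * E₂) (ι (+ 12) * D E₂) ▸⁺ D-square E₂ ▸⁺ D-E₂ ▸ D-ι* (+ 12) (D E₂) ▸⁻ D-cong D-E₂ ▸ D-neg (ι (+ 24) * D G) ▸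
    D-ι* (+ 24) (D G) ▸
    solve 10 (λ E g h q a b c d e f →
      q := # 288 :* h :- # 48 :* E :* g :+ (q :- (a :- b)) :+ (a :- # 2 :* E :* c) :+ # 2 :* E :* (c :- :- (# 24 :* g)) :- (b :- # 12 :* d)
        :+ :- # 12 :* (d :- e) :+ :- # 12 :* (e :- :- f) :+ # 12 :* (f :- # 24 :* h))
      ≈-refl E₂ (D G) (D (D G)) (D Q₄) (D (E₂ * E₂)) (D (ι (+ 12) * D E₂)) (D E₂) (D (D E₂)) (D (- (ι (+ 24) * D G))) (D (ι (+ 24) * D G))

  -- Ramanujan's equation 3 D E₄ = E₂ E₄ - E₆, obtained here by eliminating `L₂` and `L₃` from S₅ =
  -- G + 30 L₂ + 120 L₃.
  E₆≈ : E₆ ≈ E₂ * Q₄ - ι (+ 3) * D Q₄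
  E₆≈ =
    E₆≈S₅ ▸⁺ S₅≈L ▸ L₃-relation ▸ L₂-relation ▸ D-L₂ ▸ D-Q₄ ▸ D-E₂ ▸
    solve 10 (λ X S G g h l m k e q →
      X := (# 1 :- # 24 :* G) :* ((# 1 :- # 24 :* G) :* (# 1 :- # 24 :* G) :- # 12 :* e) :- # 3 :* q :+ (X :- (# 1 :- # 504 :* S))
        :+ :- # 504 :* (S :- (G :+ # 30 :* l :+ # 120 :* m))
        :+ :- # 4320 :* (# 14 :* m :- (k :- # 2 :* G :* g :- # 4 :* (G :* G :* G) :+ # 18 :* G :* l :+ # 3 :* (G :* G) :- # 3 :* l))
        :+ (:- # 432 :- # 15552 :* G) :* (# 5 :* l :- (# 2 :* (G :* G) :+ g :- G)) :+ :- # 864 :* (# 5 :* k :- (# 4 :* G :* g :+ h :- g))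
        :+ # 3 :* (q :- (# 288 :* h :- # 48 :* (# 1 :- # 24 :* G) :* g)) :+ # 12 :* (# 1 :- # 24 :* G) :* (e :- :- (# 24 :* g)))
      ≈-refl E₆ S₅ G (D G) (D (D G)) L₂ L₃ (D L₂) (D E₂) (D Q₄)

  -- The exponents in Jacobi's series are triangular numbers, which are 0, 1 or 3 modulo 5.
  ext₂-E³ : ext 2 E³ ≈ ι (+ 0)
  ext₂-E³ = coeffwise λ n → trans (coeff (ext-cong 2 (solve 1 (λ X → X := X :* # 1) ≈-refl E³)) n) (trans (coeff≤ (theta₀ (2 ℕ.+ n ℕ.* 5)) _ ℕₚ.≤-refl) (coeff (go (suc (2 ℕ.+ n ℕ.* 5 ℕ.+ (2 ℕ.+ n ℕ.* 5)))) n))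
    where
    go : ∀ M → ext 2 (theta M d₀) ≈ ι (+ 0)
    go zero = coeffwise λ n → trans (ι0-coeff (2 ℕ.+ n ℕ.* 5)) (sym (ι0-coeff n))
    go (suc M) = ≈-trans (ext-+ 2 (theta M d₀) (sg M * mono (tri M) * ι (d₀ M))) (
      go M ▸⁺ term ▸⁺ off ▸
      solve 4 (λ a b c x → a :+ b := # 0 :+ (a :- # 0) :+ (b :- x :* c) :+ x :* (c :- # 0))
        ≈-refl (ext 2 (theta M d₀)) (ext 2 (sg M * mono (tri M) * ι (d₀ M))) (ext 2 (mono (tri M))) (ι (σ M ℤ.* d₀ M)))
      where
      term : ext 2 (sg M * mono (tri M) * ι (d₀ M)) ≈ ι (σ M ℤ.* d₀ M) * ext 2 (mono (tri M))
      term = ≈-trans (ext-cong 2 (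
        ι-*-homo (σ M) (d₀ M) ▸
        solve 4 (λ s m d x → s :* m :* d := x :* m :+ :- m :* (x :- s :* d))
          ≈-refl (sg M) (mono (tri M)) (ι (d₀ M)) (ι (σ M ℤ.* d₀ M)))) (ext-ι* 2 (σ M ℤ.* d₀ M) (mono (tri M)))
      off : ext 2 (mono (tri M)) ≈ ι (+ 0)
      off = ext-mono-off 2 (tri M) (avoids tri tri-periodic (λ ()) (λ ()) (λ ()) (λ ()) (λ ()) M)

  -- Constant terms of polynomial expressions

  _^ℤ_ : ℤ → ℕ → ℤ
  z ^ℤ zero = + 1
  z ^ℤ suc n = z ℤ.* z ^ℤ n

  constant : ∀ {n} → Polynomial n → (Fin n → ℤ) → ℤ
  constant (op [+] e f) c = constant e c ℤ.+ constant f c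
  constant (op [*] e f) c = constant e c ℤ.* constant f c
  constant (con z) c = z
  constant (var i) c = c i
  constant (e :^ n) c = constant e c ^ℤ n
  constant (:- e) c = ℤ.- constant e c

  opaque
    unfolding _+_
    constant-term : ∀ {n} (e : Polynomial n) ρ {c} → (∀ i → lookup ρ i 0 ≡ c i) → ⟦ e ⟧ ρ 0 ≡ constant e c
    constant-term (op [+] e f) ρ h = cong₂ ℤ._+_ (constant-term e ρ h) (constant-term f ρ h)
    constant-term (op [*] e f) ρ h = cong₂ ℤ._*_ (constant-term e ρ h) (constant-term f ρ h)
    constant-term (con z) ρ h = refl
    constant-term (var i) ρ h = h i
    constant-term (e :^ zero) ρ h = refl
    constant-term (e :^ suc n) ρ h = cong₂ ℤ._*_ (constant-term e ρ h) (constant-term (e :^ n) ρ h)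
    constant-term (:- e) ρ h = cong ℤ.-_ (constant-term e ρ h)

  -- The 5-dissection of E

  q F a b : Series
  q = mono 1
  F = V E
  a = ext 0 E
  b = ext 2 E

  mono-^ : ∀ k → mono k ≈ q ^ k
  mono-^ zero = mono-0
  mono-^ (suc k) = ≈-trans (mono-split 1 k refl) (*-congˡ (mono-^ k))

  q^*V : ∀ j f → q ^ j * V f ≈ dilate 4 j f
  q^*V j f = ≈-trans (*-congʳ (≈-sym (mono-^ j))) (dilate-mono 4 j f)

  V-q : V q ≈ q ^ 5
  V-q = ≈-trans (V-mono 1) (mono-^ 5)

  E≈ : E ≈ V a - q * V F + q ^ 2 * V b
  E≈ =
    dissection E ▸⁺ q^*V 1 (ext 1 E) ▸⁻ class₁ ▸ q^*V 2 (ext 2 E) ▸⁻ q^*V 3 (ext 3 E) ▸⁻ vanish ext₃-E ▸ q^*V 4 (ext 4 E) ▸⁻ vanish ext₄-E ▸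
    solve 12 (λ E x₀ x₁ x₂ x₃ x₄ y z q w w₃ w₄ →
      E := x₀ :- q :* y :+ q :^ 2 :* z :+ (E :- (x₀ :+ (x₁ :+ (x₂ :+ (x₃ :+ x₄))))) :- (q :^ 1 :* w :- x₁) :+ q :* (w :- :- y)
        :- (q :^ 2 :* z :- x₂) :- (q :^ 3 :* w₃ :- x₃) :+ q :^ 3 :* (w₃ :- # 0) :- (q :^ 4 :* w₄ :- x₄) :+ q :^ 4 :* (w₄ :- # 0))
      ≈-refl E (dilate 4 0 (ext 0 E)) (dilate 4 1 (ext 1 E)) (dilate 4 2 (ext 2 E)) (dilate 4 3 (ext 3 E)) (dilate 4 4 (ext 4 E)) (V F)
        (V b) q (V (ext 1 E)) (V (ext 3 E)) (V (ext 4 E))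
    where
    class₁ : V (ext 1 E) ≈ - V F
    class₁ = ≈-trans (dilate-cong 4 0 ext₁-E) (dilate-neg 4 0 F)
    vanish : ∀ {f} → f ≈ ι (+ 0) → V f ≈ ι (+ 0)
    vanish f0 = ≈-trans (dilate-cong 4 0 f0) (dilate-ι 4 (+ 0))

  -- These collect the terms of (V a - q V F + q^2 V b)^3 by exponent modulo 5; the q in `x₀` and
  -- `x₁` is a q^5 carried over.
  x₀ x₁ x₂ x₃ x₄ : Series
  x₀ = a ^ 3 - ι (+ 3) * q * F * b ^ 2
  x₁ = q * b ^ 3 - ι (+ 3) * a ^ 2 * F
  x₂ = ι (+ 3) * a ^ 2 * b + ι (+ 3) * a * F ^ 2
  x₃ = - (ι (+ 6) * a * F * b) - F ^ 3
  x₄ = ι (+ 3) * a * b ^ 2 + ι (+ 3) * F ^ 2 * b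

  E³-dissection : E³ ≈ dilate 4 0 x₀ + (dilate 4 1 x₁ + (dilate 4 2 x₂ + (dilate 4 3 x₃ + dilate 4 4 x₄)))
  E³-dissection =
    E≈ ▸ V-poly (var 0F :^ 3 :- # 3 :* var 1F :* var 2F :* var 3F :^ 2) (a ∷ q ∷ F ∷ b ∷ []) ▸⁻
    V-poly (var 0F :* var 1F :^ 3 :- # 3 :* var 2F :^ 2 :* var 3F) (q ∷ b ∷ a ∷ F ∷ []) ▸
    V-poly (# 3 :* var 0F :^ 2 :* var 1F :+ # 3 :* var 0F :* var 2F :^ 2) (a ∷ b ∷ F ∷ []) ▸
    V-poly (:- (# 6 :* var 0F :* var 1F :* var 2F) :- var 1F :^ 3) (a ∷ F ∷ b ∷ []) ▸
    V-poly (# 3 :* var 0F :* var 1F :^ 2 :+ # 3 :* var 2F :^ 2 :* var 1F) (a ∷ b ∷ F ∷ []) ▸ q^*V 1 x₁ ▸⁺ q^*V 2 x₂ ▸⁺ q^*V 3 x₃ ▸⁺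
    q^*V 4 x₄ ▸⁺ V-q ▸
    solve 15 (λ E q Va Vb VF Vq z₀ z₁ z₂ z₃ z₄ d₁ d₂ d₃ d₄ →
      E :* E :* E := z₀ :+ (d₁ :+ (d₂ :+ (d₃ :+ d₄)))
        :+ (E :* E :+ E :* (Va :- q :* VF :+ q :^ 2 :* Vb) :+ (Va :- q :* VF :+ q :^ 2 :* Vb) :^ 2) :* (E :- (Va :- q :* VF :+ q :^ 2 :*
        Vb)) :- (z₀ :- (Va :^ 3 :- # 3 :* Vq :* VF :* Vb :^ 2)) :+ :- q :* (z₁ :- (Vq :* Vb :^ 3 :- # 3 :* Va :^ 2 :* VF))
        :+ :- (q :^ 2) :* (z₂ :- (# 3 :* Va :^ 2 :* Vb :+ # 3 :* Va :* VF :^ 2))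
        :+ :- (q :^ 3) :* (z₃ :- (:- (# 6 :* Va :* VF :* Vb) :- VF :^ 3))
        :+ :- (q :^ 4) :* (z₄ :- (# 3 :* Va :* Vb :^ 2 :+ # 3 :* VF :^ 2 :* Vb)) :+ (q :^ 1 :* z₁ :- d₁) :+ (q :^ 2 :* z₂ :- d₂)
        :+ (q :^ 3 :* z₃ :- d₃) :+ (q :^ 4 :* z₄ :- d₄) :+ (# 3 :* VF :* Vb :^ 2 :- q :* Vb :^ 3) :* (Vq :- q :^ 5))
      ≈-refl E q (V a) (V b) (V F) (V q) (V x₀) (V x₁) (V x₂) (V x₃) (V x₄) (dilate 4 1 x₁) (dilate 4 2 x₂) (dilate 4 3 x₃) (dilate 4 4 x₄)

  a-const : a 0 ≡ + 1
  a-const = E-const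

  F-const : F 0 ≡ + 1
  F-const = E-const

  -- Jacobi's identity has no exponents ≡ 2 mod 5, which ties the two theta pieces of E together.
  a*b : a * b ≈ - (F * F)
  a*b = unit-cancel a a-const (ι-cancel 3 (
    x₂-zero ▸⁺ ≈-refl ▸⁻
    solve 4 (λ a b F z₂ →
      # 3 :* (a :* (a :* b)) := # 3 :* (a :* :- (F :* F)) :+ (z₂ :- # 0) :- (z₂ :- (# 3 :* a :^ 2 :* b :+ # 3 :* a :* F :^ 2)))
      ≈-refl a b F x₂))
    where
    x₂-zero : x₂ ≈ ι (+ 0)
    x₂-zero = begin
      x₂      ≈⟨ solve 1 (λ x → x := # 0 :+ (# 0 :+ (x :+ (# 0 :+ # 0)))) ≈-refl x₂ ⟩
      _       ≈⟨ +-cong (ext₂-dilate-0 x₀) (+-cong (ext₂-dilate-1 x₁) (+-cong (ext₂-dilate-2 x₂) (+-cong (ext₂-dilate-3 x₃) (ext₂-dilate-4 x₄)))) ⟨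
      _       ≈⟨ ≈-trans (ext-+ 2 _ _) (+-congˡ (≈-trans (ext-+ 2 _ _) (+-congˡ (≈-trans (ext-+ 2 _ _) (+-congˡ (ext-+ 2 _ _)))))) ⟨
      _       ≈⟨ ext-cong 2 E³-dissection ⟨
      ext 2 E³  ≈⟨ ext₂-E³ ⟩
      ι (+ 0)   ∎
      where open ≈R

  -- r(q) = R(q^5) and ξ(q) = R(q)^5, for the Rogers–Ramanujan continued fraction R(q) = q^(1/5) ν(q).

  ν r ξ A : Series
  ν = F * inverse a
  r = q * V ν
  ξ = q * ν ^ 5
  A = V a

  ν*a : ν * a ≈ F
  ν*a = inverse-*ʳ a a-const ▸ solve 3 (λ F a i → F :* i :* a := F :+ F :* (a :* i :- # 1)) ≈-refl F a (inverse a)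

  ν-const : ν 0 ≡ + 1
  ν-const = *-const F-const refl

  A-const : A 0 ≡ + 1
  A-const = a-const

  b≈ : b ≈ - (F * ν)
  b≈ = unit-cancel a a-const (
    a*b ▸⁺ ν*a ▸
    solve 4 (λ a b F ν → a :* b := a :* :- (F :* ν) :+ (a :* b :- :- (F :* F)) :+ F :* (ν :* a :- F))
      ≈-refl a b F ν)

  -- The polynomials d, n₁, n₂, Δ, ψ of r and δ of ξ, as expressions in one variable.
  R d′ n₁′ n₂′ m′ Δ′ ψ′ δ′ : Polynomial 1
  R = var 0F
  d′ = # 1 :- R :- R :^ 2
  n₁′ = # 1 :- # 2 :* R :+ # 4 :* R :^ 2 :- # 3 :* R :^ 3 :+ R :^ 4
  n₂′ = # 1 :+ # 3 :* R :+ # 4 :* R :^ 2 :+ # 2 :* R :^ 3 :+ R :^ 4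
  m′ = n₁′ :* n₂′
  Δ′ = # 1 :- # 11 :* R :^ 5 :- R :^ 10
  ψ′ = n₂′ :^ 2 :+ R :^ 2 :* n₁′ :^ 2
  δ′ = # 1 :- # 11 :* R :- R :^ 2

  d n₁ n₂ Δ δ : Series
  d = ι (+ 1) - r - r ^ 2
  n₁ = ι (+ 1) - ι (+ 2) * r + ι (+ 4) * r ^ 2 - ι (+ 3) * r ^ 3 + r ^ 4
  n₂ = ι (+ 1) + ι (+ 3) * r + ι (+ 4) * r ^ 2 + ι (+ 2) * r ^ 3 + r ^ 4
  Δ = ι (+ 1) - ι (+ 11) * r ^ 5 - r ^ 10
  δ = ι (+ 1) - ι (+ 11) * ξ - ξ ^ 2

  -- `Δ` is the norm of `d`, the product of 1 - ζ r - ζ^2 r^2 over the fifth roots of unity ζ, and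
  -- hence a series in q^5. Multiplying by n₁ n₂ thus clears a denominator d before U is applied.
  d*n₁*n₂ : d * (n₁ * n₂) ≈ Δ
  d*n₁*n₂ = identity (d′ :* (n₁′ :* n₂′)) Δ′ _ r

  r-const : r 0 ≡ + 0
  r-const = mono-suc-*-0 0 (V ν)

  ξ-const : ξ 0 ≡ + 0
  ξ-const = mono-suc-*-0 0 (ν ^ 5)

  d-const : d 0 ≡ + 1
  d-const = constant-term d′ (r ∷ []) {λ _ → + 0} λ { 0F → r-const }

  n₁-const : n₁ 0 ≡ + 1
  n₁-const = constant-term n₁′ (r ∷ []) {λ _ → + 0} λ { 0F → r-const }

  n₂-const : n₂ 0 ≡ + 1
  n₂-const = constant-term n₂′ (r ∷ []) {λ _ → + 0} λ { 0F → r-const }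

  Δ-const : Δ 0 ≡ + 1
  Δ-const = constant-term Δ′ (r ∷ []) {λ _ → + 0} λ { 0F → r-const }

  r*A : r * A ≈ q * V F
  r*A =
    dilate-cong 4 0 ν*a ▸ V-poly (var 0F :* var 1F) (ν ∷ a ∷ []) ▸
    solve 5 (λ q Vν Va VF x → q :* Vν :* Va := q :* VF :+ q :* (x :- VF) :+ :- q :* (x :- Vν :* Va))
      ≈-refl q (V ν) A (V F) (V (ν * a))

  E≈A*d : E ≈ A * d
  E≈A*d =
    E≈ ▸⁺ dilate-cong 4 0 b≈ ▸ V-poly (:- (var 0F :* var 1F)) (F ∷ ν ∷ []) ▸ r*A ▸ ≈-refl ▸
    solve 8 (λ E A q r Vb VF Vν x →
      E := A :* (# 1 :- r :- r :^ 2) :+ (E :- (A :- q :* VF :+ q :^ 2 :* Vb)) :+ q :^ 2 :* (Vb :- x) :+ q :^ 2 :* (x :- :- (VF :* Vν))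
        :+ (# 1 :+ q :* Vν) :* (r :* A :- q :* VF) :+ r :* A :* (r :- q :* Vν))
      ≈-refl E A q r (V b) (V F) (V ν) (V (- (F * ν)))

  r⁵ : r ^ 5 ≈ V ξ
  r⁵ =
    V-poly (var 0F :* var 1F :^ 5) (q ∷ ν ∷ []) ▸⁻ V-q ▸
    solve 4 (λ q Vq Vν x → (q :* Vν) :^ 5 := x :- (x :- Vq :* Vν :^ 5) :+ :- (Vν :^ 5) :* (Vq :- q :^ 5))
      ≈-refl q (V q) (V ν) (V ξ)

  V-δ : V δ ≈ Δ
  V-δ =
    V-poly (# 1 :- # 11 :* var 0F :- var 0F :^ 2) (ξ ∷ []) ▸⁺ r⁵ ▸
    solve 3 (λ Vξ r x →
      x := # 1 :- # 11 :* r :^ 5 :- r :^ 10 :+ (x :- (# 1 :- # 11 :* Vξ :- Vξ :^ 2)) :+ (# 11 :+ Vξ :+ r :^ 5) :* (r :^ 5 :- Vξ))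
      ≈-refl (V ξ) r (V δ)

  r-cancel : ∀ {f g} → r * f ≈ r * g → f ≈ g
  r-cancel {f} {g} h = unit-cancel (V ν) ν-const (mono-cancel 1 (
    h ▸⁺
    solve 4 (λ q n f g → q :* (n :* f) := q :* (n :* g) :+ (q :* n :* f :- q :* n :* g))
      ≈-refl q (V ν) f g))

  -- β = D ξ / ξ and 𝓔 = (5 E₂(5τ) - E₂(τ))/4 = D t / t.
  β 𝓔 : Series
  β = ι (+ 1) + ι (+ 5) * (D ν * inverse ν)
  𝓔 = ι (+ 1) + ι (+ 6) * G - ι (+ 30) * V G

  ν*ν⁻¹ : ν * inverse ν ≈ ι (+ 1)
  ν*ν⁻¹ = inverse-*ʳ ν ν-const

  D-ν : ι (+ 5) * D ν ≈ (β - ι (+ 1)) * ν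
  D-ν =
    ν*ν⁻¹ ▸
    solve 3 (λ ν i e → # 5 :* e := (# 1 :+ # 5 :* (e :* i) :- # 1) :* ν :+ :- # 5 :* e :* (ν :* i :- # 1))
      ≈-refl ν (inverse ν) (D ν)

  D-ξ : D ξ ≈ β * ξ
  D-ξ =
    D-poly (var 0F :* var 1F :^ 5) (q ∷ ν ∷ []) ▸⁺ D-mono 1 ▸ D-ν ▸
    solve 6 (λ q ν Dq Dν x β →
      x := β :* (q :* ν :^ 5) :+ (x :- (Dq :* ν :^ 5 :+ q :* (# 5 :* ν :^ 4 :* Dν))) :+ ν :^ 5 :* (Dq :- # 1 :* q)
        :+ q :* ν :^ 4 :* (# 5 :* Dν :- (β :- # 1) :* ν))
      ≈-refl q ν (D q) (D ν) (D ξ) β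

  D-r : D r ≈ V β * r
  D-r =
    D-poly (var 0F :* var 1F) (q ∷ V ν ∷ []) ▸⁺ D-mono 1 ▸ D-dilate 4 ν ▸ V-poly (# 5 :* var 0F) (D ν ∷ []) ▸ dilate-cong 4 0 D-ν ▸
    V-poly ((var 0F :- # 1) :* var 1F) (β ∷ ν ∷ []) ▸
    solve 9 (λ q Dq Vν DVν x Vβ z w Ve →
      x := Vβ :* (q :* Vν) :+ (x :- (Dq :* Vν :+ q :* DVν)) :+ Vν :* (Dq :- # 1 :* q) :+ q :* (DVν :- # 5 :* Ve) :+ :- q :* (z :- # 5 :* Ve)
        :+ q :* (z :- w) :+ q :* (w :- (Vβ :- # 1) :* Vν))
      ≈-refl q (D q) (V ν) (D (V ν)) (D r) (V β) (V (ι (+ 5) * D ν)) (V ((β - ι (+ 1)) * ν)) (V (D ν))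

  D-F : D F ≈ - (ι (+ 5) * V G * F)
  D-F =
    D-dilate 4 E ▸⁺ dilate-cong 4 0 D-E ▸ V-poly (:- (var 0F :* var 1F)) (G ∷ E ∷ []) ▸
    solve 5 (λ x y z VG VE → x := :- (# 5 :* VG :* VE) :+ (x :- # 5 :* y) :+ # 5 :* (y :- z) :+ # 5 :* (z :- :- (VG :* VE)))
      ≈-refl (D F) (V (D E)) (V (- (G * E))) (V G) F

  D-VF : D (V F) ≈ - (ι (+ 25) * V (V G) * V F)
  D-VF =
    D-dilate 4 F ▸⁺ dilate-cong 4 0 D-F ▸ V-poly (:- (# 5 :* var 0F :* var 1F)) (V G ∷ F ∷ []) ▸
    solve 5 (λ x y z Vg VF → x := :- (# 25 :* Vg :* VF) :+ (x :- # 5 :* y) :+ # 5 :* (y :- z) :+ # 5 :* (z :- :- (# 5 :* Vg :* VF)))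
      ≈-refl (D (V F)) (V (D F)) (V (- (ι (+ 5) * V G * F))) (V (V G)) (V F)

  D-A : D A ≈ A * (ι (+ 1) - ι (+ 25) * V (V G) - V β)
  D-A = r-cancel (
    D-poly (var 0F :* var 1F) (r ∷ A ∷ []) ▸⁻ D-cong r*A ▸⁺ D-poly (var 0F :* var 1F) (q ∷ V F ∷ []) ▸⁺ D-r ▸ D-mono 1 ▸ D-VF ▸ r*A ▸
    solve 12 (λ r A q W B VF Dr DA Dq DVF x y →
      r :* DA := r :* (A :* (# 1 :- # 25 :* W :- B)) :- (x :- (Dr :* A :+ r :* DA)) :+ (x :- y) :+ (y :- (Dq :* VF :+ q :* DVF))
        :+ :- A :* (Dr :- B :* r) :+ VF :* (Dq :- # 1 :* q) :+ q :* (DVF :- :- (# 25 :* W :* VF))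
        :+ :- (# 1 :- # 25 :* W) :* (r :* A :- q :* VF))
      ≈-refl r A q (V (V G)) (V β) (V F) (D r) (D A) (D q) (D (V F)) (D (r * A)) (D (q * V F)))

  -- Logarithmic derivative of E = A d; the numerator arises as d + r + 2 r^2 = 1 + r^2.
  G-relation : G * d ≈ V β * (ι (+ 1) + r ^ 2) - (ι (+ 1) - ι (+ 25) * V (V G)) * d
  G-relation = unit-cancel A A-const (
    D-E ▸⁺ E≈A*d ▸ D-cong E≈A*d ▸⁻ D-poly (var 0F :* (# 1 :- var 1F :- var 1F :^ 2)) (A ∷ r ∷ []) ▸⁻ D-A ▸ D-r ▸
    solve 10 (λ r A G W B E Dr DA DE x →
      A :* (G :* (# 1 :- r :- r :^ 2)) := A :* (B :* (# 1 :+ r :^ 2) :- (# 1 :- # 25 :* W) :* (# 1 :- r :- r :^ 2)) :+ (DE :- :- (G :* E))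
        :+ :- G :* (E :- A :* (# 1 :- r :- r :^ 2)) :- (DE :- x)
        :- (x :- (DA :* (# 1 :- r :- r :^ 2) :+ A :* (# 0 :- Dr :- # 2 :* r :^ 1 :* Dr)))
        :+ :- (# 1 :- r :- r :^ 2) :* (DA :- A :* (# 1 :- # 25 :* W :- B)) :+ A :* (# 1 :+ # 2 :* r) :* (Dr :- B :* r))
      ≈-refl r A G (V (V G)) (V β) E (D r) (D A) (D E) (D (A * d)))

  module Dis = Dissection r ν ξ ≈-refl r⁵

  -- U is applied to `G-relation` multiplied by n₁ n₂. On the left U G is known from `U-G`; on the
  -- right the powers r^(5m) in (1 + r^2) n₁ n₂ leave 1 + ξ^2.
  𝓔*δ : 𝓔 * δ ≈ β * (ι (+ 1) + ξ ^ 2)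
  𝓔*δ =
    U-G ▸ U-V* δ G ▸⁻ ext-cong 0 expanded ▸⁺ ext-+ 0 ((ι (+ 1) + r ^ 2) * (n₁ * n₂) * V β) (- V ((ι (+ 1) - ι (+ 25) * V G) * δ)) ▸⁺
    ext-neg 0 (V ((ι (+ 1) - ι (+ 25) * V G) * δ)) ▸⁺ U-V ((ι (+ 1) - ι (+ 25) * V G) * δ) ▸⁻
    Dis.U-identity numerator (# 1 :+ R :^ 2) _ β ▸⁺
    solve 11 (λ G VG δ β ξ u x y z w s →
      (# 1 :+ # 6 :* G :- # 30 :* VG) :* δ := β :* (# 1 :+ ξ :^ 2) :+ δ :* :- # 1 :* (u :- (# 6 :* G :- # 5 :* VG)) :- (x :- δ :* u)
        :+ (x :- s) :+ (s :- (y :+ w)) :+ (w :- :- z) :- (z :- (# 1 :- # 25 :* VG) :* δ) :+ (y :- (# 1 :+ ξ :^ 2) :* β))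
      ≈-refl G (V G) δ β ξ (U G) (U (V δ * G)) (U ((ι (+ 1) + r ^ 2) * (n₁ * n₂) * V β)) (U (V ((ι (+ 1) - ι (+ 25) * V G) * δ)))
        (U (- V ((ι (+ 1) - ι (+ 25) * V G) * δ))) (U ((ι (+ 1) + r ^ 2) * (n₁ * n₂) * V β - V ((ι (+ 1) - ι (+ 25) * V G) * δ)))
    where
    numerator : Polynomial 1
    numerator = (# 1 :+ R :^ 2) :* m′
    expanded : V δ * G ≈ (ι (+ 1) + r ^ 2) * (n₁ * n₂) * V β - V ((ι (+ 1) - ι (+ 25) * V G) * δ)
    expanded =
      V-δ ▸ d*n₁*n₂ ▸ G-relation ▸ V-poly ((# 1 :- # 25 :* var 0F) :* var 1F) (V G ∷ δ ∷ []) ▸⁺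
      solve 10 (λ G Vh Vδ r n₁ n₂ B d Δ x →
        Vδ :* G := (# 1 :+ r :^ 2) :* (n₁ :* n₂) :* B :- x :+ (G :+ # 1 :- # 25 :* Vh) :* (Vδ :- Δ)
          :+ :- (G :+ # 1 :- # 25 :* Vh) :* (d :* (n₁ :* n₂) :- Δ)
          :+ n₁ :* n₂ :* (G :* d :- (B :* (# 1 :+ r :^ 2) :- (# 1 :- # 25 :* Vh) :* d)) :+ (x :- (# 1 :- # 25 :* Vh) :* Vδ))
        ≈-refl G (V (V G)) (V δ) r n₁ n₂ (V β) d Δ (V ((ι (+ 1) - ι (+ 25) * V G) * δ))

  -- t is the hauptmodul η(5τ)^6/η(τ)^6 of Γ₀(5).

  t y : Series
  t = q * F ^ 6 * inverse (E ^ 6)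
  y = q * V F * inverse E

  E⁶-const : (E ^ 6) 0 ≡ + 1
  E⁶-const = ^-const 6 E-const

  t*E⁶ : t * E ^ 6 ≈ q * F ^ 6
  t*E⁶ =
    inverse-*ʳ (E ^ 6) E⁶-const ▸
    solve 4 (λ q F X i → q :* F :^ 6 :* i :* X := q :* F :^ 6 :+ q :* F :^ 6 :* (X :* i :- # 1))
      ≈-refl q F (E ^ 6) (inverse (E ^ 6))

  y*E : y * E ≈ q * V F
  y*E =
    inverse-*ʳ E E-const ▸
    solve 4 (λ q F X i → q :* F :* i :* X := q :* F :+ q :* F :* (X :* i :- # 1))
      ≈-refl q (V F) E (inverse E)

  D-𝓔-t : D t ≈ 𝓔 * t
  D-𝓔-t = unit-cancel (E ^ 6) E⁶-const (
    D-poly (var 0F :* var 1F :^ 6) (t ∷ E ∷ []) ▸⁻ D-cong t*E⁶ ▸⁺ D-poly (var 0F :* var 1F :^ 6) (q ∷ F ∷ []) ▸⁺ D-mono 1 ▸ D-F ▸ D-E ▸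
    t*E⁶ ▸
    solve 12 (λ q F E t G VG Dq DF DE Dt x z →
      E :^ 6 :* Dt := E :^ 6 :* ((# 1 :+ # 6 :* G :- # 30 :* VG) :* t) :- (x :- (Dt :* E :^ 6 :+ t :* (# 6 :* E :^ 5 :* DE))) :+ (x :- z)
        :+ (z :- (Dq :* F :^ 6 :+ q :* (# 6 :* F :^ 5 :* DF))) :+ F :^ 6 :* (Dq :- # 1 :* q)
        :+ # 6 :* q :* F :^ 5 :* (DF :- :- (# 5 :* VG :* F)) :+ :- # 6 :* t :* E :^ 5 :* (DE :- :- (G :* E))
        :+ :- (# 1 :- # 30 :* VG) :* (t :* E :^ 6 :- q :* F :^ 6))
      ≈-refl q F E t G (V G) (D q) (D F) (D E) (D t) (D (t * E ^ 6)) (D (q * F ^ 6)))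

  δ-const : δ 0 ≡ + 1
  δ-const = constant-term δ′ (ξ ∷ []) {λ _ → + 0} λ { 0F → ξ-const }

  -- Both sides satisfy Df = (β - 1 - 6G) f.
  F⁶*δ : F ^ 6 * δ ≈ ν ^ 5 * E ^ 6
  F⁶*δ = ode-unique (*-const (^-const 6 F-const) δ-const) (*-const (^-const 5 ν-const) E⁶-const)
    (
      D-poly (var 0F :^ 6 :* (# 1 :- # 11 :* var 1F :- var 1F :^ 2)) (F ∷ ξ ∷ []) ▸⁺ D-F ▸ D-ξ ▸ 𝓔*δ ▸
      solve 8 (λ F ξ β G VG DF Dξ x →
        x := (β :- # 1 :- # 6 :* G) :* (F :^ 6 :* (# 1 :- # 11 :* ξ :- ξ :^ 2))
          :+ (x :- (# 6 :* F :^ 5 :* DF :* (# 1 :- # 11 :* ξ :- ξ :^ 2) :+ F :^ 6 :* (# 0 :- (# 0 :* ξ :+ # 11 :* Dξ) :- # 2 :* ξ :^ 1 :*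
          Dξ))) :+ # 6 :* F :^ 5 :* (# 1 :- # 11 :* ξ :- ξ :^ 2) :* (DF :- :- (# 5 :* VG :* F))
          :+ :- (F :^ 6 :* (# 11 :+ # 2 :* ξ)) :* (Dξ :- β :* ξ)
          :+ F :^ 6 :* ((# 1 :+ # 6 :* G :- # 30 :* VG) :* (# 1 :- # 11 :* ξ :- ξ :^ 2) :- β :* (# 1 :+ ξ :^ 2)))
        ≈-refl F ξ β G (V G) (D F) (D ξ) (D (F ^ 6 * δ)))
    (
      D-poly (var 0F :^ 5 :* var 1F :^ 6) (ν ∷ E ∷ []) ▸⁺ D-ν ▸ D-E ▸
      solve 7 (λ ν E β G Dν DE x →
        x := (β :- # 1 :- # 6 :* G) :* (ν :^ 5 :* E :^ 6) :+ (x :- (# 5 :* ν :^ 4 :* Dν :* E :^ 6 :+ ν :^ 5 :* (# 6 :* E :^ 5 :* DE)))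
          :+ ν :^ 4 :* E :^ 6 :* (# 5 :* Dν :- (β :- # 1) :* ν) :+ # 6 :* ν :^ 5 :* E :^ 5 :* (DE :- :- (G :* E)))
        ≈-refl ν E β G (D ν) (D E) (D (ν ^ 5 * E ^ 6)))

  -- Ramanujan's identity R(q)^-5 - 11 - R(q)^5 = η(τ)^6/η(5τ)^6.
  t*δ : t * δ ≈ ξ
  t*δ = unit-cancel (E ^ 6) E⁶-const (
    t*E⁶ ▸ F⁶*δ ▸
    solve 6 (λ t δ q ν E F →
      E :^ 6 :* (t :* δ) := E :^ 6 :* (q :* ν :^ 5) :+ δ :* (t :* E :^ 6 :- q :* F :^ 6) :+ q :* (F :^ 6 :* δ :- ν :^ 5 :* E :^ 6))
      ≈-refl t δ q ν E F)

  -- The companion identity 1/r - 1 - r = η(τ)/η(25τ), from two expressions for q V F.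
  y*d : y * d ≈ r
  y*d = unit-cancel A A-const (
    E≈A*d ▸ y*E ▸⁺ r*A ▸⁻
    solve 6 (λ A y d r E c → A :* (y :* d) := A :* r :+ :- y :* (E :- A :* d) :+ (y :* E :- c) :- (r :* A :- c))
      ≈-refl A y d r E (q * V F))

  T*Δ : V t * Δ ≈ r ^ 5
  T*Δ =
    V-δ ▸ V-poly (var 0F :* var 1F) (t ∷ δ ∷ []) ▸⁻ dilate-cong 4 0 t*δ ▸⁺ r⁵ ▸⁻
    solve 6 (λ Vt Δ Vδ Vξ r x → Vt :* Δ := r :^ 5 :+ :- Vt :* (Vδ :- Δ) :- (x :- Vt :* Vδ) :+ (x :- Vξ) :- (r :^ 5 :- Vξ))
      ≈-refl (V t) Δ (V δ) (V ξ) r (V (t * δ))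

  φ : Series
  φ = ι (+ 1) + ι (+ 5) * y + ι (+ 15) * y ^ 2 + ι (+ 25) * y ^ 3 + ι (+ 25) * y ^ 4

  d⁵*φ : d ^ 5 * φ ≈ Δ
  d⁵*φ =
    y*d ▸ expansion ▸⁺
    solve 4 (λ y d r Δ →
      d :^ 5 :* (# 1 :+ # 5 :* y :+ # 15 :* y :^ 2 :+ # 25 :* y :^ 3 :+ # 25 :* y :^ 4) := Δ
        :+ (# 5 :* d :^ 4 :+ # 15 :* d :^ 3 :* (y :* d :+ r) :+ # 25 :* d :^ 2 :* ((y :* d) :^ 2 :+ y :* d :* r :+ r :^ 2) :+ # 25 :* d :*
        ((y :* d) :^ 3 :+ (y :* d) :^ 2 :* r :+ y :* d :* r :^ 2 :+ r :^ 3)) :* (y :* d :- r)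
        :+ (d :^ 5 :+ # 5 :* r :* d :^ 4 :+ # 15 :* r :^ 2 :* d :^ 3 :+ # 25 :* r :^ 3 :* d :^ 2 :+ # 25 :* r :^ 4 :* d :- Δ))
      ≈-refl y d r Δ
    where
    expansion : d ^ 5 + ι (+ 5) * r * d ^ 4 + ι (+ 15) * r ^ 2 * d ^ 3 + ι (+ 25) * r ^ 3 * d ^ 2 + ι (+ 25) * r ^ 4 * d ≈ Δ
    expansion = identity (d′ :^ 5 :+ # 5 :* R :* d′ :^ 4 :+ # 15 :* R :^ 2 :* d′ :^ 3 :+ # 25 :* R :^ 3 :* d′ :^ 2 :+ # 25 :* R :^ 4 :* d′) Δ′ _ r

  -- The modular equation of level 25
  y⁵ : y ^ 5 ≈ V t * φ
  y⁵ = unit-cancel (d ^ 5 * Δ) (*-const (^-const 5 d-const) Δ-const) (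
    y*d ▸ d⁵*φ ▸ T*Δ ▸
    solve 6 (λ y d r Δ T φ →
      d :^ 5 :* Δ :* y :^ 5 := d :^ 5 :* Δ :* (T :* φ)
        :+ Δ :* ((y :* d) :^ 4 :+ (y :* d) :^ 3 :* r :+ (y :* d) :^ 2 :* r :^ 2 :+ y :* d :* r :^ 3 :+ r :^ 4) :* (y :* d :- r)
        :+ :- Δ :* T :* (d :^ 5 :* φ :- Δ) :+ :- Δ :* (T :* Δ :- r :^ 5))
      ≈-refl y d r Δ (V t) φ)

  T*F⁶ : V t * F ^ 6 ≈ q ^ 5 * V F ^ 6
  T*F⁶ =
    V-poly (var 0F :* var 1F :^ 6) (t ∷ E ∷ []) ▸⁻ dilate-cong 4 0 t*E⁶ ▸⁺ V-poly (var 0F :* var 1F :^ 6) (q ∷ F ∷ []) ▸⁺ V-q ▸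
    solve 7 (λ Vt VE q Vq VF x z →
      Vt :* VE :^ 6 := q :^ 5 :* VF :^ 6 :- (x :- Vt :* VE :^ 6) :+ (x :- z) :+ (z :- Vq :* VF :^ 6) :+ VF :^ 6 :* (Vq :- q :^ 5))
      ≈-refl (V t) F q (V q) (V F) (V (t * E ^ 6)) (V (q * F ^ 6))

  y⁶ : y ^ 6 ≈ V t * t
  y⁶ = unit-cancel (E ^ 6) E⁶-const (
    y*E ▸ t*E⁶ ▸ T*F⁶ ▸
    solve 7 (λ y E T t q F z →
      E :^ 6 :* y :^ 6 := E :^ 6 :* (T :* t)
        :+ ((y :* E) :^ 5 :+ (y :* E) :^ 4 :* (q :* z) :+ (y :* E) :^ 3 :* (q :* z) :^ 2 :+ (y :* E) :^ 2 :* (q :* z) :^ 3 :+ y :* E :* (q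
        :* z) :^ 4 :+ (q :* z) :^ 5) :* (y :* E :- q :* z) :+ :- T :* (t :* E :^ 6 :- q :* F :^ 6)
        :+ :- q :* (T :* F :^ 6 :- q :^ 5 :* z :^ 6))
      ≈-refl y E (V t) t q F (V F))

  Δ*r : Δ * r ≈ d ^ 6 * t
  Δ*r = r-cancel (r-cancel (r-cancel (r-cancel (r-cancel (
    y*d ▸ y⁶ ▸ T*Δ ▸
    solve 6 (λ y d r Δ T t →
      r :* (r :* (r :* (r :* (r :* (Δ :* r))))) := r :* (r :* (r :* (r :* (r :* (d :^ 6 :* t)))))
        :+ :- Δ :* ((y :* d) :^ 5 :+ (y :* d) :^ 4 :* r :+ (y :* d) :^ 3 :* r :^ 2 :+ (y :* d) :^ 2 :* r :^ 3 :+ y :* d :* r :^ 4 :+ r :^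
        5) :* (y :* d :- r) :+ Δ :* d :^ 6 :* (y :^ 6 :- T :* t) :+ d :^ 6 :* t :* (T :* Δ :- r :^ 5))
      ≈-refl y d r Δ (V t) t)))))

  -- The relation between R(q)^5 and R(q^5). Both ξ and r n₁/n₂ are roots of X^2 + (11 + 1/t) X - 1,
  -- whose roots have product -1. So (ξ n₂ - r n₁)(r n₁ ξ + n₂) = 0, and the second factor has
  -- constant term 1.
  ξ*n₂ : ξ * n₂ ≈ r * n₁
  ξ*n₂ = unit-cancel w w-const (
    d*n₁*n₂ ▸ quadratic ▸ ≈-refl ▸ Δ*r ▸ t*δ ▸
    solve 8 (λ r ξ d Δ δ t x z →
      (r :* x :* ξ :+ z) :* d :* (ξ :* z) := (r :* x :* ξ :+ z) :* d :* (r :* x) :+ (r :* ξ :^ 2 :- r) :* (d :* (x :* z) :- Δ)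
        :+ ξ :* (d :* (z :^ 2 :- r :^ 2 :* x :^ 2) :- (# 11 :* r :* Δ :+ d :^ 6)) :+ r :* Δ :* (δ :- (# 1 :- # 11 :* ξ :- ξ :^ 2))
        :+ :- δ :* (Δ :* r :- d :^ 6 :* t) :+ :- (d :^ 6) :* (t :* δ :- ξ))
      ≈-refl r ξ d Δ δ t n₁ n₂)
    where
    w : Series
    w = (r * n₁ * ξ + n₂) * d
    w-const : w 0 ≡ + 1
    w-const = constant-term ((var 0F :* var 1F :* var 2F :+ var 3F) :* var 4F) (r ∷ n₁ ∷ ξ ∷ n₂ ∷ d ∷ []) {λ { 0F → + 0 ; 1F → + 1 ; 2F → + 0 ; 3F → + 1 ; 4F → + 1 }}
      λ { 0F → r-const ; 1F → n₁-const ; 2F → ξ-const ; 3F → n₂-const ; 4F → d-const }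
    quadratic : d * (n₂ ^ 2 - r ^ 2 * n₁ ^ 2) ≈ ι (+ 11) * r * Δ + d ^ 6
    quadratic = identity (d′ :* (n₂′ :^ 2 :- R :^ 2 :* n₁′ :^ 2)) (# 11 :* R :* Δ′ :+ d′ :^ 6) _ r

  -- Proof that β = η(τ)^5/η(5τ): the quotient is invariant under q ↦ q^5.

  P : Series
  P = E ^ 5 * inverse F

  P*F : P * F ≈ E ^ 5
  P*F = inverse-*ʳ F F-const ▸ solve 3 (λ X F i → X :* i :* F := X :+ X :* (F :* i :- # 1)) ≈-refl (E ^ 5) F (inverse F)

  P-const : P 0 ≡ + 1
  P-const = *-const (^-const 5 E-const) refl

  -- Logarithmic derivative of `ξ*n₂`, using D r = V β r. The numerator is the Wronskian of r n₁ and
  -- n₂ with respect to r, which collapses to d^4.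
  β-step : β * (n₁ * n₂) ≈ V β * d ^ 4
  β-step = r-cancel (
    ξ*n₂ ▸ D-ξ ▸ D-r ▸ D-poly (var 0F :* (# 1 :+ # 3 :* var 1F :+ # 4 :* var 1F :^ 2 :+ # 2 :* var 1F :^ 3 :+ var 1F :^ 4)) (ξ ∷ r ∷ []) ▸
    D-cong ξ*n₂ ▸ D-poly (var 0F :* (# 1 :- # 2 :* var 0F :+ # 4 :* var 0F :^ 2 :- # 3 :* var 0F :^ 3 :+ var 0F :^ 4)) (r ∷ []) ▸
    wronskian ▸
    solve 9 (λ r β B ξ Dr Dξ x z k →
      r :* (β :* ((# 1 :- # 2 :* r :+ # 4 :* r :^ 2 :- # 3 :* r :^ 3 :+ r :^ 4) :* (# 1 :+ # 3 :* r :+ # 4 :* r :^ 2 :+ # 2 :* r :^ 3 :+ r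
        :^ 4))) := r :* (B :* k)
        :+ (:- β :* (# 1 :+ # 3 :* r :+ # 4 :* r :^ 2 :+ # 2 :* r :^ 3 :+ r :^ 4) :- r :* B :* (# 3 :+ # 8 :* r :+ # 6 :* r :^ 2 :+ # 4 :*
        r :^ 3)) :* (ξ :* (# 1 :+ # 3 :* r :+ # 4 :* r :^ 2 :+ # 2 :* r :^ 3 :+ r :^ 4) :- r :* (# 1 :- # 2 :* r :+ # 4 :* r :^ 2 :- # 3
        :* r :^ 3 :+ r :^ 4)) :+ :- ((# 1 :+ # 3 :* r :+ # 4 :* r :^ 2 :+ # 2 :* r :^ 3 :+ r :^ 4) :^ 2) :* (Dξ :- β :* ξ)
        :+ (# 1 :+ # 3 :* r :+ # 4 :* r :^ 2 :+ # 2 :* r :^ 3 :+ r :^ 4) :* (# 1 :- # 2 :* r :+ # 4 :* r :^ 2 :- # 3 :* r :^ 3 :+ r :^ 4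
        :+ r :* (# 8 :* r :- # 2 :- # 9 :* r :^ 2 :+ # 4 :* r :^ 3) :- ξ :* (# 3 :+ # 8 :* r :+ # 6 :* r :^ 2 :+ # 4 :* r :^ 3)) :* (Dr :-
        B :* r)
        :+ :- (# 1 :+ # 3 :* r :+ # 4 :* r :^ 2 :+ # 2 :* r :^ 3 :+ r :^ 4) :* (x :- (Dξ :* (# 1 :+ # 3 :* r :+ # 4 :* r :^ 2 :+ # 2 :* r
        :^ 3 :+ r :^ 4) :+ ξ :* (# 0 :+ (# 0 :* r :+ # 3 :* Dr) :+ (# 0 :* r :^ 2 :+ # 4 :* (# 2 :* r :^ 1 :* Dr)) :+ (# 0 :* r :^ 3 :+ #
        2 :* (# 3 :* r :^ 2 :* Dr)) :+ # 4 :* r :^ 3 :* Dr))) :+ (# 1 :+ # 3 :* r :+ # 4 :* r :^ 2 :+ # 2 :* r :^ 3 :+ r :^ 4) :* (x :- z)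
        :+ (# 1 :+ # 3 :* r :+ # 4 :* r :^ 2 :+ # 2 :* r :^ 3 :+ r :^ 4) :* (z :- (Dr :* (# 1 :- # 2 :* r :+ # 4 :* r :^ 2 :- # 3 :* r :^
        3 :+ r :^ 4) :+ r :* (# 0 :- (# 0 :* r :+ # 2 :* Dr) :+ (# 0 :* r :^ 2 :+ # 4 :* (# 2 :* r :^ 1 :* Dr)) :- (# 0 :* r :^ 3 :+ # 3
        :* (# 3 :* r :^ 2 :* Dr)) :+ # 4 :* r :^ 3 :* Dr)))
        :+ r :* B :* ((# 1 :- # 2 :* r :+ # 4 :* r :^ 2 :- # 3 :* r :^ 3 :+ r :^ 4) :* (# 1 :+ # 3 :* r :+ # 4 :* r :^ 2 :+ # 2 :* r :^ 3
        :+ r :^ 4) :+ r :* ((# 8 :* r :- # 2 :- # 9 :* r :^ 2 :+ # 4 :* r :^ 3) :* (# 1 :+ # 3 :* r :+ # 4 :* r :^ 2 :+ # 2 :* r :^ 3 :+ r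
        :^ 4) :- (# 1 :- # 2 :* r :+ # 4 :* r :^ 2 :- # 3 :* r :^ 3 :+ r :^ 4) :* (# 3 :+ # 8 :* r :+ # 6 :* r :^ 2 :+ # 4 :* r :^ 3)) :-
        k))
      ≈-refl r β (V β) ξ (D r) (D ξ) (D (ξ * n₂)) (D (r * n₁)) (d ^ 4))
    where
    wronskian : n₁ * n₂ + r * ((ι (+ 8) * r - ι (+ 2) - ι (+ 9) * r ^ 2 + ι (+ 4) * r ^ 3) * n₂ - n₁ * (ι (+ 3) + ι (+ 8) * r + ι (+ 6) * r ^ 2 + ι (+ 4) * r ^ 3)) ≈ d ^ 4
    wronskian = identity (n₁′ :* n₂′ :+ R :* ((# 8 :* R :- # 2 :- # 9 :* R :^ 2 :+ # 4 :* R :^ 3) :* n₂′ :- n₁′ :* (# 3 :+ # 8 :* R :+ # 6 :* R :^ 2 :+ # 4 :* R :^ 3))) (d′ :^ 4) _ r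

  VP*VF : V P * V F ≈ F ^ 5
  VP*VF =
    V-poly (var 0F :* var 1F) (P ∷ F ∷ []) ▸⁻ dilate-cong 4 0 P*F ▸⁺ V-poly (var 0F :^ 5) (E ∷ []) ▸⁺
    solve 5 (λ VP VF VE x z → VP :* VF := VE :^ 5 :- (x :- VP :* VF) :+ (x :- z) :+ (z :- VE :^ 5))
      ≈-refl (V P) (V F) F (V (P * F)) (V (E ^ 5))

  -- This is the equation that `β` satisfies, so β/P is fixed by V. Its source is φ = V P / P, a
  -- comparison of eta quotients through the modular equation.
  P-step : P * (n₁ * n₂) ≈ V P * d ^ 4
  P-step = unit-cancel d d-const (
    d*n₁*n₂ ▸ d⁵*φ ▸ φ*P ▸
    solve 6 (λ P VP d Δ φ m →
      d :* (P :* m) := d :* (VP :* d :^ 4) :+ P :* (d :* m :- Δ) :+ :- P :* (d :^ 5 :* φ :- Δ) :+ d :^ 5 :* (φ :* P :- VP))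
      ≈-refl P (V P) d Δ φ (n₁ * n₂))
    where
    φ*P : φ * P ≈ V P
    φ*P = unit-cancel (F * V F) (*-const F-const F-const) (q⁵-cancel (
      T*F⁶ ▸ P*F ▸ y⁵ ▸ y*E ▸ VP*VF ▸ T*F⁶ ▸
      solve 9 (λ y E φ P VP F z q T →
        q :^ 5 :* z :^ 6 :* (F :* z :* (φ :* P)) := q :^ 5 :* z :^ 6 :* (F :* z :* VP)
          :+ :- (F :* z :* (φ :* P :- VP)) :* (T :* F :^ 6 :- q :^ 5 :* z :^ 6) :+ F :^ 6 :* z :* φ :* T :* (P :* F :- E :^ 5)
          :+ :- (F :^ 6 :* z :* E :^ 5) :* (y :^ 5 :- T :* φ)
          :+ F :^ 6 :* z :* ((y :* E) :^ 4 :+ (y :* E) :^ 3 :* (q :* z) :+ (y :* E) :^ 2 :* (q :* z) :^ 2 :+ y :* E :* (q :* z) :^ 3 :+ (q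
          :* z) :^ 4) :* (y :* E :- q :* z) :+ :- (F :^ 7 :* T) :* (VP :* z :- F :^ 5) :+ :- (F :^ 6) :* (T :* F :^ 6 :- q :^ 5 :* z :^ 6))
        ≈-refl y E φ P (V P) F (V F) q (V t)))
      where
      q⁵-cancel : ∀ {f g} → q ^ 5 * V F ^ 6 * f ≈ q ^ 5 * V F ^ 6 * g → f ≈ g
      q⁵-cancel {f} {g} h = unit-cancel (V F ^ 6) (^-const 6 F-const) (mono-cancel 5 (
        mono-^ 5 ▸ h ▸⁺
        solve 5 (λ m q z f g →
          m :* (z :^ 6 :* f) := m :* (z :^ 6 :* g) :+ z :^ 6 :* (f :- g) :* (m :- q :^ 5)
            :+ (q :^ 5 :* z :^ 6 :* f :- q :^ 5 :* z :^ 6 :* g))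
          ≈-refl (mono 5) q (V F) f g))

  β≈P : β ≈ P
  β≈P = unit-cancel (inverse P) refl (
    quotient ▸⁺ ≈-refl ▸⁻ inverse-*ʳ P P-const ▸⁻
    solve 4 (λ β P i h → i :* β := i :* P :+ (h :- # 0) :- (h :- (β :* i :- # 1)) :- (P :* i :- # 1))
      ≈-refl β P (inverse P) h)
    where
    h : Series
    h = β * inverse P - ι (+ 1)
    cross : β * V P ≈ V β * P
    cross = unit-cancel (n₁ * n₂ * d ^ 4) (*-const (*-const n₁-const n₂-const) (^-const 4 d-const)) (
      β-step ▸ P-step ▸
      solve 6 (λ β P B VP m k → m :* k :* (β :* VP) := m :* k :* (B :* P) :+ k :* VP :* (β :* m :- B :* k) :+ :- (k :* B) :* (P :* m :- VP :* k))
        ≈-refl β P (V β) (V P) (n₁ * n₂) (d ^ 4))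
    quotient : h ≈ ι (+ 0)
    quotient = descent (+ 1) (unit-cancel (P * V P) (*-const P-const P-const) (
      inverse-*ʳ P P-const ▸ cross ▸⁺ V-poly (var 0F :* var 1F :- # 1) (β ∷ inverse P ∷ []) ▸
      V-poly (var 0F :* var 1F) (P ∷ inverse P ∷ []) ▸ dilate-cong 4 0 (inverse-*ʳ P P-const) ▸ dilate-ι 4 (+ 1) ▸
      solve 9 (λ β P i Vβ VP Vi x w o →
        P :* VP :* (β :* i :- # 1) := P :* VP :* (# 1 :* x) :+ VP :* β :* (P :* i :- # 1) :+ (β :* VP :- Vβ :* P)
          :+ :- (P :* VP) :* (x :- (Vβ :* Vi :- # 1)) :+ P :* Vβ :* (w :- VP :* Vi) :+ :- (P :* Vβ) :* (w :- o)
          :+ :- (P :* Vβ) :* (o :- # 1))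
        ≈-refl β P (inverse P) (V β) (V P) (V (inverse P)) (V h) (V (P * inverse P)) (V (ι (+ 1)))))
      (constant-term (var 0F :* var 1F :- # 1) (β ∷ inverse P ∷ []) {λ { 0F → + 1 ; 1F → + 1 }} λ { 0F → β-const ; 1F → refl })
      where
      β-const : β 0 ≡ + 1
      β-const = constant-term (# 1 :+ # 5 :* (var 0F :* var 1F)) (D ν ∷ inverse ν ∷ []) {λ { 0F → + 0 ; 1F → + 1 }} λ { 0F → D-coeff ν 0 ; 1F → refl }

  -- This is E₄ divided by P^2, as `Q₄≈` will show.
  level₁ : Series
  level₁ = ι (+ 1) + ι (+ 250) * t + ι (+ 3125) * t ^ 2

  𝓔*δ′ : 𝓔 * δ ≈ P * (ι (+ 1) + ξ ^ 2)
  𝓔*δ′ = ≈-trans 𝓔*δ (*-congʳ β≈P)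

  D-ξ′ : D ξ ≈ P * ξ
  D-ξ′ = ≈-trans D-ξ (*-congʳ β≈P)

  D-P : D P ≈ ι (+ 5) * (V G - G) * P
  D-P = unit-cancel F F-const (
    D-poly (var 0F :* var 1F) (P ∷ F ∷ []) ▸⁻ D-cong P*F ▸⁺ D-poly (var 0F :^ 5) (E ∷ []) ▸⁺ D-E ▸ D-F ▸ P*F ▸
    solve 10 (λ P F E G g DP DF DE x z →
      F :* DP := F :* (# 5 :* (g :- G) :* P) :- (x :- (DP :* F :+ P :* DF)) :+ (x :- z) :+ (z :- # 5 :* E :^ 4 :* DE)
        :+ # 5 :* E :^ 4 :* (DE :- :- (G :* E)) :+ :- P :* (DF :- :- (# 5 :* g :* F)) :+ # 5 :* G :* (P :* F :- E :^ 5))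
      ≈-refl P F E G (V G) (D P) (D F) (D E) (D (P * F)) (D (E ^ 5)))

  D-𝓔 : δ * D 𝓔 ≈ ι (+ 5) * (V G - G) * (𝓔 * δ) + ι (+ 2) * P ^ 2 * ξ ^ 2 + 𝓔 * P * (ι (+ 11) * ξ + ι (+ 2) * ξ ^ 2)
  D-𝓔 =
    D-poly (var 0F :* (# 1 :- # 11 :* var 1F :- var 1F :^ 2)) (𝓔 ∷ ξ ∷ []) ▸⁻ D-cong 𝓔*δ′ ▸⁺
    D-poly (var 0F :* (# 1 :+ var 1F :^ 2)) (P ∷ ξ ∷ []) ▸⁺ D-P ▸ D-ξ′ ▸ 𝓔*δ′ ▸
    solve 10 (λ e P ξ G g De DP Dξ x z →
      (# 1 :- # 11 :* ξ :- ξ :^ 2) :* De :=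
        # 5 :* (g :- G) :* (e :* (# 1 :- # 11 :* ξ :- ξ :^ 2)) :+ # 2 :* P :^ 2 :* ξ :^ 2 :+ e :* P :* (# 11 :* ξ :+ # 2 :* ξ :^ 2)
        :- (x :- (De :* (# 1 :- # 11 :* ξ :- ξ :^ 2) :+ e :* (# 0 :- (# 0 :* ξ :+ # 11 :* Dξ) :- # 2 :* ξ :^ 1 :* Dξ))) :+ (x :- z)
        :+ (z :- (DP :* (# 1 :+ ξ :^ 2) :+ P :* (# 0 :+ # 2 :* ξ :^ 1 :* Dξ))) :+ (# 1 :+ ξ :^ 2) :* (DP :- # 5 :* (g :- G) :* P)
        :+ (# 2 :* P :* ξ :+ e :* (# 11 :+ # 2 :* ξ)) :* (Dξ :- P :* ξ)
        :+ :- (# 5 :* (g :- G)) :* (e :* (# 1 :- # 11 :* ξ :- ξ :^ 2) :- P :* (# 1 :+ ξ :^ 2)))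
      ≈-refl 𝓔 P ξ G (V G) (D 𝓔) (D P) (D ξ) (D (𝓔 * δ)) (D (P * (ι (+ 1) + ξ ^ 2)))

  D-𝓔-G : D 𝓔 ≈ ι (+ 6) * D G - ι (+ 150) * V (D G)
  D-𝓔-G =
    D-poly (# 1 :+ # 6 :* var 0F :- # 30 :* var 1F) (G ∷ V G ∷ []) ▸⁺ D-dilate 4 G ▸
    solve 6 (λ G g DG Dg x z →
      x := # 6 :* DG :- # 150 :* z :+ (x :- (# 0 :+ (# 0 :* G :+ # 6 :* DG) :- (# 0 :* g :+ # 30 :* Dg))) :+ :- # 30 :* (Dg :- # 5 :* z))
      ≈-refl G (V G) (D G) (D (V G)) (D 𝓔) (V (D G))

  -- As E₂ - 5 V E₂ = -4 𝓔 and D V = 5 V D, the factor 25 splits the squares into (E₂ - 5 V E₂)(E₂ +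
  -- 5 V E₂) and makes the derivative part a multiple of D 𝓔.
  Q₄-difference : Q₄ - ι (+ 25) * V Q₄ ≈ ι (+ 48) * D 𝓔 - ι (+ 24) * 𝓔 * (ι (+ 1) - ι (+ 4) * G - ι (+ 20) * V G)
  Q₄-difference =
    V-poly ((# 1 :- # 24 :* var 0F) :* (# 1 :- # 24 :* var 0F) :- # 12 :* var 1F) (G ∷ D E₂ ∷ []) ▸ D-E₂ ▸ dilate-cong 4 0 D-E₂ ▸
    V-poly (:- (# 24 :* var 0F)) (D G ∷ []) ▸ D-𝓔-G ▸
    solve 9 (λ G VG c Vc h Vh x y z →
      (# 1 :- # 24 :* G) :* (# 1 :- # 24 :* G) :- # 12 :* c :- # 25 :* x :=
        # 48 :* z :- # 24 :* (# 1 :+ # 6 :* G :- # 30 :* VG) :* (# 1 :- # 4 :* G :- # 20 :* VG)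
        :+ :- # 25 :* (x :- ((# 1 :- # 24 :* VG) :* (# 1 :- # 24 :* VG) :- # 12 :* Vc)) :+ :- # 12 :* (c :- :- (# 24 :* h))
        :+ # 300 :* (Vc :- y) :+ # 300 :* (y :- :- (# 24 :* Vh)) :+ :- # 48 :* (z :- (# 6 :* h :- # 150 :* Vh)))
      ≈-refl G (V G) (D E₂) (V (D E₂)) (D G) (V (D G)) (V Q₄) (V (- (ι (+ 24) * D G))) (D 𝓔)

  -- The quasimodular terms combine: 48 times the part 5 (V G - G) 𝓔 of D 𝓔, together with the
  -- second term in `Q₄-difference`, gives -24 𝓔^2. What remains is expressed by P, ξ and t.
  Q₄-difference-t : Q₄ - ι (+ 25) * V Q₄ ≈ ι (+ 24) * P ^ 2 * (ι (+ 125) * t ^ 2 - ι (+ 1))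
  Q₄-difference-t = unit-cancel (δ ^ 2) (^-const 2 δ-const) (
    Q₄-difference ▸ D-𝓔 ▸ ≈-refl {𝓔} ▸ ≈-refl {𝓔 * δ} ▸ 𝓔*δ′ ▸ t*δ ▸
    solve 10 (λ e P ξ G g t De Q R S →
      (# 1 :- # 11 :* ξ :- ξ :^ 2) :^ 2 :* (Q :- # 25 :* R) :=
        (# 1 :- # 11 :* ξ :- ξ :^ 2) :^ 2 :* (# 24 :* P :^ 2 :* (# 125 :* t :^ 2 :- # 1))
        :+ (# 1 :- # 11 :* ξ :- ξ :^ 2) :^ 2 :* (Q :- # 25 :* R :- (# 48 :* De :- # 24 :* e :* (# 1 :- # 4 :* G :- # 20 :* g)))
        :+ # 48 :* (# 1 :- # 11 :* ξ :- ξ :^ 2) :* ((# 1 :- # 11 :* ξ :- ξ :^ 2) :* De :- (# 5 :* (g :- G) :* S :+ # 2 :* P :^ 2 :* ξ :^ 2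
        :+ e :* P :* (# 11 :* ξ :+ # 2 :* ξ :^ 2))) :+ :- # 24 :* S :* (# 1 :- # 11 :* ξ :- ξ :^ 2) :* (# 1 :+ # 6 :* G :- # 30 :* g :- e)
        :+ (# 24 :* (# 1 :- # 11 :* ξ :- ξ :^ 2) :* (# 1 :- # 4 :* G :- # 20 :* g) :+ # 24 :* S :- # 48 :* P :* (# 11 :* ξ :+ # 2 :* ξ :^
        2)) :* (S :- e :* (# 1 :- # 11 :* ξ :- ξ :^ 2))
        :+ (:- # 24 :* (S :+ P :* (# 1 :+ ξ :^ 2)) :+ # 48 :* P :* (# 11 :* ξ :+ # 2 :* ξ :^ 2)) :* (S :- P :* (# 1 :+ ξ :^ 2))
        :+ :- # 3000 :* P :^ 2 :* (t :* (# 1 :- # 11 :* ξ :- ξ :^ 2) :+ ξ) :* (t :* (# 1 :- # 11 :* ξ :- ξ :^ 2) :- ξ))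
      ≈-refl 𝓔 P ξ G (V G) t (D 𝓔) Q₄ (V Q₄) (𝓔 * δ))

  -- The right side fits `Q₄-difference-t`, since `level₁` - 25 (1 + 10 t + 5 t^2) = 24 (125 t^2 -
  -- 1).
  V-level₁ : V (P ^ 2 * level₁) ≈ P ^ 2 * (ι (+ 1) + ι (+ 10) * t + ι (+ 5) * t ^ 2)
  V-level₁ = unit-cancel (Δ ^ 2 * d ^ 12) (*-const (^-const 2 Δ-const) (^-const 12 d-const)) (
    V-poly (var 0F :^ 2 :* (# 1 :+ # 250 :* var 1F :+ # 3125 :* var 1F :^ 2)) (P ∷ t ∷ []) ▸ T*Δ ▸ P-step ▸ d*n₁*n₂ ▸ expansion ▸ Δ*r ▸
    solve 9 (λ P VP t Vt d Δ r m x →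
      Δ :^ 2 :* d :^ 12 :* x := Δ :^ 2 :* d :^ 12 :* (P :^ 2 :* (# 1 :+ # 10 :* t :+ # 5 :* t :^ 2))
        :+ Δ :^ 2 :* d :^ 12 :* (x :- VP :^ 2 :* (# 1 :+ # 250 :* Vt :+ # 3125 :* Vt :^ 2))
        :+ VP :^ 2 :* d :^ 12 :* (# 250 :* Δ :+ # 3125 :* (Vt :* Δ :+ r :^ 5)) :* (Vt :* Δ :- r :^ 5)
        :+ :- (d :^ 4 :* (Δ :^ 2 :+ # 250 :* r :^ 5 :* Δ :+ # 3125 :* r :^ 10) :* (VP :* d :^ 4 :+ P :* m)) :* (P :* m :- VP :* d :^ 4)
        :+ P :^ 2 :* d :^ 2 :* (Δ :^ 2 :+ # 250 :* r :^ 5 :* Δ :+ # 3125 :* r :^ 10) :* (d :* m :+ Δ) :* (d :* m :- Δ)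
        :+ P :^ 2 :* Δ :^ 2 :* (d :^ 2 :* (Δ :^ 2 :+ # 250 :* r :^ 5 :* Δ :+ # 3125 :* r :^ 10) :- (d :^ 12 :+ # 10 :* r :* Δ :* d :^ 6 :+
        # 5 :* r :^ 2 :* Δ :^ 2)) :+ P :^ 2 :* Δ :^ 2 :* (# 10 :* d :^ 6 :+ # 5 :* (Δ :* r :+ d :^ 6 :* t)) :* (Δ :* r :- d :^ 6 :* t))
      ≈-refl P (V P) t (V t) d Δ r (n₁ * n₂) (V (P ^ 2 * level₁)))
    where
    expansion : d ^ 2 * (Δ ^ 2 + ι (+ 250) * r ^ 5 * Δ + ι (+ 3125) * r ^ 10) ≈ d ^ 12 + ι (+ 10) * r * Δ * d ^ 6 + ι (+ 5) * r ^ 2 * Δ ^ 2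
    expansion = identity (d′ :^ 2 :* (Δ′ :^ 2 :+ # 250 :* R :^ 5 :* Δ′ :+ # 3125 :* R :^ 10)) (d′ :^ 12 :+ # 10 :* R :* Δ′ :* d′ :^ 6 :+ # 5 :* R :^ 2 :* Δ′ :^ 2) _ r

  t-const : t 0 ≡ + 0
  t-const = constant-term (var 0F :* var 1F) (q * F ^ 6 ∷ inverse (E ^ 6) ∷ []) {λ { 0F → + 0 ; 1F → + 1 }} λ { 0F → mono-suc-*-0 0 (F ^ 6) ; 1F → refl }

  -- Both sides f have the same f - 25 V(f).
  Q₄≈ : Q₄ ≈ P ^ 2 * level₁
  Q₄≈ =
    descent (+ 25) invariant h-const ▸⁺ ≈-refl ▸⁻
    solve 3 (λ Q x h → Q := x :+ (h :- # 0) :- (h :- (Q :- x)))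
      ≈-refl Q₄ (P ^ 2 * level₁) (Q₄ - P ^ 2 * level₁)
    where
    invariant : Q₄ - P ^ 2 * level₁ ≈ ι (+ 25) * V (Q₄ - P ^ 2 * level₁)
    invariant =
      V-poly (var 0F :- var 1F) (Q₄ ∷ P ^ 2 * level₁ ∷ []) ▸ Q₄-difference-t ▸⁺ V-level₁ ▸
      solve 6 (λ Q P t Vx z VQ →
        Q :- P :^ 2 :* (# 1 :+ # 250 :* t :+ # 3125 :* t :^ 2) := # 25 :* z :+ :- # 25 :* (z :- (VQ :- Vx))
          :+ (Q :- # 25 :* VQ :- # 24 :* P :^ 2 :* (# 125 :* t :^ 2 :- # 1))
          :+ # 25 :* (Vx :- P :^ 2 :* (# 1 :+ # 10 :* t :+ # 5 :* t :^ 2)))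
        ≈-refl Q₄ P t (V (P ^ 2 * level₁)) (V (Q₄ - P ^ 2 * level₁)) (V Q₄)
    h-const : (Q₄ - P ^ 2 * level₁) 0 ≡ + 0
    h-const = constant-term ((# 1 :- # 24 :* var 0F) :* (# 1 :- # 24 :* var 0F) :- # 12 :* var 1F :- var 2F :^ 2 :* (# 1 :+ # 250 :* var 3F :+ # 3125 :* var 3F :^ 2)) (G ∷ D E₂ ∷ P ∷ t ∷ [])
      {λ { 0F → + 0 ; 1F → + 0 ; 2F → + 1 ; 3F → + 0 }} λ { 0F → ι0-coeff 0 ; 1F → D-coeff E₂ 0 ; 2F → P-const ; 3F → t-const }

  -- In E₂ Q₄ - 3 D Q₄ the derivative of P^2 contributes -30 (V G - G), which turns E₂ into 𝓔. As D
  -- t = 𝓔 t, the remaining factor is `level₁` minus 3 t times its derivative in t.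
  E₆-level₁ : E₆ ≈ 𝓔 * P ^ 2 * (ι (+ 1) - ι (+ 500) * t - ι (+ 15625) * t ^ 2)
  E₆-level₁ =
    E₆≈ ▸⁺ Q₄≈ ▸ D-cong Q₄≈ ▸ D-poly (var 0F :^ 2 :* (# 1 :+ # 250 :* var 1F :+ # 3125 :* var 1F :^ 2)) (P ∷ t ∷ []) ▸ D-P ▸ D-𝓔-t ▸
    solve 10 (λ X Q P t G g DQ DP Dt x →
      X := (# 1 :+ # 6 :* G :- # 30 :* g) :* P :^ 2 :* (# 1 :- # 500 :* t :- # 15625 :* t :^ 2)
        :+ (X :- ((# 1 :- # 24 :* G) :* Q :- # 3 :* DQ)) :+ (# 1 :- # 24 :* G) :* (Q :- P :^ 2 :* (# 1 :+ # 250 :* t :+ # 3125 :* t :^ 2))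
        :+ :- # 3 :* (DQ :- x)
        :+ :- # 3 :* (x :- (# 2 :* P :^ 1 :* DP :* (# 1 :+ # 250 :* t :+ # 3125 :* t :^ 2) :+ P :^ 2 :* (# 0 :+ (# 0 :* t :+ # 250 :* Dt)
        :+ (# 0 :* t :^ 2 :+ # 3125 :* (# 2 :* t :^ 1 :* Dt)))))
        :+ :- # 6 :* P :* (# 1 :+ # 250 :* t :+ # 3125 :* t :^ 2) :* (DP :- # 5 :* (g :- G) :* P)
        :+ :- # 3 :* P :^ 2 :* (# 250 :+ # 6250 :* t) :* (Dt :- (# 1 :+ # 6 :* G :- # 30 :* g) :* t))
      ≈-refl E₆ Q₄ P t G (V G) (D Q₄) (D P) (D t) (D (P ^ 2 * level₁))

  ψ : Series
  ψ = n₂ ^ 2 + r ^ 2 * n₁ ^ 2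

  -- Combines 𝓔 δ = P (1 + ξ^2), ξ = r n₁/n₂ and `P-step`. Over the denominator Δ, a series in q^5,
  -- this makes 𝓔 a polynomial in r times a series in q^5, the form on which U can be read off.
  𝓔*Δ : 𝓔 * Δ ≈ V P * ψ
  𝓔*Δ = unit-cancel (d ^ 4) (^-const 4 d-const) (
    d*n₁*n₂ ▸ norm ▸ ξ*n₂ ▸ 𝓔*δ′ ▸ ξ*n₂ ▸ P-step ▸
    solve 9 (λ e d Δ P VP n z r ξ →
      d :^ 4 :* (e :* Δ) := d :^ 4 :* (VP :* (z :^ 2 :+ r :^ 2 :* n :^ 2)) :+ :- (e :* d :^ 4) :* (d :* (n :* z) :- Δ)
        :+ :- (e :* n :* z) :* (z :^ 2 :- # 11 :* r :* n :* z :- r :^ 2 :* n :^ 2 :- d :^ 5)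
        :+ e :* n :* z :* (# 11 :* z :+ (ξ :* z :+ r :* n)) :* (ξ :* z :- r :* n)
        :+ n :* z :^ 3 :* (e :* (# 1 :- # 11 :* ξ :- ξ :^ 2) :- P :* (# 1 :+ ξ :^ 2))
        :+ P :* n :* z :* (ξ :* z :+ r :* n) :* (ξ :* z :- r :* n) :+ (z :^ 2 :+ r :^ 2 :* n :^ 2) :* (P :* (n :* z) :- VP :* d :^ 4))
      ≈-refl 𝓔 d Δ P (V P) n₁ n₂ r ξ)
    where
    norm : n₂ ^ 2 - ι (+ 11) * r * n₁ * n₂ - r ^ 2 * n₁ ^ 2 ≈ d ^ 5
    norm = identity (n₂′ :^ 2 :- # 11 :* R :* n₁′ :* n₂′ :- R :^ 2 :* n₁′ :^ 2) (d′ :^ 5) _ r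

  -- The action of U on 𝓔 y^i

  δ^*U : ∀ k e e′ → T (every₅ 0 (coeffs e) ≐ coeffs e′) → ∀ {f h} → Δ ^ k * f ≈ ⟦ e ⟧ (r ∷ []) * V h → δ ^ k * U f ≈ ⟦ e′ ⟧ (ξ ∷ []) * h
  δ^*U k e e′ check {f} {h} eq = begin
    δ ^ k * U f              ≈⟨ U-V* (δ ^ k) f ⟨
    U (V (δ ^ k) * f)        ≈⟨ ext-cong 0 (*-congʳ (V-^ k)) ⟩
    U (Δ ^ k * f)            ≈⟨ ext-cong 0 eq ⟩
    U (⟦ e ⟧ (r ∷ []) * V h) ≈⟨ Dis.U-identity e e′ check h ⟩
    ⟦ e′ ⟧ (ξ ∷ []) * h      ∎
    where
    open ≈R
    V-^ : ∀ k → V (δ ^ k) ≈ Δ ^ k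
    V-^ zero = dilate-ι 4 (+ 1)
    V-^ (suc k) = ≈-trans (dilate-* 4 0 δ (δ ^ k)) (*-cong V-δ (V-^ k))

  y*Δ : y * Δ ≈ r * (n₁ * n₂)
  y*Δ =
    d*n₁*n₂ ▸ y*d ▸
    solve 5 (λ y d r Δ m → y :* Δ := r :* m :+ :- y :* (d :* m :- Δ) :+ m :* (y :* d :- r))
      ≈-refl y d r Δ (n₁ * n₂)

  U-𝓔y^ : ∀ i e′ → T (every₅ 0 (coeffs (ψ′ :* (R :* m′) :^ i)) ≐ coeffs e′) → δ ^ suc i * U (𝓔 * y ^ i) ≈ ⟦ e′ ⟧ (ξ ∷ []) * P
  U-𝓔y^ i e′ check = δ^*U (suc i) (ψ′ :* (R :* m′) :^ i) e′ check (
    𝓔*Δ ▸ y*Δ^ i ▸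
    solve 7 (λ e Δ D Y z p s → Δ :* D :* (e :* Y) := s :* z :* p :+ D :* Y :* (e :* Δ :- p :* s) :+ p :* s :* (Y :* D :- z))
      ≈-refl 𝓔 Δ (Δ ^ i) (y ^ i) ((r * (n₁ * n₂)) ^ i) (V P) ψ)
    where
    y*Δ^ : ∀ i → y ^ i * Δ ^ i ≈ (r * (n₁ * n₂)) ^ i
    y*Δ^ zero = solve 0 (# 1 :* # 1 := # 1) ≈-refl
    y*Δ^ (suc i) =
      y*Δ ▸ y*Δ^ i ▸
      solve 7 (λ y Y Δ D z m r → y :* Y :* (Δ :* D) := r :* m :* z :+ Y :* D :* (y :* Δ :- r :* m) :+ r :* m :* (Y :* D :- z))
        ≈-refl y (y ^ i) Δ (Δ ^ i) ((r * (n₁ * n₂)) ^ i) (n₁ * n₂) r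

  U-𝓔 : U (𝓔 * y ^ 0) ≈ 𝓔
  U-𝓔 = unit-cancel (δ ^ 1) (^-const 1 δ-const) (
    U-𝓔y^ 0 (# 1 :+ R :^ 2) _ ▸⁺ 𝓔*δ′ ▸⁻
    solve 5 (λ e δ u ξ P → δ :^ 1 :* u := δ :^ 1 :* e :+ (δ :^ 1 :* u :- (# 1 :+ ξ :^ 2) :* P) :- (e :* δ :- P :* (# 1 :+ ξ :^ 2)))
      ≈-refl 𝓔 δ (U (𝓔 * y ^ 0)) ξ P)

  U-𝓔y : U (𝓔 * y ^ 1) ≈ 𝓔 * (ι (+ 125) * t)
  U-𝓔y = unit-cancel (δ ^ 2) (^-const 2 δ-const) (
    U-𝓔y^ 1 ((# 1 :+ R :^ 2) :* (# 125 :* R)) _ ▸⁺ 𝓔*δ′ ▸ t*δ ▸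
    solve 6 (λ e δ u ξ P t →
      δ :^ 2 :* u := δ :^ 2 :* (e :* (# 125 :* t)) :+ (δ :^ 2 :* u :- (# 1 :+ ξ :^ 2) :* (# 125 :* ξ) :* P)
        :+ :- # 125 :* t :* δ :* (e :* δ :- P :* (# 1 :+ ξ :^ 2)) :+ :- # 125 :* P :* (# 1 :+ ξ :^ 2) :* (t :* δ :- ξ))
      ≈-refl 𝓔 δ (U (𝓔 * y ^ 1)) ξ P t)

  U-𝓔y² : U (𝓔 * y ^ 2) ≈ 𝓔 * (ι (+ 100) * t + ι (+ 3125) * t ^ 2)
  U-𝓔y² = unit-cancel (δ ^ 3) (^-const 3 δ-const) (
    U-𝓔y^ 2 ((# 1 :+ R :^ 2) :* (# 100 :* R :* δ′ :+ # 3125 :* R :^ 2)) _ ▸⁺ ≈-refl {δ} ▸ 𝓔*δ′ ▸ t*δ ▸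
    solve 6 (λ e δ u ξ P t →
      δ :^ 3 :* u := δ :^ 3 :* (e :* (# 100 :* t :+ # 3125 :* t :^ 2))
        :+ (δ :^ 3 :* u :- (# 1 :+ ξ :^ 2) :* (# 100 :* ξ :* (# 1 :- # 11 :* ξ :- ξ :^ 2) :+ # 3125 :* ξ :^ 2) :* P)
        :+ :- (# 1 :+ ξ :^ 2) :* P :* # 100 :* ξ :* (δ :- (# 1 :- # 11 :* ξ :- ξ :^ 2))
        :+ :- (# 100 :* t :+ # 3125 :* t :^ 2) :* δ :^ 2 :* (e :* δ :- P :* (# 1 :+ ξ :^ 2))
        :+ :- P :* (# 1 :+ ξ :^ 2) :* (# 100 :* δ :+ # 3125 :* (t :* δ :+ ξ)) :* (t :* δ :- ξ))
      ≈-refl 𝓔 δ (U (𝓔 * y ^ 2)) ξ P t)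

  U-𝓔y³ : U (𝓔 * y ^ 3) ≈ 𝓔 * (ι (+ 45) * t + ι (+ 5625) * t ^ 2 + ι (+ 78125) * t ^ 3)
  U-𝓔y³ = unit-cancel (δ ^ 4) (^-const 4 δ-const) (
    U-𝓔y^ 3 ((# 1 :+ R :^ 2) :* (# 45 :* R :* δ′ :^ 2 :+ # 5625 :* R :^ 2 :* δ′ :+ # 78125 :* R :^ 3)) _ ▸⁺ ≈-refl {δ} ▸ 𝓔*δ′ ▸ t*δ ▸
    solve 6 (λ e δ u ξ P t →
      δ :^ 4 :* u := δ :^ 4 :* (e :* (# 45 :* t :+ # 5625 :* t :^ 2 :+ # 78125 :* t :^ 3))
        :+ (δ :^ 4 :* u :- (# 1 :+ ξ :^ 2) :* (# 45 :* ξ :* (# 1 :- # 11 :* ξ :- ξ :^ 2) :^ 2 :+ # 5625 :* ξ :^ 2 :* (# 1 :- # 11 :* ξ :-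
        ξ :^ 2) :+ # 78125 :* ξ :^ 3) :* P)
        :+ :- (# 1 :+ ξ :^ 2) :* P :* (# 45 :* ξ :* (δ :+ # 1 :- # 11 :* ξ :- ξ :^ 2) :+ # 5625 :* ξ :^ 2) :* (δ :- (# 1 :- # 11 :* ξ :- ξ
        :^ 2)) :+ :- (# 45 :* t :+ # 5625 :* t :^ 2 :+ # 78125 :* t :^ 3) :* δ :^ 3 :* (e :* δ :- P :* (# 1 :+ ξ :^ 2))
        :+ :- P :* (# 1 :+ ξ :^ 2) :* (# 45 :* δ :^ 2 :+ # 5625 :* δ :* (t :* δ :+ ξ) :+ # 78125 :* ((t :* δ) :^ 2 :+ t :* δ :* ξ :+ ξ :^
        2)) :* (t :* δ :- ξ))
      ≈-refl 𝓔 δ (U (𝓔 * y ^ 3)) ξ P t)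

  U-𝓔y⁴ : U (𝓔 * y ^ 4) ≈ 𝓔 * (ι (+ 10) * t + ι (+ 5500) * t ^ 2 + ι (+ 218750) * t ^ 3 + ι (+ 1953125) * t ^ 4)
  U-𝓔y⁴ = unit-cancel (δ ^ 5) (^-const 5 δ-const) (
    U-𝓔y^ 4 ((# 1 :+ R :^ 2) :* (# 10 :* R :* δ′ :^ 3 :+ # 5500 :* R :^ 2 :* δ′ :^ 2 :+ # 218750 :* R :^ 3 :* δ′ :+ # 1953125 :* R :^ 4))
    _ ▸⁺ ≈-refl {δ} ▸ 𝓔*δ′ ▸ t*δ ▸
    solve 6 (λ e δ u ξ P t →
      δ :^ 5 :* u := δ :^ 5 :* (e :* (# 10 :* t :+ # 5500 :* t :^ 2 :+ # 218750 :* t :^ 3 :+ # 1953125 :* t :^ 4))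
        :+ (δ :^ 5 :* u :- (# 1 :+ ξ :^ 2) :* (# 10 :* ξ :* (# 1 :- # 11 :* ξ :- ξ :^ 2) :^ 3 :+ # 5500 :* ξ :^ 2 :* (# 1 :- # 11 :* ξ :-
        ξ :^ 2) :^ 2 :+ # 218750 :* ξ :^ 3 :* (# 1 :- # 11 :* ξ :- ξ :^ 2) :+ # 1953125 :* ξ :^ 4) :* P)
        :+ :- (# 1 :+ ξ :^ 2) :* P :* (# 10 :* ξ :* (δ :^ 2 :+ δ :* (# 1 :- # 11 :* ξ :- ξ :^ 2) :+ (# 1 :- # 11 :* ξ :- ξ :^ 2) :^ 2) :+
        # 5500 :* ξ :^ 2 :* (δ :+ # 1 :- # 11 :* ξ :- ξ :^ 2) :+ # 218750 :* ξ :^ 3) :* (δ :- (# 1 :- # 11 :* ξ :- ξ :^ 2))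
        :+ :- (# 10 :* t :+ # 5500 :* t :^ 2 :+ # 218750 :* t :^ 3 :+ # 1953125 :* t :^ 4) :* δ :^ 4 :* (e :* δ :- P :* (# 1 :+ ξ :^ 2))
        :+ :- P :* (# 1 :+ ξ :^ 2) :* (# 10 :* δ :^ 3 :+ # 5500 :* δ :^ 2 :* (t :* δ :+ ξ) :+ # 218750 :* δ :* ((t :* δ) :^ 2 :+ t :* δ :*
        ξ :+ ξ :^ 2) :+ # 1953125 :* ((t :* δ) :^ 3 :+ (t :* δ) :^ 2 :* ξ :+ t :* δ :* ξ :^ 2 :+ ξ :^ 3)) :* (t :* δ :- ξ))
      ≈-refl 𝓔 δ (U (𝓔 * y ^ 4)) ξ P t)

  -- Lattice i is spanned by 5^e 𝓔 t^l with l ≥ i/5 and e ≥ (5l - i)/2; it contains U (𝓔 y^i).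

  5^_ : ℕ → Series
  5^ e = ι (+ (5 ℕ.^ e))

  data Lattice (i : ℕ) : Series → Set where
    gen   : ∀ e l → i ℕ.≤ 5 ℕ.* l → 5 ℕ.* l ℕ.≤ 2 ℕ.* e ℕ.+ i → Lattice i (5^ e * (𝓔 * t ^ l))
    add   : ∀ {f g} → Lattice i f → Lattice i g → Lattice i (f + g)
    scale : ∀ z {f} → Lattice i f → Lattice i (ι z * f)
    resp  : ∀ {f g} → f ≈ g → Lattice i g → Lattice i f

  5^-+ : ∀ a b → 5^ (a ℕ.+ b) ≈ 5^ a * 5^ b
  5^-+ a b = ≈-trans (coeffwise λ n → cong (λ z → ι z n) (trans (cong +_ (ℕₚ.^-distribˡ-+-* 5 a b)) (ℤₚ.pos-* (5 ℕ.^ a) (5 ℕ.^ b)))) (ι-*-homo (+ (5 ℕ.^ a)) (+ (5 ℕ.^ b)))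

  -- Multiplication by 5^ε t is what a term 5^ε y^κ of the modular equation does to U (𝓔 y^(κ+i)).
  -- Its coefficients 1, 5, 15, 25, 25 satisfy κ <= 2ε, and 5l <= 2e + i in `Lattice` is the bound
  -- that this condition preserves.
  raise : ∀ κ ε → κ ℕ.≤ 2 ℕ.* ε → ∀ {i f} → Lattice (κ ℕ.+ i) f → Lattice (5 ℕ.+ i) (5^ ε * (t * f))
  raise κ ε κ≤ {i} (gen e l lo hi) = resp (
    5^-+ ε e ▸
    solve 6 (λ a b c t g u → a :* (t :* (b :* (g :* u))) := c :* (g :* (t :* u)) :+ :- (g :* t :* u) :* (c :- a :* b))
      ≈-refl (5^ ε) (5^ e) (5^ (ε ℕ.+ e)) t 𝓔 (t ^ l))
    (gen (ε ℕ.+ e) (suc l) (ℕₚ.≤-trans (ℕₚ.+-monoʳ-≤ 5 (ℕₚ.≤-trans (ℕₚ.m≤n+m i κ) lo)) (ℕₚ.≤-reflexive (sym (ℕₚ.*-suc 5 l))))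
      (begin
        5 ℕ.* suc l                            ≡⟨ ℕₚ.*-suc 5 l ⟩
        5 ℕ.+ 5 ℕ.* l                          ≤⟨ ℕₚ.+-monoʳ-≤ 5 hi ⟩
        5 ℕ.+ (2 ℕ.* e ℕ.+ (κ ℕ.+ i))          ≤⟨ ℕₚ.+-monoʳ-≤ 5 (ℕₚ.+-monoʳ-≤ (2 ℕ.* e) (ℕₚ.+-monoˡ-≤ i κ≤)) ⟩
        5 ℕ.+ (2 ℕ.* e ℕ.+ (2 ℕ.* ε ℕ.+ i))    ≡⟨ arith e ε i ⟩
        2 ℕ.* (ε ℕ.+ e) ℕ.+ (5 ℕ.+ i)          ∎))
    where
    open ℕₚ.≤-Reasoning
    arith : ∀ e ε i → 5 ℕ.+ (2 ℕ.* e ℕ.+ (2 ℕ.* ε ℕ.+ i)) ≡ 2 ℕ.* (ε ℕ.+ e) ℕ.+ (5 ℕ.+ i)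
    arith = ℕˢ.solve-∀
  raise κ ε κ≤ (add {f} {g} x y) = resp (
    solve 4 (λ a t f g → a :* (t :* (f :+ g)) := a :* (t :* f) :+ a :* (t :* g))
      ≈-refl (5^ ε) t f g) (add (raise κ ε κ≤ x) (raise κ ε κ≤ y))
  raise κ ε κ≤ (scale z {f} x) = resp (solve 4 (λ a t z f → a :* (t :* (z :* f)) := z :* (a :* (t :* f))) ≈-refl (5^ ε) t (ι z) f) (scale z (raise κ ε κ≤ x))
  raise κ ε κ≤ (resp eq x) = resp (*-congˡ (*-congˡ eq)) (raise κ ε κ≤ x)

  ≤! : ∀ {m n} → T (m ℕ.≤ᵇ n) → m ℕ.≤ n
  ≤! {m} {n} = ℕₚ.≤ᵇ⇒≤ m n

  opaque
    U-𝓔y∈Lattice : ∀ i → Lattice i (U (𝓔 * y ^ i))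
    U-𝓔y∈Lattice 0 = resp (≈-trans U-𝓔 (solve 1 (λ e → e := # 1 :* (e :* # 1)) ≈-refl 𝓔)) (gen 0 0 z≤n z≤n)
    U-𝓔y∈Lattice 1 = resp (≈-trans U-𝓔y (solve 2 (λ e t → e :* (# 125 :* t) := # 5 :* (# 25 :* (e :* t :^ 1))) ≈-refl 𝓔 t)) (scale (+ 5) (gen 2 1 (≤! _) (≤! _)))
    U-𝓔y∈Lattice 2 = resp (≈-trans U-𝓔y² (
      solve 2 (λ e t → e :* (# 100 :* t :+ # 3125 :* t :^ 2) := # 4 :* (# 25 :* (e :* t :^ 1)) :+ # 5 :* (# 625 :* (e :* t :^ 2)))
        ≈-refl 𝓔 t)) (add (scale (+ 4) (gen 2 1 (≤! _) (≤! _))) (scale (+ 5) (gen 4 2 (≤! _) (≤! _))))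
    U-𝓔y∈Lattice 3 = resp (≈-trans U-𝓔y³ (
      solve 2 (λ e t →
        e :* (# 45 :* t :+ # 5625 :* t :^ 2 :+ # 78125 :* t :^ 3) :=
          # 9 :* (# 5 :* (e :* t :^ 1)) :+ # 9 :* (# 625 :* (e :* t :^ 2)) :+ # 5 :* (# 15625 :* (e :* t :^ 3)))
        ≈-refl 𝓔 t))
      (add (add (scale (+ 9) (gen 1 1 (≤! _) (≤! _))) (scale (+ 9) (gen 4 2 (≤! _) (≤! _)))) (scale (+ 5) (gen 6 3 (≤! _) (≤! _))))
    U-𝓔y∈Lattice 4 = resp (≈-trans U-𝓔y⁴ (
      solve 2 (λ e t →
        e :* (# 10 :* t :+ # 5500 :* t :^ 2 :+ # 218750 :* t :^ 3 :+ # 1953125 :* t :^ 4) :=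
          # 2 :* (# 5 :* (e :* t :^ 1)) :+ # 44 :* (# 125 :* (e :* t :^ 2)) :+ # 14 :* (# 15625 :* (e :* t :^ 3)) :+ # 5 :* (# 390625 :*
          (e :* t :^ 4)))
        ≈-refl 𝓔 t))
      (add (add (add (scale (+ 2) (gen 1 1 (≤! _) (≤! _))) (scale (+ 44) (gen 3 2 (≤! _) (≤! _)))) (scale (+ 14) (gen 6 3 (≤! _) (≤! _)))) (scale (+ 5) (gen 8 4 (≤! _) (≤! _))))
    U-𝓔y∈Lattice (suc i₄@(suc i₃@(suc i₂@(suc i₁@(suc i))))) = resp recurrence
      (add (add (add (add (raise 0 0 (≤! _) (U-𝓔y∈Lattice i)) (raise 1 1 (≤! _) (U-𝓔y∈Lattice i₁))) (scale (+ 3) (raise 2 1 (≤! _) (U-𝓔y∈Lattice i₂))))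
        (raise 3 2 (≤! _) (U-𝓔y∈Lattice i₃))) (raise 4 2 (≤! _) (U-𝓔y∈Lattice i₄)))
      where
      f : ℕ → Series
      f k = 𝓔 * y ^ (k ℕ.+ i)
      sum : Series
      sum = f 0 + ι (+ 5) * f 1 + ι (+ 15) * f 2 + ι (+ 25) * f 3 + ι (+ 25) * f 4
      U-sum₅ : U sum ≈ U (f 0) + ι (+ 5) * U (f 1) + ι (+ 15) * U (f 2) + ι (+ 25) * U (f 3) + ι (+ 25) * U (f 4)
      U-sum₅ = ≈-trans (ext-+ 0 _ _) (+-cong (≈-trans (ext-+ 0 _ _) (+-cong (≈-trans (ext-+ 0 _ _) (+-cong (≈-trans (ext-+ 0 _ _)
        (+-congˡ (ext-ι* 0 (+ 5) (f 1)))) (ext-ι* 0 (+ 15) (f 2)))) (ext-ι* 0 (+ 25) (f 3)))) (ext-ι* 0 (+ 25) (f 4)))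
      split : 𝓔 * y ^ (5 ℕ.+ i) ≈ V t * sum
      split =
        y⁵ ▸
        solve 4 (λ e y Y T →
          e :* (y :* (y :* (y :* (y :* (y :* Y))))) :=
            T :* (e :* Y :+ # 5 :* (e :* (y :* Y)) :+ # 15 :* (e :* (y :* (y :* Y))) :+ # 25 :* (e :* (y :* (y :* (y :* Y)))) :+ # 25 :*
            (e :* (y :* (y :* (y :* (y :* Y))))))
            :+ e :* Y :* (y :^ 5 :- T :* (# 1 :+ # 5 :* y :+ # 15 :* y :^ 2 :+ # 25 :* y :^ 3 :+ # 25 :* y :^ 4)))
          ≈-refl 𝓔 y (y ^ i) (V t)
      recurrence : U (𝓔 * y ^ (5 ℕ.+ i)) ≈ 5^ 0 * (t * U (f 0)) + 5^ 1 * (t * U (f 1)) + ι (+ 3) * (5^ 1 * (t * U (f 2))) + 5^ 2 * (t * U (f 3)) + 5^ 2 * (t * U (f 4))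
      recurrence =
        ext-cong 0 split ▸⁺ U-V* t sum ▸⁺ U-sum₅ ▸
        solve 9 (λ t a b c d e s x u →
          u := # 1 :* (t :* a) :+ # 5 :* (t :* b) :+ # 3 :* (# 5 :* (t :* c)) :+ # 25 :* (t :* d) :+ # 25 :* (t :* e) :+ (u :- x)
            :+ (x :- t :* s) :+ t :* (s :- (a :+ # 5 :* b :+ # 15 :* c :+ # 25 :* d :+ # 25 :* e)))
          ≈-refl t (U (f 0)) (U (f 1)) (U (f 2)) (U (f 3)) (U (f 4)) (U sum) (U (V t * sum)) (U (𝓔 * y ^ (5 ℕ.+ i)))

  -- Span consists of the multiples 𝓔 P^2 h(5t) with h an integer polynomial without constant term.

  data Span : Series → Set where
    gen   : ∀ l → Span (5^ suc l * (𝓔 * P ^ 2 * t ^ suc l))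
    add   : ∀ {f g} → Span f → Span g → Span (f + g)
    scale : ∀ z {f} → Span f → Span (ι z * f)
    resp  : ∀ {f g} → f ≈ g → Span g → Span f

  Span₂₅ : Series → Set
  Span₂₅ f = ∃ λ g → Span g × f ≈ ι (+ 25) * g

  module _ (Φ : Series → Series) (Φ-+ : ∀ f g → Φ (f + g) ≈ Φ f + Φ g) (Φ-scale : ∀ z f → Φ (ι z * f) ≈ ι z * Φ f) (Φ-cong : ∀ {f g} → f ≈ g → Φ f ≈ Φ g)
           (Φ-gen : ∀ l → Span₂₅ (Φ (5^ suc l * (𝓔 * P ^ 2 * t ^ suc l)))) where
    Span-image : ∀ {f} → Span f → Span₂₅ (Φ f)
    Span-image (gen l) = Φ-gen l
    Span-image (add {f} {g} x y) with Span-image x | Span-image y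
    ... | f′ , x′ , p | g′ , y′ , p′ = f′ + g′ , add x′ y′ , ≈-trans (Φ-+ f g) (≈-trans (+-cong p p′) (
      solve 2 (λ f g → # 25 :* f :+ # 25 :* g := # 25 :* (f :+ g))
        ≈-refl f′ g′))
    Span-image (scale z {f} x) with Span-image x
    ... | f′ , x′ , p = ι z * f′ , scale z x′ , ≈-trans (Φ-scale z f) (≈-trans (*-congˡ p) (
      solve 2 (λ z f → z :* (# 25 :* f) := # 25 :* (z :* f))
        ≈-refl (ι z) f′))
    Span-image (resp eq x) with Span-image x
    ... | f′ , x′ , p = f′ , x′ , ≈-trans (Φ-cong eq) p

  -- Source of the last factor 5, which `divide-unit` adds to the exponents 1 + 4k and 3 + 4k.
  Span-5 : ∀ {f} → Span f → ∃ λ g → f ≈ ι (+ 5) * g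
  Span-5 (gen l) = 5^ l * (𝓔 * P ^ 2 * t ^ suc l) , (
    5^-+ 1 l ▸
    solve 3 (λ a b x → a :* x := # 5 :* (b :* x) :+ x :* (a :- # 5 :* b))
      ≈-refl (5^ suc l) (5^ l) (𝓔 * P ^ 2 * t ^ suc l))
  Span-5 (add x y) with Span-5 x | Span-5 y
  ... | f , p | g , p′ = f + g , ≈-trans (+-cong p p′) (solve 2 (λ f g → # 5 :* f :+ # 5 :* g := # 5 :* (f :+ g)) ≈-refl f g)
  Span-5 (scale z x) with Span-5 x
  ... | f , p = ι z * f , ≈-trans (*-congˡ p) (solve 2 (λ z f → z :* (# 5 :* f) := # 5 :* (z :* f)) ≈-refl (ι z) f)
  Span-5 (resp eq x) with Span-5 x
  ... | f , p = f , ≈-trans eq p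

  -- Both sides are η(5τ)^5/η(τ). The purpose is to trade P for a series in q^5 while a t turns into
  -- y.
  P*t : P * t ≈ V P * y
  P*t = unit-cancel (E ^ 6 * F * V F) (*-const (*-const E⁶-const F-const) F-const) (
    P*F ▸ t*E⁶ ▸ y*E ▸ VP*VF ▸
    solve 8 (λ P t VP y E F z q →
      E :^ 6 :* F :* z :* (P :* t) := E :^ 6 :* F :* z :* (VP :* y) :+ E :^ 6 :* z :* t :* (P :* F :- E :^ 5)
        :+ E :^ 5 :* z :* (t :* E :^ 6 :- q :* F :^ 6) :+ :- (F :* z :* VP :* E :^ 5) :* (y :* E :- q :* z)
        :+ (# 0 :- F :* q :* z :* E :^ 5) :* (VP :* z :- F :^ 5))
      ≈-refl P t (V P) y E F (V F) q)

  P²*t : P ^ 2 * t * Δ ≈ V P ^ 2 * r * d ^ 4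
  P²*t = unit-cancel ((n₁ * n₂) ^ 2 * d ^ 6) (*-const (^-const 2 (*-const n₁-const n₂-const)) (^-const 6 d-const)) (
    P-step ▸ Δ*r ▸ d*n₁*n₂ ▸
    solve 7 (λ P VP t Δ r d m →
      m :^ 2 :* d :^ 6 :* (P :^ 2 :* t :* Δ) := m :^ 2 :* d :^ 6 :* (VP :^ 2 :* r :* d :^ 4)
        :+ d :^ 6 :* t :* Δ :* (P :* m :+ VP :* d :^ 4) :* (P :* m :- VP :* d :^ 4)
        :+ :- (VP :^ 2 :* d :^ 8 :* Δ) :* (Δ :* r :- d :^ 6 :* t) :+ :- (VP :^ 2 :* d :^ 8 :* r :* (Δ :+ d :* m)) :* (d :* m :- Δ))
      ≈-refl P (V P) t Δ r d (n₁ * n₂))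

  -- One factor t cannot absorb P^2, so the image is computed from ψ r d^4 V(P)^3 over the
  -- denominator Δ^2. `U-yt` and `U-y` are found in the same way, the latter for the leading term of
  -- E₆.
  U-t : U (𝓔 * P ^ 2 * t) ≈ ι (+ 25) * (𝓔 * P ^ 2 * t)
  U-t = unit-cancel (δ ^ 2) (^-const 2 δ-const) (
    δ^*U 2 (ψ′ :* (R :* d′ :^ 4)) (# 25 :* R :* (# 1 :+ R :^ 2)) _ dissected ▸⁺ 𝓔*δ′ ▸ t*δ ▸
    solve 6 (λ u δ ξ e P t →
      δ :^ 2 :* u := δ :^ 2 :* (# 25 :* (e :* P :^ 2 :* t)) :+ (δ :^ 2 :* u :- # 25 :* ξ :* (# 1 :+ ξ :^ 2) :* P :^ 3)
        :+ :- # 25 :* P :^ 2 :* t :* δ :* (e :* δ :- P :* (# 1 :+ ξ :^ 2)) :+ :- # 25 :* P :^ 3 :* (# 1 :+ ξ :^ 2) :* (t :* δ :- ξ))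
      ≈-refl (U (𝓔 * P ^ 2 * t)) δ ξ 𝓔 P t)
    where
    dissected : Δ ^ 2 * (𝓔 * P ^ 2 * t) ≈ ψ * (r * d ^ 4) * V (P ^ 3)
    dissected =
      𝓔*Δ ▸ P²*t ▸ V-poly (var 0F :^ 3) (P ∷ []) ▸
      solve 9 (λ Δ e P t s r d VP x →
        Δ :^ 2 :* (e :* P :^ 2 :* t) := s :* (r :* d :^ 4) :* x :+ P :^ 2 :* t :* Δ :* (e :* Δ :- VP :* s)
          :+ VP :* s :* (P :^ 2 :* t :* Δ :- VP :^ 2 :* r :* d :^ 4) :+ :- (s :* r :* d :^ 4) :* (x :- VP :^ 3))
        ≈-refl Δ 𝓔 P t ψ r d (V P) (V (P ^ 3))

  U-yt : U (y * (𝓔 * P ^ 2 * t)) ≈ - (ι (+ 25) * (𝓔 * P ^ 2 * t))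
  U-yt = unit-cancel (δ ^ 2) (^-const 2 δ-const) (
    δ^*U 2 (ψ′ :* (R :^ 2 :* d′ :^ 3)) (:- (# 25 :* R :* (# 1 :+ R :^ 2))) _ dissected ▸⁺ 𝓔*δ′ ▸ t*δ ▸
    solve 6 (λ u δ ξ e P t →
      δ :^ 2 :* u := δ :^ 2 :* :- (# 25 :* (e :* P :^ 2 :* t)) :+ (δ :^ 2 :* u :- :- (# 25 :* ξ :* (# 1 :+ ξ :^ 2)) :* P :^ 3)
        :+ # 25 :* P :^ 2 :* t :* δ :* (e :* δ :- P :* (# 1 :+ ξ :^ 2)) :+ # 25 :* P :^ 3 :* (# 1 :+ ξ :^ 2) :* (t :* δ :- ξ))
      ≈-refl (U (y * (𝓔 * P ^ 2 * t))) δ ξ 𝓔 P t)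
    where
    dissected : Δ ^ 2 * (y * (𝓔 * P ^ 2 * t)) ≈ ψ * (r ^ 2 * d ^ 3) * V (P ^ 3)
    dissected =
      𝓔*Δ ▸ P²*t ▸ y*d ▸ V-poly (var 0F :^ 3) (P ∷ []) ▸
      solve 10 (λ Δ y e P t s r d VP x →
        Δ :^ 2 :* (y :* (e :* P :^ 2 :* t)) := s :* (r :^ 2 :* d :^ 3) :* x :+ y :* P :^ 2 :* t :* Δ :* (e :* Δ :- VP :* s)
          :+ y :* VP :* s :* (P :^ 2 :* t :* Δ :- VP :^ 2 :* r :* d :^ 4) :+ VP :^ 3 :* s :* r :* d :^ 3 :* (y :* d :- r)
          :+ :- (s :* r :^ 2 :* d :^ 3) :* (x :- VP :^ 3))
        ≈-refl Δ y 𝓔 P t ψ r d (V P) (V (P ^ 3))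

  U-y : U (y * (𝓔 * P ^ 2)) ≈ 𝓔 * P ^ 2 * (ι (+ 150) * t + ι (+ 3125) * t ^ 2)
  U-y = unit-cancel (δ ^ 3) (^-const 3 δ-const) (
    δ^*U 3 (ψ′ :* (R :* d′ :^ 9)) ((# 1 :+ R :^ 2) :* (# 150 :* R :* δ′ :+ # 3125 :* R :^ 2)) _ dissected ▸⁺ ≈-refl {δ} ▸ 𝓔*δ′ ▸ t*δ ▸
    solve 6 (λ u δ ξ e P t →
      δ :^ 3 :* u := δ :^ 3 :* (e :* P :^ 2 :* (# 150 :* t :+ # 3125 :* t :^ 2))
        :+ (δ :^ 3 :* u :- (# 1 :+ ξ :^ 2) :* (# 150 :* ξ :* (# 1 :- # 11 :* ξ :- ξ :^ 2) :+ # 3125 :* ξ :^ 2) :* P :^ 3)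
        :+ :- (# 1 :+ ξ :^ 2) :* P :^ 3 :* # 150 :* ξ :* (δ :- (# 1 :- # 11 :* ξ :- ξ :^ 2))
        :+ :- (P :^ 2) :* (# 150 :* t :+ # 3125 :* t :^ 2) :* δ :^ 2 :* (e :* δ :- P :* (# 1 :+ ξ :^ 2))
        :+ :- (P :^ 3) :* (# 1 :+ ξ :^ 2) :* (# 150 :* δ :+ # 3125 :* (t :* δ :+ ξ)) :* (t :* δ :- ξ))
      ≈-refl (U (y * (𝓔 * P ^ 2))) δ ξ 𝓔 P t)
    where
    dissected : Δ ^ 3 * (y * (𝓔 * P ^ 2)) ≈ ψ * (r * d ^ 9) * V (P ^ 3)
    dissected =
      𝓔*Δ ▸ d*n₁*n₂ ▸ P-step ▸ y*d ▸ V-poly (var 0F :^ 3) (P ∷ []) ▸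
      solve 10 (λ Δ y e P s r d VP m x →
        Δ :^ 3 :* (y :* (e :* P :^ 2)) := s :* (r :* d :^ 9) :* x :+ y :* P :^ 2 :* Δ :^ 2 :* (e :* Δ :- VP :* s)
          :+ :- (y :* VP :* s :* P :^ 2 :* (Δ :+ d :* m)) :* (d :* m :- Δ)
          :+ y :* VP :* s :* d :^ 2 :* (P :* m :+ VP :* d :^ 4) :* (P :* m :- VP :* d :^ 4) :+ VP :^ 3 :* s :* d :^ 9 :* (y :* d :- r)
          :+ :- (s :* r :* d :^ 9) :* (x :- VP :^ 3))
        ≈-refl Δ y 𝓔 P ψ r d (V P) (n₁ * n₂) (V (P ^ 3))

  -- V(t)^j turns 𝓔 P^2 t^(j+2) into a multiple of 𝓔 y^(6j+2) by a series in q^5.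

  ^-+ : ∀ f m n → f ^ (m ℕ.+ n) ≈ f ^ m * f ^ n
  ^-+ f zero n = solve 1 (λ x → x := # 1 :* x) ≈-refl (f ^ n)
  ^-+ f (suc m) n =
    ^-+ f m n ▸
    solve 4 (λ f x a b → f :* x := f :* a :* b :+ f :* (x :- a :* b))
      ≈-refl f (f ^ (m ℕ.+ n)) (f ^ m) (f ^ n)

  t-cancel : ∀ j {f g} → t ^ j * f ≈ t ^ j * g → f ≈ g
  t-cancel zero {f} {g} h = h ▸⁺ solve 2 (λ f g → f := g :+ (# 1 :* f :- # 1 :* g)) ≈-refl f g
  t-cancel (suc j) {f} {g} h = t-cancel j (unit-cancel (F ^ 6) (^-const 6 F-const) (mono-cancel 1 (
    t*E⁶ ▸ h ▸
    solve 7 (λ q F E t u f g →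
      q :* (F :^ 6 :* (u :* f)) := q :* (F :^ 6 :* (u :* g)) :+ :- (u :* (f :- g)) :* (t :* E :^ 6 :- q :* F :^ 6)
        :+ E :^ 6 :* (t :* u :* f :- t :* u :* g))
      ≈-refl q F E t (t ^ j) f g)))

  y^6* : ∀ j → y ^ (6 ℕ.* j) ≈ V (t ^ j) * t ^ j
  y^6* zero = dilate-ι 4 (+ 1) ▸⁻ solve 1 (λ x → # 1 := x :* # 1 :- (x :- # 1)) ≈-refl (V (ι (+ 1)))
  y^6* (suc j) = begin
    y ^ (6 ℕ.* suc j)                       ≡⟨ cong (y ^_) (ℕₚ.*-suc 6 j) ⟩
    y ^ (6 ℕ.+ 6 ℕ.* j)                     ≈⟨ ^-+ y 6 (6 ℕ.* j) ⟩
    y ^ 6 * y ^ (6 ℕ.* j)                   ≈⟨ *-cong y⁶ (y^6* j) ⟩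
    V t * t * (V (t ^ j) * t ^ j)           ≈⟨
      solve 4 (λ a t b u → a :* t :* (b :* u) := a :* b :* (t :* u))
        ≈-refl (V t) t (V (t ^ j)) (t ^ j) ⟩
    V t * V (t ^ j) * t ^ suc j             ≈⟨ *-congʳ (dilate-* 4 0 t (t ^ j)) ⟨
    V (t ^ suc j) * t ^ suc j               ∎
    where open ≈R

  opaque
    -- A generator 5^e 𝓔 t^l of the lattice has 5l >= 6j + 2, so l = j + suc l′. The upper bound
    -- gives 5 suc l′ <= 2e + j + 3, hence suc l′ <= j + e, and 5^(2 + j + e) contains both the
    -- 5^(suc l′) demanded by `Span` and a further 25. The case ε = 0 serves U, and ε = 1 serves f ↦
    -- U (y f).
    lattice⇒Span : ∀ j ε → ε ℕ.≤ 1 → ∀ {f} → Lattice (ε ℕ.+ (2 ℕ.+ 6 ℕ.* j)) f → ∃ λ g → Span g × 5^ (2 ℕ.+ j) * (P ^ 2 * f) ≈ t ^ j * (ι (+ 25) * g)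
    lattice⇒Span j ε ε≤1 (gen e l lo hi) = 5^ x * (5^ suc l′ * (𝓔 * P ^ 2 * t ^ suc l′)) , scale (+ (5 ℕ.^ x)) (gen l′) ,
      (
        5^-+ (2 ℕ.+ j) e ▸ exponents ▸ 5^-+ 2 (x ℕ.+ suc l′) ▸ 5^-+ x (suc l′) ▸ powers ▸
        solve 12 (λ a b c s P g u w z p k i →
          a :* (P :^ 2 :* (b :* (g :* u))) := w :* (# 25 :* (c :* (s :* (g :* P :^ 2 :* z)))) :+ :- (P :^ 2 :* g :* u) :* (p :- a :* b)
            :+ P :^ 2 :* g :* u :* (p :- k) :+ P :^ 2 :* g :* u :* (k :- # 25 :* i) :+ # 25 :* P :^ 2 :* g :* u :* (i :- c :* s)
            :+ # 25 :* c :* s :* P :^ 2 :* g :* (u :- w :* z))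
          ≈-refl (5^ (2 ℕ.+ j)) (5^ e) (5^ x) (5^ suc l′) P 𝓔 (t ^ l) (t ^ j) (t ^ suc l′) (5^ (2 ℕ.+ j ℕ.+ e)) (5^ (2 ℕ.+ (x ℕ.+ suc l′)))
            (5^ (x ℕ.+ suc l′)))
      where
      j<l : j ℕ.< l
      j<l = ℕₚ.*-cancelˡ-< 5 j l (ℕₚ.<-≤-trans (s≤s (ℕₚ.*-monoˡ-≤ j (≤! {5} {6} _))) (ℕₚ.≤-trans (ℕₚ.n≤1+n _) (ℕₚ.≤-trans (ℕₚ.m≤n+m (2 ℕ.+ 6 ℕ.* j) ε) lo)))
      l′ x : ℕ
      l′ = l ℕ.∸ suc j
      l≡ : j ℕ.+ suc l′ ≡ l
      l≡ = trans (ℕₚ.+-suc j l′) (ℕₚ.m+[n∸m]≡n j<l)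
      l′<j+e : suc l′ ℕ.≤ j ℕ.+ e
      l′<j+e = ℕₚ.*-cancelˡ-≤ 2 (ℕₚ.+-cancelˡ-≤ 3 _ _ (begin
        3 ℕ.+ 2 ℕ.* suc l′                    ≤⟨ ℕₚ.m≤m+n _ (3 ℕ.* l′) ⟩
        3 ℕ.+ 2 ℕ.* suc l′ ℕ.+ 3 ℕ.* l′       ≡⟨ arith₁ l′ ⟩
        5 ℕ.* suc l′                          ≤⟨ ℕₚ.+-cancelˡ-≤ (5 ℕ.* j) _ _ bound ⟩
        3 ℕ.+ (2 ℕ.* e ℕ.+ j)                 ≤⟨ ℕₚ.m≤m+n _ j ⟩
        3 ℕ.+ (2 ℕ.* e ℕ.+ j) ℕ.+ j           ≡⟨ arith₂ e j ⟩
        3 ℕ.+ 2 ℕ.* (j ℕ.+ e)                 ∎))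
        where
        open ℕₚ.≤-Reasoning
        arith₁ : ∀ l → 3 ℕ.+ 2 ℕ.* suc l ℕ.+ 3 ℕ.* l ≡ 5 ℕ.* suc l
        arith₁ = ℕˢ.solve-∀
        arith₂ : ∀ e j → 3 ℕ.+ (2 ℕ.* e ℕ.+ j) ℕ.+ j ≡ 3 ℕ.+ 2 ℕ.* (j ℕ.+ e)
        arith₂ = ℕˢ.solve-∀
        arith₃ : ∀ e j → 2 ℕ.* e ℕ.+ (1 ℕ.+ (2 ℕ.+ 6 ℕ.* j)) ≡ 5 ℕ.* j ℕ.+ (3 ℕ.+ (2 ℕ.* e ℕ.+ j))
        arith₃ = ℕˢ.solve-∀
        bound : 5 ℕ.* j ℕ.+ 5 ℕ.* suc l′ ℕ.≤ 5 ℕ.* j ℕ.+ (3 ℕ.+ (2 ℕ.* e ℕ.+ j))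
        bound = begin
          5 ℕ.* j ℕ.+ 5 ℕ.* suc l′                 ≡⟨ ℕₚ.*-distribˡ-+ 5 j (suc l′) ⟨
          5 ℕ.* (j ℕ.+ suc l′)                     ≡⟨ cong (5 ℕ.*_) l≡ ⟩
          5 ℕ.* l                                  ≤⟨ hi ⟩
          2 ℕ.* e ℕ.+ (ε ℕ.+ (2 ℕ.+ 6 ℕ.* j))      ≤⟨ ℕₚ.+-monoʳ-≤ (2 ℕ.* e) (ℕₚ.+-monoˡ-≤ (2 ℕ.+ 6 ℕ.* j) ε≤1) ⟩
          2 ℕ.* e ℕ.+ (1 ℕ.+ (2 ℕ.+ 6 ℕ.* j))      ≡⟨ arith₃ e j ⟩
          5 ℕ.* j ℕ.+ (3 ℕ.+ (2 ℕ.* e ℕ.+ j))      ∎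
      x = j ℕ.+ e ℕ.∸ suc l′
      exponents : 5^ (2 ℕ.+ j ℕ.+ e) ≈ 5^ (2 ℕ.+ (x ℕ.+ suc l′))
      exponents = coeffwise λ n → cong (λ k → (5^ (2 ℕ.+ k)) n) (sym (ℕₚ.m∸n+n≡m l′<j+e))
      powers : t ^ l ≈ t ^ j * t ^ suc l′
      powers = ≈-trans (coeffwise λ n → cong (λ k → (t ^ k) n) (sym l≡)) (^-+ t j (suc l′))
    lattice⇒Span j ε ε≤1 (add {f} {g} x y) with lattice⇒Span j ε ε≤1 x | lattice⇒Span j ε ε≤1 y
    ... | f′ , x′ , p | g′ , y′ , p′ = f′ + g′ , add x′ y′ , (
      p ▸⁺ p′ ▸⁺
      solve 7 (λ a P f g u h k →
        a :* (P :^ 2 :* (f :+ g)) := u :* (# 25 :* (h :+ k)) :+ (a :* (P :^ 2 :* f) :- u :* (# 25 :* h))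
          :+ (a :* (P :^ 2 :* g) :- u :* (# 25 :* k)))
        ≈-refl (5^ (2 ℕ.+ j)) P f g (t ^ j) f′ g′)
    lattice⇒Span j ε ε≤1 (scale z {f} x) with lattice⇒Span j ε ε≤1 x
    ... | f′ , x′ , p = ι z * f′ , scale z x′ , (
      p ▸
      solve 6 (λ a P f z u h → a :* (P :^ 2 :* (z :* f)) := u :* (# 25 :* (z :* h)) :+ z :* (a :* (P :^ 2 :* f) :- u :* (# 25 :* h)))
        ≈-refl (5^ (2 ℕ.+ j)) P f (ι z) (t ^ j) f′)
    lattice⇒Span j ε ε≤1 (resp eq x) with lattice⇒Span j ε ε≤1 x
    ... | f′ , x′ , p = f′ , x′ , ≈-trans (*-congˡ (*-congˡ eq)) p

  opaque
    column : ∀ j ε → ε ℕ.≤ 1 → Span₂₅ (U (y ^ ε * (5^ (2 ℕ.+ j) * (𝓔 * P ^ 2 * t ^ (2 ℕ.+ j)))))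
    column j ε ε≤1 = divide (lattice⇒Span j ε ε≤1 (U-𝓔y∈Lattice (ε ℕ.+ (2 ℕ.+ 6 ℕ.* j))))
      where
      open ≈R
      X : Series
      X = y ^ ε * (5^ (2 ℕ.+ j) * (𝓔 * P ^ 2 * t ^ (2 ℕ.+ j)))
      shifted : V (t ^ j) * X ≈ V (5^ (2 ℕ.+ j) * P ^ 2) * (𝓔 * y ^ (ε ℕ.+ (2 ℕ.+ 6 ℕ.* j)))
      shifted =
        P*t ▸ y^6* j ▸ ^-+ y ε (2 ℕ.+ 6 ℕ.* j) ▸ V-poly (var 0F :* var 1F :^ 2) (5^ (2 ℕ.+ j) ∷ P ∷ []) ▸ dilate-ι 4 (+ (5 ℕ.^ (2 ℕ.+ j))) ▸
        solve 13 (λ c e P t u T y Y z w x Vc VP →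
          T :* (Y :* (c :* (e :* P :^ 2 :* (t :* (t :* u))))) := x :* (e :* w)
            :+ T :* Y :* c :* e :* u :* (P :* t :+ VP :* y) :* (P :* t :- VP :* y) :+ :- (Y :* c :* e :* VP :^ 2 :* y :^ 2) :* (z :- T :* u)
            :+ :- (c :* VP :^ 2 :* e) :* (w :- Y :* (y :* (y :* z))) :+ :- (e :* w) :* (x :- Vc :* VP :^ 2)
            :+ :- (VP :^ 2 :* e :* w) :* (Vc :- c))
          ≈-refl (5^ (2 ℕ.+ j)) 𝓔 P t (t ^ j) (V (t ^ j)) y (y ^ ε) (y ^ (6 ℕ.* j)) (y ^ (ε ℕ.+ (2 ℕ.+ 6 ℕ.* j))) (V (5^ (2 ℕ.+ j) * P ^ 2))
            (V (5^ (2 ℕ.+ j))) (V P)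
      divide : (∃ λ g → Span g × 5^ (2 ℕ.+ j) * (P ^ 2 * U (𝓔 * y ^ (ε ℕ.+ (2 ℕ.+ 6 ℕ.* j)))) ≈ t ^ j * (ι (+ 25) * g)) → Span₂₅ (U X)
      divide (g , g∈ , eq) = g , g∈ , t-cancel j (begin
        t ^ j * U X                                            ≈⟨ U-V* (t ^ j) X ⟨
        U (V (t ^ j) * X)                                      ≈⟨ ext-cong 0 shifted ⟩
        U (V (5^ (2 ℕ.+ j) * P ^ 2) * (𝓔 * y ^ (ε ℕ.+ (2 ℕ.+ 6 ℕ.* j)))) ≈⟨ U-V* (5^ (2 ℕ.+ j) * P ^ 2) _ ⟩
        5^ (2 ℕ.+ j) * P ^ 2 * U (𝓔 * y ^ (ε ℕ.+ (2 ℕ.+ 6 ℕ.* j)))       ≈⟨ *-assoc _ _ _ ⟩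
        5^ (2 ℕ.+ j) * (P ^ 2 * U (𝓔 * y ^ (ε ℕ.+ (2 ℕ.+ 6 ℕ.* j))))     ≈⟨ eq ⟩
        t ^ j * (ι (+ 25) * g)                                 ∎)

  opaque
    U-Span : ∀ {f} → Span f → Span₂₅ (U f)
    U-Span = Span-image U (ext-+ 0) (ext-ι* 0) (ext-cong 0) λ
      { zero → 5^ 1 * (𝓔 * P ^ 2 * t ^ 1) , gen 0 , ≈-trans (ext-cong 0 (
          solve 3 (λ c x t → c :* (x :* t :^ 1) := c :* (x :* t))
            ≈-refl (5^ 1) (𝓔 * P ^ 2) t)) (≈-trans (ext-ι* 0 (+ 5) (𝓔 * P ^ 2 * t))
          (
            U-t ▸
            solve 3 (λ x t u → # 5 :* u := # 25 :* (# 5 :* (x :* t :^ 1)) :+ # 5 :* (u :- # 25 :* (x :* t)))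
              ≈-refl (𝓔 * P ^ 2) t (U (𝓔 * P ^ 2 * t))))
      ; (suc j) → strip (column j 0 z≤n) }
      where
      strip : ∀ {f} → Span₂₅ (U (y ^ 0 * f)) → Span₂₅ (U f)
      strip {f} (g , g∈ , eq) = g , g∈ , ≈-trans (ext-cong 0 (solve 1 (λ f → f := # 1 :* f) ≈-refl f)) eq

  opaque
    Uy-Span : ∀ {f} → Span f → Span₂₅ (U (y * f))
    Uy-Span = Span-image (λ f → U (y * f)) (λ f g → ≈-trans (ext-cong 0 (
      solve 3 (λ y f g → y :* (f :+ g) := y :* f :+ y :* g)
        ≈-refl y f g)) (ext-+ 0 (y * f) (y * g)))
      (λ z f → ≈-trans (ext-cong 0 (solve 3 (λ y z f → y :* (z :* f) := z :* (y :* f)) ≈-refl y (ι z) f)) (ext-ι* 0 z (y * f))) (λ eq → ext-cong 0 (*-congˡ eq)) λ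
      { zero → ι -[1+ 0 ] * (5^ 1 * (𝓔 * P ^ 2 * t ^ 1)) , scale -[1+ 0 ] (gen 0) , ≈-trans (ext-cong 0 (
          solve 4 (λ c x t y → y :* (c :* (x :* t :^ 1)) := c :* (y :* (x :* t)))
            ≈-refl (5^ 1) (𝓔 * P ^ 2) t y)) (≈-trans (ext-ι* 0 (+ 5) (y * (𝓔 * P ^ 2 * t)))
          (
            U-yt ▸ ι-‿-homo (+ 1) ▸
            solve 4 (λ x t u m →
              # 5 :* u := # 25 :* (m :* (# 5 :* (x :* t :^ 1))) :+ # 5 :* (u :- :- (# 25 :* (x :* t)))
                :+ :- (# 125 :* x :* t) :* (m :- :- # 1))
              ≈-refl (𝓔 * P ^ 2) t (U (y * (𝓔 * P ^ 2 * t))) (ι -[1+ 0 ])))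
      ; (suc j) → strip (column j 1 (s≤s z≤n)) }
      where
      strip : ∀ {f} → Span₂₅ (U (y ^ 1 * f)) → Span₂₅ (U (y * f))
      strip {f} (g , g∈ , eq) = g , g∈ , ≈-trans (ext-cong 0 (solve 2 (λ y f → y :* f := y :^ 1 :* f) ≈-refl y f)) eq

  -- even k and odd k generate e₆ along the progressions modulo 5^(2k) and 5^(2k+1), shifted so that
  -- the value of index n sits at suc n; the coefficient at 0 plays no role.

  even odd : ℕ → Series
  even zero = e₆
  even (suc k) = U (odd k)
  odd k = U (q * even k)

  e₆≈ : E * e₆ ≈ E₆
  e₆≈ =
    ⊛≈* E₆ invEuler ▸ inverse-*ʳ E E-const ▸
    solve 4 (λ E X e i → E :* e := X :+ E :* (e :- X :* i) :+ X :* (E :* i :- # 1))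
      ≈-refl E E₆ e₆ (inverse E)

  opaque
    -- The term 𝓔 P^2 of E₆ lies outside `Span`; its image is 5 (6 h₀ + 25 h₁), so this first step
    -- brings out 5 instead of 25.
    U-yE₆ : ∃ λ g → Span g × U (y * E₆) ≈ ι (+ 5) * g
    U-yE₆ = collect (Uy-Span (gen 1))
      where
      h₀ h₁ : Series
      h₀ = 5^ 1 * (𝓔 * P ^ 2 * t ^ 1)
      h₁ = 5^ 2 * (𝓔 * P ^ 2 * t ^ 2)
      collect : Span₂₅ (U (y * h₁)) → ∃ λ g → Span g × U (y * E₆) ≈ ι (+ 5) * g
      -- Here 506 = 6 + 500, where 6 comes from 150 t = 5·6·(5t) in `U-y` and 500 from (-500)(-25) t
      -- = 5·500·(5t) by `U-yt`. Next, 3125 t^2 = 5·25·(25 t^2), and -625 h₁ has the image -625·25 g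
      -- = 5·(-3125) g.
      collect (g , g∈ , eq) = ι (+ 506) * h₀ + ι (+ 25) * h₁ + ι -[1+ 3124 ] * g ,
        add (add (scale (+ 506) (gen 0)) (scale (+ 25) (gen 1))) (scale -[1+ 3124 ] g∈) , (begin
          U (y * E₆)
            ≈⟨ ext-cong 0 (
                E₆-level₁ ▸ ι-‿-homo (+ 500) ▸ ι-‿-homo (+ 625) ▸
                solve 7 (λ y X e P t m n →
                  y :* X := y :* (e :* P :^ 2) :+ (m :* (y :* (e :* P :^ 2 :* t)) :+ n :* (y :* (# 25 :* (e :* P :^ 2 :* t :^ 2))))
                    :+ y :* (X :- e :* P :^ 2 :* (# 1 :- # 500 :* t :- # 15625 :* t :^ 2)) :+ :- (y :* e :* P :^ 2 :* t) :* (m :- :- # 500)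
                    :+ :- (# 25 :* y :* e :* P :^ 2 :* t :^ 2) :* (n :- :- # 625))
                  ≈-refl y E₆ 𝓔 P t (ι -[1+ 499 ]) (ι -[1+ 624 ])) ⟩
          U (y * (𝓔 * P ^ 2) + (ι -[1+ 499 ] * (y * (𝓔 * P ^ 2 * t)) + ι -[1+ 624 ] * (y * h₁)))
            ≈⟨ ≈-trans (ext-+ 0 _ _) (+-congˡ (≈-trans (ext-+ 0 _ _) (+-cong (ext-ι* 0 -[1+ 499 ] _) (ext-ι* 0 -[1+ 624 ] _)))) ⟩
          U (y * (𝓔 * P ^ 2)) + (ι -[1+ 499 ] * U (y * (𝓔 * P ^ 2 * t)) + ι -[1+ 624 ] * U (y * h₁))
            ≈⟨
                U-y ▸⁺ ι-‿-homo (+ 500) ▸ ι-‿-homo (+ 625) ▸ U-yt ▸ eq ▸ ι-‿-homo (+ 3125) ▸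
                solve 9 (λ e t g m n k a b c →
                  a :+ (m :* b :+ n :* c) := # 5 :* (# 506 :* (# 5 :* (e :* t :^ 1)) :+ # 25 :* (# 25 :* (e :* t :^ 2)) :+ k :* g)
                    :+ (a :- e :* (# 150 :* t :+ # 3125 :* t :^ 2)) :+ b :* (m :- :- # 500) :+ c :* (n :- :- # 625)
                    :+ :- # 500 :* (b :- :- (# 25 :* (e :* t))) :+ :- # 625 :* (c :- # 25 :* g) :+ :- # 5 :* g :* (k :- :- # 3125))
                  ≈-refl (𝓔 * P ^ 2) t g (ι -[1+ 499 ]) (ι -[1+ 624 ]) (ι -[1+ 3124 ]) (U (y * (𝓔 * P ^ 2))) (U (y * (𝓔 * P ^ 2 * t)))
                    (U (y * h₁)) ⟩
          ι (+ 5) * (ι (+ 506) * h₀ + ι (+ 25) * h₁ + ι -[1+ 3124 ] * g) ∎)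
        where open ≈R

    odd-zero : ∃ λ g → Span g × F * odd 0 ≈ 5^ 1 * g
    odd-zero = transfer U-yE₆
      where
      transfer : (∃ λ g → Span g × U (y * E₆) ≈ ι (+ 5) * g) → ∃ λ g → Span g × F * odd 0 ≈ 5^ 1 * g
      transfer (g , g∈ , eq) = g , g∈ , ≈-trans (≈-sym (U-V* F (q * e₆)))
        (≈-trans (ext-cong 0 (
          y*E ▸ e₆≈ ▸
          solve 6 (λ z q e y E X → z :* (q :* e) := y :* X :+ :- e :* (y :* E :- q :* z) :+ y :* (E :* e :- X))
            ≈-refl (V F) q e₆ y E E₆)) eq)

    -- As q V F = y E, one has F · U (q f) = U (V F · q f) = U (y E f): the shift by q and the
    -- passage from E to F amount to multiplication by y.
    odd-step : ∀ k m → (∃ λ g → Span g × E * even k ≈ 5^ m * g) → ∃ λ h → Span h × F * odd k ≈ 5^ (2 ℕ.+ m) * h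
    odd-step k m (g , g∈ , eq) = transfer (Uy-Span g∈)
      where
      open ≈R
      transfer : Span₂₅ (U (y * g)) → ∃ λ h → Span h × F * odd k ≈ 5^ (2 ℕ.+ m) * h
      transfer (h , h∈ , eq′) = h , h∈ , (begin
        F * U (q * even k)          ≈⟨ U-V* F (q * even k) ⟨
        U (V F * (q * even k))      ≈⟨ ext-cong 0 (
          y*E ▸ eq ▸
          solve 7 (λ z q e y E c g → z :* (q :* e) := c :* (y :* g) :+ :- e :* (y :* E :- q :* z) :+ y :* (E :* e :- c :* g))
            ≈-refl (V F) q (even k) y E (5^ m) g) ⟩
        U (5^ m * (y * g))          ≈⟨ ext-ι* 0 _ (y * g) ⟩
        5^ m * U (y * g)            ≈⟨
          eq′ ▸ 5^-+ 2 m ▸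
          solve 4 (λ c d u h → c :* u := d :* h :+ c :* (u :- # 25 :* h) :+ :- h :* (d :- # 25 :* c))
            ≈-refl (5^ m) (5^ (2 ℕ.+ m)) (U (y * g)) h ⟩
        5^ (2 ℕ.+ m) * h            ∎)

    even-step : ∀ k m → (∃ λ g → Span g × F * odd k ≈ 5^ m * g) → ∃ λ h → Span h × E * even (suc k) ≈ 5^ (2 ℕ.+ m) * h
    even-step k m (g , g∈ , eq) = transfer (U-Span g∈)
      where
      open ≈R
      transfer : Span₂₅ (U g) → ∃ λ h → Span h × E * even (suc k) ≈ 5^ (2 ℕ.+ m) * h
      transfer (h , h∈ , eq′) = h , h∈ , (begin
        E * U (odd k)               ≈⟨ U-V* E (odd k) ⟨
        U (F * odd k)               ≈⟨ ext-cong 0 eq ⟩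
        U (5^ m * g)                ≈⟨ ext-ι* 0 _ g ⟩
        5^ m * U g                  ≈⟨
          eq′ ▸ 5^-+ 2 m ▸
          solve 4 (λ c d u h → c :* u := d :* h :+ c :* (u :- # 25 :* h) :+ :- h :* (d :- # 25 :* c))
            ≈-refl (5^ m) (5^ (2 ℕ.+ m)) (U g) h ⟩
        5^ (2 ℕ.+ m) * h            ∎)

    odd-Span : ∀ k → ∃ λ g → Span g × F * odd k ≈ 5^ (1 ℕ.+ 4 ℕ.* k) * g
    even-Span : ∀ k → ∃ λ g → Span g × E * even (suc k) ≈ 5^ (3 ℕ.+ 4 ℕ.* k) * g
    odd-Span zero = odd-zero
    odd-Span (suc k) = ≡.subst (λ m → ∃ λ g → Span g × F * odd (suc k) ≈ 5^ (1 ℕ.+ m) * g) (sym (ℕₚ.*-suc 4 k)) (odd-step (suc k) (3 ℕ.+ 4 ℕ.* k) (even-Span k))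
    even-Span k = even-step k (1 ℕ.+ 4 ℕ.* k) (odd-Span k)

    divide-unit : ∀ c m {f} → c 0 ≡ + 1 → (∃ λ g → Span g × c * f ≈ 5^ m * g) → ∀ n → + (5 ℕ.^ suc m) ℤᵈ.∣ f n
    divide-unit c m {f} c0 (g , g∈ , eq) n = extract (Span-5 g∈)
      where
      extract : (∃ λ h → g ≈ ι (+ 5) * h) → + (5 ℕ.^ suc m) ℤᵈ.∣ f n
      extract (h , eq′) = ≡.subst (+ (5 ℕ.^ suc m) ℤᵈ.∣_) (sym (trans (coeff f≈ n) (ι-* (+ (5 ℕ.^ suc m)) (inverse c * h) n)))
        (≡.subst (5 ℕ.^ suc m ℕᵈ.∣_) (sym (ℤₚ.abs-* (+ (5 ℕ.^ suc m)) ((inverse c * h) n))) (ℕᵈ.m∣m*n ℤ.∣ (inverse c * h) n ∣))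
        where
        f≈ : f ≈ 5^ suc m * (inverse c * h)
        f≈ =
          inverse-*ʳ c c0 ▸ eq ▸ eq′ ▸ 5^-+ 1 m ▸
          solve 7 (λ f c i g h a b →
            f := b :* (i :* h) :+ :- f :* (c :* i :- # 1) :+ i :* (c :* f :- a :* g) :+ i :* a :* (g :- # 5 :* h)
              :+ :- (i :* h) :* (b :- # 5 :* a))
            ≈-refl f c (inverse c) g h (5^ m) (5^ suc m)

  -- The starting points of the progressions

  evenStart oddStart : ℕ → ℕ
  evenStart zero = 1
  -- U reads its coefficient at suc n from the index 5 (suc n) = suc (4 + 5n), whence the digit 4;
  -- in `oddStart` the shift by q lowers it to 3.
  evenStart (suc k) = 5 ℕ.^ (1 ℕ.+ 2 ℕ.* k) ℕ.* 4 ℕ.+ oddStart k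
  oddStart k = 5 ℕ.^ (2 ℕ.* k) ℕ.* 3 ℕ.+ evenStart k

  pow-suc : ∀ k → 5 ℕ.^ (2 ℕ.* suc k) ≡ 5 ℕ.* (5 ℕ.* 5 ℕ.^ (2 ℕ.* k))
  pow-suc k = cong (5 ℕ.^_) (ℕₚ.*-suc 2 k)

  even-coeff : ∀ k n → even k (suc n) ≡ e₆ (5 ℕ.^ (2 ℕ.* k) ℕ.* n ℕ.+ evenStart k)
  odd-coeff : ∀ k n → odd k (suc n) ≡ e₆ (5 ℕ.^ (1 ℕ.+ 2 ℕ.* k) ℕ.* n ℕ.+ oddStart k)
  even-coeff zero n = cong e₆ (arith n)
    where
    arith : ∀ n → suc n ≡ 1 ℕ.* n ℕ.+ 1
    arith = ℕˢ.solve-∀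
  even-coeff (suc k) n = trans (odd-coeff k (4 ℕ.+ n ℕ.* 5)) (cong e₆ (trans (arith (5 ℕ.^ (2 ℕ.* k)) n (oddStart k))
    (cong (λ p → p ℕ.* n ℕ.+ evenStart (suc k)) (sym (pow-suc k)))))
    where
    arith : ∀ a n s → 5 ℕ.* a ℕ.* (4 ℕ.+ n ℕ.* 5) ℕ.+ s ≡ 5 ℕ.* (5 ℕ.* a) ℕ.* n ℕ.+ (5 ℕ.* a ℕ.* 4 ℕ.+ s)
    arith = ℕˢ.solve-∀
  odd-coeff k n = trans (mono-suc-*-suc 0 (even k) (4 ℕ.+ n ℕ.* 5)) (trans (mono-0-* (even k) (4 ℕ.+ n ℕ.* 5))
    (trans (even-coeff k (3 ℕ.+ n ℕ.* 5)) (cong e₆ (arith (5 ℕ.^ (2 ℕ.* k)) n (evenStart k)))))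
    where
    arith : ∀ a n s → a ℕ.* (3 ℕ.+ n ℕ.* 5) ℕ.+ s ≡ 5 ℕ.* a ℕ.* n ℕ.+ (a ℕ.* 3 ℕ.+ s)
    arith = ℕˢ.solve-∀

  -- The cofactors solve c 5^K ≡ -1 modulo 24: as 5^2 ≡ 1, c is 23 for even K and 19 for odd K,
  -- since 5·19 = 95.
  evenStart-24 : ∀ k → 24 ℕ.* evenStart k ≡ 1 ℕ.+ 23 ℕ.* 5 ℕ.^ (2 ℕ.* k)
  oddStart-24 : ∀ k → 24 ℕ.* oddStart k ≡ 1 ℕ.+ 19 ℕ.* 5 ℕ.^ (1 ℕ.+ 2 ℕ.* k)
  evenStart-24 zero = refl
  evenStart-24 (suc k) = trans (arith (5 ℕ.^ (2 ℕ.* k)) (oddStart k)) (trans (cong (λ w → 480 ℕ.* 5 ℕ.^ (2 ℕ.* k) ℕ.+ w) (oddStart-24 k))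
    (trans (arith′ (5 ℕ.^ (2 ℕ.* k))) (cong (λ p → 1 ℕ.+ 23 ℕ.* p) (sym (pow-suc k)))))
    where
    arith : ∀ a s → 24 ℕ.* (5 ℕ.* a ℕ.* 4 ℕ.+ s) ≡ 480 ℕ.* a ℕ.+ 24 ℕ.* s
    arith = ℕˢ.solve-∀
    arith′ : ∀ a → 480 ℕ.* a ℕ.+ (1 ℕ.+ 19 ℕ.* (5 ℕ.* a)) ≡ 1 ℕ.+ 23 ℕ.* (5 ℕ.* (5 ℕ.* a))
    arith′ = ℕˢ.solve-∀
  oddStart-24 k = trans (arith (5 ℕ.^ (2 ℕ.* k)) (evenStart k)) (trans (cong (λ w → 72 ℕ.* 5 ℕ.^ (2 ℕ.* k) ℕ.+ w) (evenStart-24 k)) (arith′ (5 ℕ.^ (2 ℕ.* k))))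
    where
    arith : ∀ a s → 24 ℕ.* (a ℕ.* 3 ℕ.+ s) ≡ 72 ℕ.* a ℕ.+ 24 ℕ.* s
    arith = ℕˢ.solve-∀
    arith′ : ∀ a → 72 ℕ.* a ℕ.+ (1 ℕ.+ 23 ℕ.* a) ≡ 1 ℕ.+ 19 ℕ.* (5 ℕ.* a)
    arith′ = ℕˢ.solve-∀

  start-bound : ∀ {c s m} → c ℕ.< 24 → 1 ℕ.< m → 24 ℕ.* s ≡ 1 ℕ.+ c ℕ.* m → s ℕ.< m
  start-bound {c} {s} {m} c<24 1<m eq = ℕₚ.*-cancelˡ-< 24 s m (begin-strict
    24 ℕ.* s          ≡⟨ eq ⟩
    1 ℕ.+ c ℕ.* m     <⟨ ℕₚ.+-monoˡ-< (c ℕ.* m) 1<m ⟩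
    suc c ℕ.* m       ≤⟨ ℕₚ.*-monoˡ-≤ m c<24 ⟩
    24 ℕ.* m          ∎)
    where open ℕₚ.≤-Reasoning

  -- Modulo m one has δ ≡ δ (24 s) = s (24 δ) ≡ s, and both lie below m.
  inverse-unique : ∀ m .{{_ : ℕ.NonZero m}} {δ s c} → 0 ℕ.< δ → δ ℕ.< m → s ℕ.< m → + m ℤᵈ.∣ (+ (24 ℕ.* δ) ℤ.- + 1) → 24 ℕ.* s ≡ 1 ℕ.+ c ℕ.* m → δ ≡ s
  inverse-unique m {δ} {s} {c} 0<δ δ<m s<m d eq = finish (≡.subst (m ℕᵈ.∣_) absolute d)
    where
    1≤24δ : 1 ℕ.≤ 24 ℕ.* δ
    1≤24δ = ℕₚ.≤-trans 0<δ (ℕₚ.m≤n*m δ 24)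
    absolute : ℤ.∣ + (24 ℕ.* δ) ℤ.- + 1 ∣ ≡ 24 ℕ.* δ ℕ.∸ 1
    absolute = cong ℤ.∣_∣ (trans (ℤₚ.m-n≡m⊖n (24 ℕ.* δ) 1) (ℤₚ.⊖-≥ 1≤24δ))
    arith : ∀ δ c m → δ ℕ.+ δ ℕ.* c ℕ.* m ≡ δ ℕ.* (1 ℕ.+ c ℕ.* m)
    arith = ℕˢ.solve-∀
    swap : ∀ δ s → δ ℕ.* (24 ℕ.* s) ≡ s ℕ.* (24 ℕ.* δ)
    swap = ℕˢ.solve-∀
    finish : m ℕᵈ.∣ 24 ℕ.* δ ℕ.∸ 1 → δ ≡ s
    finish (ℕᵈ.divides x e) = begin
      δ                            ≡⟨ ℕᵐ.m<n⇒m%n≡m δ<m ⟨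
      δ ℕ.% m                      ≡⟨ ℕᵐ.[m+kn]%n≡m%n δ (δ ℕ.* c) m ⟨
      (δ ℕ.+ δ ℕ.* c ℕ.* m) ℕ.% m  ≡⟨ cong (ℕ._% m) (trans (arith δ c m) (trans (cong (δ ℕ.*_) (sym eq)) (trans (swap δ s) (trans (cong (s ℕ.*_) 24δ) (sym (arith s x m)))))) ⟩
      (s ℕ.+ s ℕ.* x ℕ.* m) ℕ.% m  ≡⟨ ℕᵐ.[m+kn]%n≡m%n s (s ℕ.* x) m ⟩
      s ℕ.% m                      ≡⟨ ℕᵐ.m<n⇒m%n≡m s<m ⟩
      s                            ∎
      where
      open ≡.≡-Reasoning
      24δ : 24 ℕ.* δ ≡ 1 ℕ.+ x ℕ.* m
      24δ = trans (sym (ℕₚ.m+[n∸m]≡n 1≤24δ)) (cong (1 ℕ.+_) e)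

  data Parity : ℕ → Set where
    isOdd  : ∀ k → Parity (1 ℕ.+ 2 ℕ.* k)
    isEven : ∀ k → Parity (2 ℕ.* suc k)

  parity : ∀ K → Parity (suc K)
  parity zero = isOdd 0
  parity (suc K) with parity K
  ... | isOdd k = ≡.subst Parity (ℕₚ.*-suc 2 k) (isEven k)
  ... | isEven k = isOdd (suc k)

  congruence : ∀ (k n δ : ℕ) → 1 ℕ.≤ k →
      0 ℕ.< δ → δ ℕ.< 5 ℕ.^ k → (+ (5 ℕ.^ k)) ℤᵈ.∣ (+ (24 ℕ.* δ) ℤ.- + 1) →
      (+ (5 ℕ.^ (2 ℕ.* k))) ℤᵈ.∣ e₆ (5 ℕ.^ k ℕ.* n ℕ.+ δ)
  congruence (suc K) n δ _ 0<δ δ<m d with parity K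
  ... | isOdd k = ≡.subst (λ s → + (5 ℕ.^ (2 ℕ.* (1 ℕ.+ 2 ℕ.* k))) ℤᵈ.∣ e₆ (5 ℕ.^ (1 ℕ.+ 2 ℕ.* k) ℕ.* n ℕ.+ s)) (sym unique)
      (≡.subst₂ (λ a b → + (5 ℕ.^ a) ℤᵈ.∣ b) (arith k) (odd-coeff k n) (divide-unit F (1 ℕ.+ 4 ℕ.* k) F-const (odd-Span k) (suc n)))
    where
    arith : ∀ k → 2 ℕ.+ 4 ℕ.* k ≡ 2 ℕ.* (1 ℕ.+ 2 ℕ.* k)
    arith = ℕˢ.solve-∀
    unique : δ ≡ oddStart k
    unique = inverse-unique _ {{ℕₚ.m^n≢0 5 (1 ℕ.+ 2 ℕ.* k)}} {c = 19} 0<δ δ<m (start-bound {19} (≤! _) (ℕₚ.≤-<-trans 0<δ δ<m) (oddStart-24 k)) d (oddStart-24 k)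
  ... | isEven k = ≡.subst (λ s → + (5 ℕ.^ (2 ℕ.* (2 ℕ.* suc k))) ℤᵈ.∣ e₆ (5 ℕ.^ (2 ℕ.* suc k) ℕ.* n ℕ.+ s)) (sym unique)
      (≡.subst₂ (λ a b → + (5 ℕ.^ a) ℤᵈ.∣ b) (arith k) (even-coeff (suc k) n) (divide-unit E (3 ℕ.+ 4 ℕ.* k) E-const (even-Span k) (suc n)))
    where
    arith : ∀ k → 4 ℕ.+ 4 ℕ.* k ≡ 2 ℕ.* (2 ℕ.* suc k)
    arith = ℕˢ.solve-∀
    unique : δ ≡ evenStart (suc k)
    unique = inverse-unique _ {{ℕₚ.m^n≢0 5 (2 ℕ.* suc k)}} {c = 23} 0<δ δ<m (start-bound {23} (≤! _) (ℕₚ.≤-<-trans 0<δ δ<m) (evenStart-24 (suc k))) d (evenStart-24 (suc k))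

open import Defs
open import Data.Nat using (ℕ; _+_; _*_; _^_; _≤_; _<_)
open import Data.Integer using (+_; _-_)
open import Data.Integer.Divisibility using (_∣_)

theorem4p12 : ∀ (k n δ : ℕ) → 1 ≤ k →
    0 < δ → δ < 5 ^ k → (+ (5 ^ k)) ∣ (+ (24 * δ) - + 1) →
    (+ (5 ^ (2 * k))) ∣ e₆ (5 ^ k * n + δ)
theorem4p12 = PowersOfFive.congruence
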